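{- Let $n$ and $k$ be integers with $n\geq 2k\geq 4$. Then $$\chi(\overline{K}(n,k))\leq h_o(\overline{K}(n,k)).$$ Moreover, there exists an integer $t=t(n,k)\geq \chi(\overline{K}(n,k))$ such that $\overline{K}(n,k)$ contains a strongly $1$-shallow $K_t$-minor. Furthermore, if $k\geq 3$, then $$h_o(\overline{K}(n,k))-\chi(\overline{K}(n,k))\geq \begin{cases}\frac{1}{12}\left(1.5^{k-1}-8k-2\right), & \text{if } 2k+1\leq n\leq 3k-2,\\[2pt] \frac{1}{6}\left(1.5^{k-1}-11\right), & \text{if } n=3k-1.\end{cases}$$
   Context: For integers $n\ge 2k\ge 4$, the Kneser graph $K(n,k)$ has as vertices the $k$-element subsets of $[n]=\{1,\dots,n\}$, two being adjacent iff they are disjoint; $\overline{K}(n,k)$ is its complement (two $k$-subsets adjacent iff they are distinct and intersect). $\chi$ denotes chromatic number. A signed graph $(G,\sigma)$ is a graph $G$ with a map $\sigma:E(G)\to\{+,-\}$. Switching at a vertex $x$ changes the sign of every edge incident with $x$; signed graphs obtained from each other by a sequence of switchings are switching equivalent. A signed graph $(H,\pi)$ is a minor of $(G,\sigma)$ if there exist a signature $\tau$ switching equivalent to $\sigma$ and pairwise vertex-disjoint subgraphs $B_x$ of $G$ ($x\in V(H)$) such that (i) for each $x$, the positive edges of $B_x$ under $\tau$ form a connected spanning subgraph of $B_x$, and (ii) for each edge $xy$ of $H$ there is an edge $uv$ of $G$ with $u\in V(B_x)$, $v\in V(B_y)$ and $\tau(uv)=\pi(xy)$. $(G,-)$ denotes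 $G$ with all edges negative. The odd Hadwiger number $h_o(G)$ is the largest $t$ such that $(K_t,-)$ is a minor of $(G,-)$. A $K_t$-minor of a graph $G$ is given by $t$ pairwise vertex-disjoint connected subgraphs (bags) of $G$, any two of which are joined by an edge of $G$. A star is $K_{1,s}$ for some $s\ge1$. A $K_t$-minor is strongly $1$-shallow if each bag is either a single vertex or a star, and for every two bags there is a connecting edge of $G$ each of whose endpoints is either the unique vertex of a single-vertex bag or a leaf vertex of a star bag. -}

module Defs where

open import Algebra.Definitions.RawSemiring using (_^_)
open import Data.Bool.Base using (Bool; T; _∧_; _∨_; if_then_else_)
open import Data.Bool.Properties using (T?; ∨-comm; T-∧)
open import Data.Empty using (⊥-elim)
open import Data.Fin.Base using (Fin)
import Data.Fin.Properties as Fin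
open import Data.Fin.Subset using (Subset; inside; outside; _∩_; ∣_∣; Empty)
open import Data.Fin.Subset.Properties using (nonempty?; ∩-comm)
import Data.Integer.Base as ℤ
open import Data.List.Base as List using (List; []; _∷_; _++_; foldr; length)
open import Data.List.Membership.Propositional using (_∈_; find; lose)
open import Data.List.Membership.Propositional.Properties using (∈-map⁺; ∈-++⁺ˡ; ∈-++⁺ʳ)
open import Data.List.Relation.Unary.Any using (any?; here; there; index)
open import Data.List.Relation.Unary.Any.Properties using (lookup-index)
open import Data.Maybe.Base using (Maybe; just; nothing)
open import Data.Maybe.Properties using (just-injective) renaming (≡-dec to ≡-decMaybe)
open import Data.Nat.Base using (ℕ; zero; suc; _≤_; z≤n; s≤s)
import Data.Nat.Properties as ℕ
open import Data.Product.Base using (Σ; ∃; ∃-syntax; _×_; _,_; proj₁; proj₂)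
open import Data.Rational.Base as ℚ using (ℚ)
open import Data.Sign.Base as Sign using (Sign; opposite)
import Data.Sign.Properties as Sign
open import Data.Sum.Base using (_⊎_; inj₁; inj₂)
open import Data.Vec.Base using (Vec; []; _∷_; lookup; tabulate)
open import Data.Vec.Properties using (lookup∘tabulate; ≡-dec)
import Data.Bool.Properties as Bool
open import Function.Base using (_∘_)
open import Function.Bundles using (_⇔_; module Equivalence)
open import Relation.Binary.Construct.Closure.ReflexiveTransitive using (Star; ε; _◅_; _◅◅_)
import Relation.Binary.Construct.Closure.ReflexiveTransitive as Star
open import Relation.Binary.Definitions using (DecidableEquality)
open import Relation.Binary.PropositionalEquality
open import Relation.Nullary
open import Relation.Nullary.Decidable using (⌊_⌋; toWitness; fromWitness)

------------------------------------------------------------------------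
-- Extremal natural numbers

IsLeast IsGreatest : (ℕ → Set) → ℕ → Set
IsLeast    P m = P m × (∀ {n} → P n → m ≤ n)
IsGreatest P m = P m × (∀ {n} → P n → n ≤ m)

least : ∀ {P : ℕ → Set} → (∀ n → Dec (P n)) → ∀ b → P b → ∃ (IsLeast P)
least P? b pb with P? 0
least P? b       pb | yes p0 = 0 , p0 , λ _ → z≤n
least P? zero    pb | no ¬p0 = ⊥-elim (¬p0 pb)
least {P} P? (suc b) pb | no ¬p0 with least (P? ∘ suc) b pb
... | m , pm , min = suc m , pm , bound
  where
  bound : ∀ {n} → P n → suc m ≤ n
  bound {zero}  p = ⊥-elim (¬p0 p)
  bound {suc n} p = s≤s (min p)

greatest : ∀ {P : ℕ → Set} → (∀ n → Dec (P n)) → P 0 →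
           ∀ b → (∀ {n} → P n → n ≤ b) → ∃ (IsGreatest P)
greatest P? p0 b bound with P? b
greatest P? p0 b       bound | yes pb = b , pb , bound
greatest P? p0 zero    bound | no ¬pb = ⊥-elim (¬pb p0)
greatest P? p0 (suc b) bound | no ¬pb = greatest P? p0 b λ p →
  ℕ.≤-pred (ℕ.≤∧≢⇒< (bound p) λ { refl → ¬pb p })

------------------------------------------------------------------------
-- Finite simple graphs

record Graph : Set₁ where
  field
    Vertex      : Set
    _≟ᵛ_        : DecidableEquality Vertex
    vertices    : List Vertex
    complete    : ∀ v → v ∈ vertices
    Adj         : Vertex → Vertex → Set
    adj?        : ∀ u v → Dec (Adj u v)
    adj-sym     : ∀ {u v} → Adj u v → Adj v u
    irreflexive : ∀ {v} → ¬ Adj v v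

open Graph public using (Vertex; Adj)

complement : Graph → Graph
complement G = record
  { Vertex      = G.Vertex
  ; _≟ᵛ_        = G._≟ᵛ_
  ; vertices    = G.vertices
  ; complete    = G.complete
  ; Adj         = λ u v → u ≢ v × ¬ G.Adj u v
  ; adj?        = λ u v → ¬? (u G.≟ᵛ v) ×-dec ¬? (G.adj? u v)
  ; adj-sym     = λ (u≢v , ¬uv) → u≢v ∘ sym , ¬uv ∘ G.adj-sym
  ; irreflexive = λ (v≢v , _) → v≢v refl
  }
  where module G = Graph G

K : ℕ → Graph
K t = record
  { Vertex      = Fin t
  ; _≟ᵛ_        = Fin._≟_
  ; vertices    = List.allFin t
  ; complete    = ∈-allFin
  ; Adj         = _≢_
  ; adj?        = λ i j → ¬? (i Fin.≟ j)
  ; adj-sym     = λ i≢j → i≢j ∘ sym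
  ; irreflexive = λ i≢i → i≢i refl
  }
  where open import Data.List.Membership.Propositional.Properties using (∈-allFin)

------------------------------------------------------------------------
-- Kneser graphs

KSubset : ℕ → ℕ → Set
KSubset n k = Σ (Subset n) λ A → ∣ A ∣ ≡ k

kSubset-≡ : ∀ {n k} {A B : KSubset n k} → proj₁ A ≡ proj₁ B → A ≡ B
kSubset-≡ {A = A , p} {.A , q} refl = cong (A ,_) (ℕ.≡-irrelevant p q)

_≟ˢ_ : ∀ {n k} → DecidableEquality (KSubset n k)
(A , p) ≟ˢ (B , q) = map′ kSubset-≡ (cong proj₁) (≡-dec Bool._≟_ A B)

addOutside : ∀ {n k} → KSubset n k → KSubset (suc n) k
addOutside (A , p) = outside ∷ A , p

addInside : ∀ {n k} → KSubset n k → KSubset (suc n) (suc k)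
addInside (A , p) = inside ∷ A , cong suc p

kSubsets : ∀ n k → List (KSubset n k)
kSubsets zero    zero    = ([] , refl) ∷ []
kSubsets zero    (suc k) = []
kSubsets (suc n) zero    = List.map addOutside (kSubsets n zero)
kSubsets (suc n) (suc k) =
  List.map addOutside (kSubsets n (suc k)) ++ List.map addInside (kSubsets n k)

∈-kSubsets : ∀ n k (A : KSubset n k) → A ∈ kSubsets n k
∈-kSubsets zero    zero    ([] , p) = here (kSubset-≡ refl)
∈-kSubsets zero    (suc k) ([] , ())
∈-kSubsets (suc n) zero    (outside ∷ A , p) = ∈-map⁺ addOutside (∈-kSubsets n zero (A , p))
∈-kSubsets (suc n) zero    (inside ∷ A , ())
∈-kSubsets (suc n) (suc k) (outside ∷ A , p) =
  ∈-++⁺ˡ (∈-map⁺ addOutside (∈-kSubsets n (suc k) (A , p)))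
∈-kSubsets (suc n) (suc k) (inside ∷ A , p) =
  subst (_∈ kSubsets (suc n) (suc k)) (kSubset-≡ refl)
    (∈-++⁺ʳ (List.map addOutside (kSubsets n (suc k)))
      (∈-map⁺ addInside (∈-kSubsets n k (A , ℕ.suc-injective p))))

-- For k ≥ 1 disjoint k-subsets are automatically distinct; the condition
-- A ≢ B only keeps the graph loopless in the degenerate case k = 0.
kneser : ℕ → ℕ → Graph
kneser n k = record
  { Vertex      = KSubset n k
  ; _≟ᵛ_        = _≟ˢ_
  ; vertices    = kSubsets n k
  ; complete    = ∈-kSubsets n k
  ; Adj         = λ A B → A ≢ B × Empty (proj₁ A ∩ proj₁ B)
  ; adj?        = λ A B → ¬? (A ≟ˢ B) ×-dec ¬? (nonempty? (proj₁ A ∩ proj₁ B))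
  ; adj-sym     = λ {A} {B} (A≢B , e) →
                    A≢B ∘ sym , subst Empty (∩-comm (proj₁ A) (proj₁ B)) e
  ; irreflexive = λ (A≢A , _) → A≢A refl
  }

K̄ : ℕ → ℕ → Graph
K̄ n k = complement (kneser n k)

------------------------------------------------------------------------
-- Colourings

Colourable : Graph → ℕ → Set
Colourable G c = Σ (Vertex G → Fin c) λ f → ∀ u v → Adj G u v → f u ≢ f v

IsChromaticNumber : Graph → ℕ → Set
IsChromaticNumber G = IsLeast (Colourable G)

------------------------------------------------------------------------
-- Subgraphs

record Subgraph (G : Graph) : Set where
  field
    hasVertex : Vertex G → Bool
    hasEdge   : Vertex G → Vertex G → Bool
    edge-sym  : ∀ {u v} → T (hasEdge u v) → T (hasEdge v u)
    edge-adj  : ∀ {u v} → T (hasEdge u v) → Adj G u v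
    edge-ends : ∀ {u v} → T (hasEdge u v) → T (hasVertex u) × T (hasVertex v)

open Subgraph public using (hasVertex; hasEdge)

module _ {G : Graph} where

  infix 4 _∈ᵛ_
  _∈ᵛ_ : Vertex G → Subgraph G → Set
  v ∈ᵛ B = T (hasVertex B v)

  Edge : Subgraph G → Vertex G → Vertex G → Set
  Edge B u v = T (hasEdge B u v)

  Connected : Subgraph G → Set
  Connected B = (∃[ v ] v ∈ᵛ B) × (∀ {u v} → u ∈ᵛ B → v ∈ᵛ B → Star (Edge B) u v)

  PairwiseDisjoint : {I : Set} → (I → Subgraph G) → Set
  PairwiseDisjoint B = ∀ {x y} → x ≢ y → ∀ {v} → v ∈ᵛ B x → ¬ v ∈ᵛ B y

------------------------------------------------------------------------
-- Signed graphs

-- A signature assigns a sign to every pair of vertices; only its values on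
-- adjacent pairs are meaningful.
record Signature (G : Graph) : Set where
  field
    sign     : Vertex G → Vertex G → Sign
    sign-sym : ∀ u v → sign u v ≡ sign v u

open Signature public using (sign; sign-sym)

allNegative : (G : Graph) → Signature G
allNegative G = record { sign = λ _ _ → Sign.- ; sign-sym = λ _ _ → refl }

module _ {G : Graph} where
  open Graph G using (_≟ᵛ_)

  switch : Vertex G → Signature G → Signature G
  switch x σ = record
    { sign     = λ u v → if does (u ≟ᵛ x) ∨ does (v ≟ᵛ x)
                         then opposite (sign σ u v) else sign σ u v
    ; sign-sym = λ u v → cong₂ (λ b s → if b then opposite s else s)
                           (∨-comm (does (u ≟ᵛ x)) (does (v ≟ᵛ x))) (sign-sym σ u v)
    }

  SwitchingEquivalent : Signature G → Signature G → Set
  SwitchingEquivalent σ τ =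
    ∃[ xs ] ∀ u v → Adj G u v → sign τ u v ≡ sign (foldr switch σ xs) u v

  positivePart : Signature G → Subgraph G → Subgraph G
  positivePart τ B = record
    { hasVertex = hasVertex B
    ; hasEdge   = λ u v → hasEdge B u v ∧ positive u v
    ; edge-sym  = λ {u} {v} e → let (uv , p) = Equivalence.to T-∧ e in
        Equivalence.from T-∧ (B.edge-sym uv , subst (T ∘ isPositive) (sign-sym τ u v) p)
    ; edge-adj  = λ e → B.edge-adj (proj₁ (Equivalence.to T-∧ e))
    ; edge-ends = λ e → B.edge-ends (proj₁ (Equivalence.to T-∧ e))
    }
    where
    module B = Subgraph B
    isPositive : Sign → Bool
    isPositive s = ⌊ s Sign.≟ Sign.+ ⌋
    positive : Vertex G → Vertex G → Bool
    positive u v = isPositive (sign τ u v)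

record SignedMinor (H : Graph) (π : Signature H) (G : Graph) (σ : Signature G) : Set where
  field
    τ          : Signature G
    equivalent : SwitchingEquivalent σ τ
    bag        : Vertex H → Subgraph G
    disjoint   : PairwiseDisjoint bag
    connected  : ∀ x → Connected (positivePart τ (bag x))
    edges      : ∀ x y → Adj H x y →
                 ∃[ u ] ∃[ v ] Adj G u v × u ∈ᵛ bag x × v ∈ᵛ bag y × sign τ u v ≡ sign π x y

OddMinor : Graph → ℕ → Set
OddMinor G t = SignedMinor (K t) (allNegative (K t)) G (allNegative G)

IsOddHadwigerNumber : Graph → ℕ → Set
IsOddHadwigerNumber G = IsGreatest (OddMinor G)

------------------------------------------------------------------------
-- Strongly 1-shallow complete minors

record CompleteMinor (G : Graph) (t : ℕ) : Set where
  field
    bag       : Fin t → Subgraph G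
    disjoint  : PairwiseDisjoint bag
    connected : ∀ i → Connected (bag i)
    edges     : ∀ i j → i ≢ j → ∃[ u ] ∃[ v ] Adj G u v × u ∈ᵛ bag i × v ∈ᵛ bag j

module _ {G : Graph} where

  IsSingleVertex : Subgraph G → Vertex G → Set
  IsSingleVertex B v = ∀ w → w ∈ᵛ B ⇔ w ≡ v

  -- B is a star K_{1,s} with s ≥ 1 and centre c.
  record IsStar (B : Subgraph G) (c : Vertex G) : Set where
    field
      centre  : c ∈ᵛ B
      leaf    : ∃[ v ] v ∈ᵛ B × v ≢ c
      centred : ∀ u v → Edge B u v ⇔
                  ((u ≡ c × v ∈ᵛ B × v ≢ c) ⊎ (v ≡ c × u ∈ᵛ B × u ≢ c))

  data Shape (B : Subgraph G) : Set where
    single : ∀ v → IsSingleVertex B v → Shape B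
    star   : ∀ c → IsStar B c → Shape B

  -- The vertices of a bag at which connecting edges may end.  In a bag K_{1,1}
  -- exactly one of the two vertices counts as a leaf, the other being the
  -- centre chosen by the shape.
  Terminal : {B : Subgraph G} → Shape B → Vertex G → Set
  Terminal {B} (single v _) u = u ≡ v
  Terminal {B} (star c _)   u = u ∈ᵛ B × u ≢ c

StronglyOneShallow : ∀ {G t} → CompleteMinor G t → Set
StronglyOneShallow {G} {t} M =
  Σ (∀ i → Shape (bag i)) λ shape →
    ∀ i j → i ≢ j → ∃[ u ] ∃[ v ] Adj G u v × Terminal (shape i) u × Terminal (shape j) v
  where open CompleteMinor M

------------------------------------------------------------------------
-- Existence of the two invariants, by exhaustive search

Searchable : Set → Set₁
Searchable A = ∀ {P : A → Set} → (∀ a → Dec (P a)) → Dec (∃ P)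

every : ∀ {A} → Searchable A → ∀ {P : A → Set} → (∀ a → Dec (P a)) → Dec (∀ a → P a)
every search P? = map′
  (λ none a → decidable-stable (P? a) (λ ¬p → none (a , ¬p)))
  (λ all (a , ¬p) → ¬p (all a))
  (¬? (search (λ a → ¬? (P? a))))

search-Sign : Searchable Sign
search-Sign P? = map′
  (λ { (inj₁ p) → Sign.- , p ; (inj₂ p) → Sign.+ , p })
  (λ { (Sign.- , p) → inj₁ p ; (Sign.+ , p) → inj₂ p })
  (P? Sign.- ⊎-dec P? Sign.+)

search-Maybe : ∀ {A} → Searchable A → Searchable (Maybe A)
search-Maybe search P? = map′
  (λ { (inj₁ p) → nothing , p ; (inj₂ (a , p)) → just a , p })
  (λ { (nothing , p) → inj₁ p ; (just a , p) → inj₂ (a , p) })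
  (P? nothing ⊎-dec search (P? ∘ just))

search-Vec : ∀ {A} → Searchable A → ∀ n → Searchable (Vec A n)
search-Vec search zero    P? = map′ ([] ,_) (λ { ([] , p) → p }) (P? [])
search-Vec search (suc n) P? = map′
  (λ (a , as , p) → a ∷ as , p)
  (λ { (a ∷ as , p) → a , as , p })
  (search λ a → search-Vec search n λ as → P? (a ∷ as))

module Existence (G : Graph) where
  open Graph G using (_≟ᵛ_; vertices; complete; adj?; adj-sym; irreflexive)

  private
    V = Vertex G
    N = length vertices

    search-V : Searchable V
    search-V P? = map′ (λ p → let (v , _ , pv) = find p in v , pv)
                       (λ (v , pv) → lose (complete v) pv)
                       (any? P? vertices)

    position : V → Fin N
    position v = index (complete v)

    at-position : ∀ v → List.lookup vertices (position v) ≡ v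
    at-position v = sym (lookup-index (complete v))

    position-injective : ∀ {u v} → position u ≡ position v → u ≡ v
    position-injective {u} {v} eq =
      trans (sym (at-position u)) (trans (cong (List.lookup vertices) eq) (at-position v))

    decode : ∀ {A : Set} → Vec A N → V → A
    decode as v = lookup as (position v)

    encode : ∀ {A : Set} → (V → A) → Vec A N
    encode f = tabulate (f ∘ List.lookup vertices)

    decode-encode : ∀ {A : Set} (f : V → A) v → decode (encode f) v ≡ f v
    decode-encode f v = trans (lookup∘tabulate _ (position v)) (cong f (at-position v))

  colourable? : ∀ c → Dec (Colourable G c)
  colourable? c = map′
    (λ (as , ok) → decode as , ok)
    (λ (f , ok) → encode f , λ u v uv eq →
      ok u v uv (trans (sym (decode-encode f u)) (trans eq (decode-encode f v))))
    (search-Vec Fin.any? N λ as →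
      every search-V λ u → every search-V λ v →
        adj? u v →-dec ¬? (decode as u Fin.≟ decode as v))

  -- Floyd–Warshall: walks whose inner vertices lie in a given list.
  private module Reachability (R : V → V → Set) (R? : ∀ u v → Dec (R u v)) where

    Path : List V → V → V → Set
    Path []       u v = u ≡ v ⊎ R u v
    Path (x ∷ xs) u v = Path xs u v ⊎ (Path xs u x × Path xs x v)

    path? : ∀ xs u v → Dec (Path xs u v)
    path? []       u v = u ≟ᵛ v ⊎-dec R? u v
    path? (x ∷ xs) u v = path? xs u v ⊎-dec (path? xs u x ×-dec path? xs x v)

    path⇒star : ∀ xs {u v} → Path xs u v → Star R u v
    path⇒star []       (inj₁ refl)    = ε
    path⇒star []       (inj₂ r)       = r ◅ ε
    path⇒star (x ∷ xs) (inj₁ p)       = path⇒star xs p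
    path⇒star (x ∷ xs) (inj₂ (p , q)) = path⇒star xs p ◅◅ path⇒star xs q

    base : ∀ xs {u v} → u ≡ v ⊎ R u v → Path xs u v
    base []       p = p
    base (x ∷ xs) p = inj₁ (base xs p)

    join : ∀ {xs x u v} → x ∈ xs → Path xs u x → Path xs x v → Path xs u v
    join (here refl) p q = inj₂ (first p , second q)
      where
      first : ∀ {xs x u} → Path (x ∷ xs) u x → Path xs u x
      first (inj₁ p)       = p
      first (inj₂ (p , _)) = p
      second : ∀ {xs x v} → Path (x ∷ xs) x v → Path xs x v
      second (inj₁ q)       = q
      second (inj₂ (_ , q)) = q
    join (there i) (inj₁ p)        (inj₁ q)        = inj₁ (join i p q)
    join (there i) (inj₁ p)        (inj₂ (q , q′)) = inj₂ (join i p q , q′)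
    join (there i) (inj₂ (p , p′)) (inj₁ q)        = inj₂ (p , join i p′ q)
    join (there i) (inj₂ (p , _))  (inj₂ (_ , q′)) = inj₂ (p , q′)

    star⇒path : ∀ {u v} → Star R u v → Path vertices u v
    star⇒path ε        = base vertices (inj₁ refl)
    star⇒path (r ◅ rs) = join (complete _) (base vertices (inj₂ r)) (star⇒path rs)

    star? : ∀ u v → Dec (Star R u v)
    star? u v = map′ (path⇒star vertices) star⇒path (path? vertices u v)

  private
    -- The effect of a sequence of switchings is multiplication by p u * p v,
    -- where p x records how often x is switched, modulo 2.

    flip : V → V → Sign → Sign
    flip x u s = if does (u ≟ᵛ x) then opposite s else s

    parity : List V → V → Sign
    parity xs u = foldr (λ x → flip x u) Sign.+ xs

    switched : (V → Sign) → V → V → Sign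
    switched p u v = p u Sign.* p v Sign.* Sign.-

    switchings : List V → Signature G
    switchings = foldr switch (allNegative G)

    switchings-parity : ∀ xs {u v} → u ≢ v → sign (switchings xs) u v ≡ switched (parity xs) u v
    switchings-parity []       u≢v = refl
    switchings-parity (x ∷ xs) {u} {v} u≢v
      rewrite switchings-parity xs u≢v with u ≟ᵛ x | v ≟ᵛ x
    ... | yes refl | yes refl = ⊥-elim (u≢v refl)
    ... | yes _    | no _     = left (parity xs u) (parity xs v)
      where
      left : ∀ s t → opposite (s Sign.* t Sign.* Sign.-) ≡ opposite s Sign.* t Sign.* Sign.-
      left Sign.- Sign.- = refl
      left Sign.- Sign.+ = refl
      left Sign.+ Sign.- = refl
      left Sign.+ Sign.+ = refl
    ... | no _     | yes _    = right (parity xs u) (parity xs v)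
      where
      right : ∀ s t → opposite (s Sign.* t Sign.* Sign.-) ≡ s Sign.* opposite t Sign.* Sign.-
      right Sign.- Sign.- = refl
      right Sign.- Sign.+ = refl
      right Sign.+ Sign.- = refl
      right Sign.+ Sign.+ = refl
    ... | no _     | no _     = refl

    opposite-≢ : ∀ {s t} → s ≢ t → opposite s ≡ t
    opposite-≢ {Sign.-} {Sign.-} s≢t = ⊥-elim (s≢t refl)
    opposite-≢ {Sign.-} {Sign.+} s≢t = refl
    opposite-≢ {Sign.+} {Sign.-} s≢t = refl
    opposite-≢ {Sign.+} {Sign.+} s≢t = ⊥-elim (s≢t refl)

    realise : (p : V → Sign) (ys : List V) → ∃[ xs ] ∀ {u} → u ∈ ys → parity xs u ≡ p u
    realise p []       = [] , λ ()
    realise p (y ∷ ys) with realise p ys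
    ... | xs , ok with parity xs y Sign.≟ p y
    ...   | yes eq = xs , λ { (here refl) → eq ; (there i) → ok i }
    ...   | no ¬eq = y ∷ xs , flipped
      where
      flipped : ∀ {u} → u ∈ y ∷ ys → parity (y ∷ xs) u ≡ p u
      flipped {u} i with u ≟ᵛ y
      flipped {u} i           | yes refl = opposite-≢ ¬eq
      flipped {u} (here refl) | no u≢y   = ⊥-elim (u≢y refl)
      flipped {u} (there i)   | no _     = ok i

  module _ (t : ℕ) where
    private
      -- A minor is encoded by the switched vertices and a partial map sending
      -- a vertex to the bag containing it; bags are taken to be induced.
      Step : (V → Sign) → (V → Maybe (Fin t)) → Fin t → V → V → Set
      Step p a i u v = a u ≡ just i × a v ≡ just i × Adj G u v × switched p u v ≡ Sign.+

      Encoded : (V → Sign) → (V → Maybe (Fin t)) → Set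
      Encoded p a =
        (∀ i → ∃[ v ] a v ≡ just i) ×
        (∀ i u v → a u ≡ just i → a v ≡ just i → Star (Step p a i) u v) ×
        (∀ i j → i ≢ j → ∃[ u ] ∃[ v ]
          Adj G u v × a u ≡ just i × a v ≡ just j × switched p u v ≡ Sign.-)

      _≟ᵐ_ : DecidableEquality (Maybe (Fin t))
      _≟ᵐ_ = ≡-decMaybe Fin._≟_

      step? : ∀ p a i u v → Dec (Step p a i u v)
      step? p a i u v =
        (a u ≟ᵐ just i) ×-dec (a v ≟ᵐ just i) ×-dec adj? u v ×-dec (switched p u v Sign.≟ Sign.+)

      encoded? : ∀ p a → Dec (Encoded p a)
      encoded? p a =
        (Fin.all? λ i → search-V λ v → a v ≟ᵐ just i) ×-dec
        (Fin.all? λ i → every search-V λ u → every search-V λ v →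
          (a u ≟ᵐ just i) →-dec ((a v ≟ᵐ just i) →-dec
            Reachability.star? (Step p a i) (step? p a i) u v)) ×-dec
        (Fin.all? λ i → Fin.all? λ j → ¬? (i Fin.≟ j) →-dec
          (search-V λ u → search-V λ v →
            adj? u v ×-dec (a u ≟ᵐ just i) ×-dec (a v ≟ᵐ just j) ×-dec
            (switched p u v Sign.≟ Sign.-)))

      toMinor : ∀ {p a} → Encoded p a → OddMinor G t
      toMinor {p} {a} (nonempty , reach , joined) = record
        { τ          = τ
        ; equivalent = xs , λ _ _ _ → refl
        ; bag        = bag
        ; disjoint   = λ i≢j v∈i v∈j →
            i≢j (just-injective (trans (sym (toWitness v∈i)) (toWitness v∈j)))
        ; connected  = λ i →
            (let (v , eq) = nonempty i in v , fromWitness eq) ,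
            λ u∈ v∈ → Star.map step (reach i _ _ (toWitness u∈) (toWitness v∈))
        ; edges      = λ i j i≢j → let (u , v , uv , au , av , neg) = joined i j i≢j in
            u , v , uv , fromWitness au , fromWitness av , trans (τ-switched uv) neg
        }
        where
        xs = proj₁ (realise p vertices)
        τ  = switchings xs

        τ-switched : ∀ {u v} → Adj G u v → sign τ u v ≡ switched p u v
        τ-switched {u} {v} uv = trans
          (switchings-parity xs (λ { refl → irreflexive uv }))
          (cong₂ (λ s s′ → s Sign.* s′ Sign.* Sign.-)
            (proj₂ (realise p vertices) (complete u)) (proj₂ (realise p vertices) (complete v)))

        inBag? : ∀ i u v → Dec (a u ≡ just i × a v ≡ just i × Adj G u v)
        inBag? i u v = (a u ≟ᵐ just i) ×-dec (a v ≟ᵐ just i) ×-dec adj? u v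

        bag : Fin t → Subgraph G
        bag i = record
          { hasVertex = λ v → ⌊ a v ≟ᵐ just i ⌋
          ; hasEdge   = λ u v → ⌊ inBag? i u v ⌋
          ; edge-sym  = λ {u} {v} e → let (au , av , uv) = toWitness {a? = inBag? i u v} e in
              fromWitness {a? = inBag? i v u} (av , au , adj-sym uv)
          ; edge-adj  = λ {u} {v} e → proj₂ (proj₂ (toWitness {a? = inBag? i u v} e))
          ; edge-ends = λ {u} {v} e → let (au , av , uv) = toWitness {a? = inBag? i u v} e in
              fromWitness au , fromWitness av
          }

        step : ∀ {i u v} → Step p a i u v → Edge (positivePart τ (bag i)) u v
        step {i} {u} {v} (au , av , uv , pos) = Equivalence.from T-∧
          ( fromWitness {a? = inBag? i u v} (au , av , uv)
          , fromWitness {a? = sign τ u v Sign.≟ Sign.+} (trans (τ-switched uv) pos))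

      fromMinor : OddMinor G t →
        Σ (Vec Sign N) λ ps → Σ (Vec (Maybe (Fin t)) N) λ as → Encoded (decode ps) (decode as)
      fromMinor M = encode q , encode b ,
        (λ i → let (v , v∈) = proj₁ (connected i) in v , assign v∈) ,
        (λ i u v au av → Star.map step (proj₂ (connected i) (unassign au) (unassign av))) ,
        (λ i j i≢j → let (u , v , uv , u∈ , v∈ , neg) = edges i j i≢j in
          u , v , uv , assign u∈ , assign v∈ , trans (sym (τ-switched uv)) neg)
        where
        open SignedMinor M

        q : V → Sign
        q = parity (proj₁ equivalent)

        owner : ∀ {v} → Dec (∃[ i ] v ∈ᵛ bag i) → Maybe (Fin t)
        owner (yes (i , _)) = just i
        owner (no _)        = nothing

        owner? : ∀ v → Dec (∃[ i ] v ∈ᵛ bag i)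
        owner? v = Fin.any? λ i → T? (hasVertex (bag i) v)

        b : V → Maybe (Fin t)
        b v = owner (owner? v)

        owner-∈ : ∀ {v i} (d : Dec (∃[ j ] v ∈ᵛ bag j)) → v ∈ᵛ bag i → owner d ≡ just i
        owner-∈ {v} {i} (yes (j , v∈j)) v∈i with j Fin.≟ i
        ... | yes refl = refl
        ... | no j≢i   = ⊥-elim (disjoint j≢i v∈j v∈i)
        owner-∈ (no none) v∈i = ⊥-elim (none (_ , v∈i))

        ∈-owner : ∀ {v i} (d : Dec (∃[ j ] v ∈ᵛ bag j)) → owner d ≡ just i → v ∈ᵛ bag i
        ∈-owner (yes (_ , v∈)) refl = v∈

        assign : ∀ {v i} → v ∈ᵛ bag i → decode (encode b) v ≡ just i
        assign {v} v∈ = trans (decode-encode b v) (owner-∈ (owner? v) v∈)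

        unassign : ∀ {v i} → decode (encode b) v ≡ just i → v ∈ᵛ bag i
        unassign {v} eq = ∈-owner (owner? v) (trans (sym (decode-encode b v)) eq)

        τ-switched : ∀ {u v} → Adj G u v → sign τ u v ≡ switched (decode (encode q)) u v
        τ-switched {u} {v} uv = trans (proj₂ equivalent u v uv) (trans
          (switchings-parity (proj₁ equivalent) (λ { refl → irreflexive uv }))
          (cong₂ (λ s s′ → s Sign.* s′ Sign.* Sign.-)
            (sym (decode-encode q u)) (sym (decode-encode q v))))

        step : ∀ {i u v} → Edge (positivePart τ (bag i)) u v →
               Step (decode (encode q)) (decode (encode b)) i u v
        step {i} {u} {v} e =
          let (uv , pos) = Equivalence.to T-∧ e
              (u∈ , v∈)  = Subgraph.edge-ends (bag i) uv
              adj        = Subgraph.edge-adj (bag i) uv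
          in assign u∈ , assign v∈ , adj ,
             trans (sym (τ-switched adj)) (toWitness {a? = sign τ u v Sign.≟ Sign.+} pos)

    oddMinor? : Dec (OddMinor G t)
    oddMinor? = map′ (λ (ps , as , e) → toMinor {decode ps} {decode as} e) fromMinor
      (search-Vec search-Sign N λ ps → search-Vec (search-Maybe Fin.any?) N λ as →
        encoded? (decode ps) (decode as))

  oddMinor-0 : OddMinor G 0
  oddMinor-0 = record
    { τ          = allNegative G
    ; equivalent = [] , λ _ _ _ → refl
    ; bag        = λ ()
    ; disjoint   = λ { {()} }
    ; connected  = λ ()
    ; edges      = λ ()
    }

  oddMinor-bound : ∀ {t} → OddMinor G t → t ≤ N
  oddMinor-bound {t} M = Fin.injective⇒≤ {f = position ∘ pick} λ {i} {j} eq → injective i j eq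
    where
    open SignedMinor M
    pick : Fin t → V
    pick i = proj₁ (proj₁ (connected i))
    pick∈ : ∀ i → pick i ∈ᵛ bag i
    pick∈ i = proj₂ (proj₁ (connected i))
    injective : ∀ i j → position (pick i) ≡ position (pick j) → i ≡ j
    injective i j eq with i Fin.≟ j
    ... | yes i≡j = i≡j
    ... | no i≢j  = ⊥-elim (disjoint i≢j (pick∈ i)
                      (subst (_∈ᵛ bag j) (sym (position-injective eq)) (pick∈ j)))

  abstract
    chromaticNumber : ∃ (IsChromaticNumber G)
    chromaticNumber = least colourable? N
      (position , λ u v uv eq →
        irreflexive (subst (Adj G u) (sym (position-injective eq)) uv))

    oddHadwigerNumber : ∃ (IsOddHadwigerNumber G)
    oddHadwigerNumber = greatest oddMinor? oddMinor-0 N oddMinor-bound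

χ : Graph → ℕ
χ G = proj₁ (Existence.chromaticNumber G)

χ-isChromaticNumber : ∀ G → IsChromaticNumber G (χ G)
χ-isChromaticNumber G = proj₂ (Existence.chromaticNumber G)

hₒ : Graph → ℕ
hₒ G = proj₁ (Existence.oddHadwigerNumber G)

hₒ-isOddHadwigerNumber : ∀ G → IsOddHadwigerNumber G (hₒ G)
hₒ-isOddHadwigerNumber G = proj₂ (Existence.oddHadwigerNumber G)

------------------------------------------------------------------------
-- Rational arithmetic

infixr 8 _^ℚ_
_^ℚ_ : ℚ → ℕ → ℚ
_^ℚ_ = _^_ ℚ.+-*-rawSemiring

fromℕ : ℕ → ℚ
fromℕ n = ℤ.+ n ℚ./ 1

{-# OPTIONS --safe #-}

-- Write n = qk + r with 0 ≤ r < k.  Colour classes of K̄(n,k) are families of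
-- pairwise disjoint k-sets, so Baranyai's theorem (an induction over the points
-- of [n], each step an integral rounding obtained from Rado's form of Hall's
-- theorem) gives χ ≤ M as soon as C(n,k) ≤ qM.  The k-sets containing one fixed
-- point form a clique of size C(n-1,k-1), which suffices when r = 0.  Otherwise
-- it is enlarged by stars of k-sets avoiding that point whose leaves cover at
-- least n - k + 1 of the other points: the leaves of such a star meet every set
-- of the clique and a leaf of every other such star, and switching at the
-- centres makes this strongly 1-shallow minor an odd one.  For k = 2 one star
-- is enough.  For q = 2 the leaves are a disjoint pair and the centre is a set
-- meeting both, found greedily; the resulting surplus is exponential in k.  For
-- q ≥ 3 each leaf contains one or two of three fixed points and is otherwise
-- taken from a class of a Baranyai partition of the remaining points.

module Submission where

open import Defs
open import Data.Bool.Base using (Bool; true; _∧_; if_then_else_) renaming (T to IsTrue)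
import Data.Bool.Properties as Bool
open import Data.Bool.Properties using (T-∧)
open import Data.Fin.Base
  using (Fin; zero; suc; toℕ; cast; inject≤; splitAt; join; combine; remQuot; _↑ˡ_; _↑ʳ_)
import Data.Fin.Properties as Fin
open import Data.Fin.Patterns using (0F; 1F; 2F)
open import Data.Fin.Subset using (Subset; inside; outside; _⊆_; _∪_; _∩_; _-_; ⁅_⁆; ∣_∣)
  renaming (_∈_ to _∈ˢ_; _∉_ to _∉ˢ_; ⊥ to ∅; ⊤ to full)
open import Data.Fin.Subset.Properties
  using ( _∈?_; _⊆?_; anySubset?; x∈p∪q⁻; x∈p∪q⁺; x∈p∩q⁺; x∈p∩q⁻; ∉⊥; x∈⁅x⁆; x∈⁅y⁆⇒x≡y; p─q⊆p
        ; x∈p∧x≢y⇒x∈p-y; x∈p⇒∣p-x∣<∣p∣; ∣⊥∣≡0; ∣⊤∣≡n; ∣⁅x⁆∣≡1; ∣p∣≤n)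
open import Data.List.Base as List
  using (List; []; _∷_; _++_; concat; filter; foldr; length; map; replicate; tabulate)
open import Data.List.Membership.Propositional using (_∈_; _∉_)
open import Data.List.Membership.Propositional.Properties
  using (∈-++⁺ˡ; ∈-++⁺ʳ; ∈-concat⁻′; ∈-concat⁺′; ∈-tabulate⁻; ∈-tabulate⁺; ∈-lookup)
open import Data.List.Properties using (length-map; length-replicate)
open import Data.List.Relation.Unary.All as All using (All; []; _∷_)
import Data.List.Relation.Unary.All.Properties as All
open import Data.List.Relation.Unary.AllPairs as AllPairs using (AllPairs; []; _∷_)
import Data.List.Relation.Unary.AllPairs.Properties as AllPairs
open import Data.List.Relation.Unary.Any as Any using (here; there; index)
open import Data.List.Relation.Unary.Any.Properties using (lookup-index)
open import Data.List.Relation.Unary.Unique.Propositional using (Unique)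
import Data.List.Relation.Unary.Unique.Propositional.Properties as Unique
open import Data.Maybe.Base using (Maybe; just; nothing)
open import Data.Maybe.Properties using (just-injective)
open import Data.Nat.Base renaming (_/_ to _div_; _%_ to _mod_)
open import Data.Nat.Combinatorics using (_C_; nCk+nC[k+1]≡[n+1]C[k+1]; nC1≡n)
open import Data.Nat.Coprimality using (1-coprimeTo) renaming (sym to coprime-sym)
open import Data.Nat.DivMod using (m≡m%n+[m/n]*n; m%n<n; m/n*n≤m; m*n/n≡m; /-monoˡ-≤)
open import Data.Nat.Induction using (<-wellFounded)
open import Data.Nat.ListAction using () renaming (sum to sumᴸ)
open import Data.Nat.Properties
open import Algebra.Properties.Semiring.Sum +-*-semiring
open import Data.Nat.Tactic.RingSolver using (solve-∀)
open import Data.Product.Base using (Σ; ∃-syntax; _×_; _,_; proj₁; proj₂; uncurry)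
open import Data.Sign.Base as Sign using (opposite)
import Data.Sign.Properties as Sign
open import Data.Sum.Base as Sum using (_⊎_; inj₁; inj₂; [_,_]′)
open import Data.Sum.Properties using (inj₂-injective)
open import Data.Vec.Base as Vec using (Vec; []; _∷_; here; there) renaming (_++_ to _++ⱽ_)
open import Data.Vec.Functional using (updateAt)
open import Data.Vec.Functional.Properties using (updateAt-updates; updateAt-minimal)
open import Data.Vec.Properties
  using (≡-dec; ∷-injectiveʳ; ++-injective; ++-injectiveˡ; ++-injectiveʳ; lookup∘tabulate; []=⇒lookup; lookup⇒[]=)
open import Function.Base using (_∘_; case_of_; const; id)
open import Function.Bundles using (mk⇔; module Equivalence; module Inverse)
open import Function.Definitions using (Injective)
open import Induction.WellFounded using (Acc; acc)
open import Relation.Binary.Construct.Closure.ReflexiveTransitive using (Star; ε; _◅_; _◅◅_)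
open import Relation.Binary.Definitions using (DecidableEquality)
open import Relation.Binary.PropositionalEquality
open import Relation.Nullary
open import Relation.Nullary.Decidable using (⌊_⌋; toWitness; fromWitness; dec-yes)

-- Bags and minors

-- Put m = n - 1 and B = C(m,k-1). As C(n,k) = n B / k, classes of q sets need about B + r B / (q k)
-- colours, so beyond the clique about r B / (q k) stars are wanted, nearly B / q when r is close to
-- k. The obstacle is that a centre must meet all its leaves, although leaves that cover
-- economically are almost disjoint. For q = 2 a star takes only three sets. The N = C(m,k) sets
-- avoiding the fixed point satisfy N ≤ 2 B, and few of them miss a given leaf; packing nearly all
-- into triples leaves a gain of about (3 B - N) / 6, hence at least about B / 6. For q ≥ 3 common
-- points make a centre meet its leaves without exception. For q = 3, r = k - 1 and large k, one or
-- two such points would give about 3 B / 20 or 21 B / 80 stars against a demand near B / 3; three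
-- points give about 27 B / 80. The margin is so narrow that rounding losses must be tracked, which
-- turns the counting into polynomial inequalities.

data Bag (V : Set) : Set where
  point : V → Bag V
  star  : V → List V → Bag V

module _ {V : Set} where

  centres terminals body : Bag V → List V
  centres   (point _)   = []
  centres   (star c _)  = c ∷ []
  terminals (point v)   = v ∷ []
  terminals (star _ ls) = ls
  body b = centres b ++ terminals b

module _ (G : Graph) where
  open Graph G using (_≟ᵛ_; adj-sym; irreflexive) renaming (Vertex to V)

  -- As the graph has no loops, `spokes` also keeps the centre out of the terminals, and `terminal`
  -- supplies a leaf, so a star bag is a genuine K(1,s) with s ≥ 1.
  record IsBag (b : Bag V) : Set where
    field
      terminal : ∃[ v ] v ∈ terminals b
      spokes   : ∀ {c l} → c ∈ centres b → l ∈ terminals b → Adj G c l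

  -- The common source of both kinds of minor: links between terminals only are what strong
  -- shallowness demands, and they are also the edges that switching at the centres leaves negative.
  -- The index type is arbitrary so that cliques and stars can be indexed by a sum before being
  -- numbered.
  record BagFamily (I : Set) : Set where
    field
      bag      : I → Bag V
      isBag    : ∀ i → IsBag (bag i)
      disjoint : ∀ {i j v} → v ∈ body (bag i) → v ∈ body (bag j) → i ≡ j
      linked   : ∀ {i j} → i ≢ j →
                 ∃[ u ] ∃[ v ] Adj G u v × u ∈ terminals (bag i) × v ∈ terminals (bag j)

  reindex : ∀ {I J : Set} (f : J → I) → Injective _≡_ _≡_ f → BagFamily I → BagFamily J
  reindex f f-injective F = record
    { bag      = bag ∘ f
    ; isBag    = isBag ∘ f
    ; disjoint = λ v∈ v∈′ → f-injective (disjoint v∈ v∈′)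
    ; linked   = λ i≢j → linked (i≢j ∘ f-injective)
    }
    where open BagFamily F

  open import Data.List.Membership.DecPropositional _≟ᵛ_ renaming (_∈?_ to _∈ᴸ?_) using ()

  Spoke : Bag V → V → V → Set
  Spoke b u v = (u ∈ centres b × v ∈ terminals b) ⊎ (v ∈ centres b × u ∈ terminals b)

  spoke? : ∀ b u v → Dec (Spoke b u v)
  spoke? b u v = ((u ∈ᴸ? centres b) ×-dec (v ∈ᴸ? terminals b)) ⊎-dec
                 ((v ∈ᴸ? centres b) ×-dec (u ∈ᴸ? terminals b))

  spoke-sym : ∀ (b : Bag V) {u v} → Spoke b u v → Spoke b v u
  spoke-sym b (inj₁ s) = inj₂ s
  spoke-sym b (inj₂ s) = inj₁ s

  centre-∈ : ∀ (b : Bag V) {v} → v ∈ centres b → v ∈ body b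
  centre-∈ b = ∈-++⁺ˡ

  terminal-∈ : ∀ (b : Bag V) {v} → v ∈ terminals b → v ∈ body b
  terminal-∈ b = ∈-++⁺ʳ (centres b)

  spoke-ends : ∀ (b : Bag V) {u v} → Spoke b u v → u ∈ body b × v ∈ body b
  spoke-ends b (inj₁ (u∈ , v∈)) = centre-∈ b u∈ , terminal-∈ b v∈
  spoke-ends b (inj₂ (v∈ , u∈)) = terminal-∈ b u∈ , centre-∈ b v∈

  bagSubgraph : ∀ b → IsBag b → Subgraph G
  bagSubgraph b valid = record
    { hasVertex = λ v → ⌊ v ∈ᴸ? body b ⌋
    ; hasEdge   = λ u v → ⌊ spoke? b u v ⌋
    ; edge-sym  = λ {u} {v} e → fromWitness {a? = spoke? b v u}
                    (spoke-sym b (toWitness {a? = spoke? b u v} e))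
    ; edge-adj  = λ {u} {v} e → adjacent (toWitness {a? = spoke? b u v} e)
    ; edge-ends = λ {u} {v} e → let (u∈ , v∈) = spoke-ends b (toWitness {a? = spoke? b u v} e) in
                    fromWitness u∈ , fromWitness v∈
    }
    where
    open IsBag valid
    adjacent : ∀ {u v} → Spoke b u v → Adj G u v
    adjacent (inj₁ (c , l)) = spokes c l
    adjacent (inj₂ (c , l)) = adj-sym (spokes c l)

  bag-connected : ∀ b {R : V → V → Set} → (∀ {u v} → Spoke b u v → R u v) →
                  ∀ {u v} → u ∈ body b → v ∈ body b → Star R u v
  bag-connected (point _)   r (here refl) (here refl) = ε
  bag-connected b@(star c _) {R} r u∈ v∈ = inward u∈ ◅◅ outward v∈
    where
    inward : ∀ {u} → u ∈ body b → Star R u c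
    inward (here refl) = ε
    inward (there u∈)  = r (inj₂ (here refl , u∈)) ◅ ε
    outward : ∀ {v} → v ∈ body b → Star R c v
    outward (here refl) = ε
    outward (there v∈)  = r (inj₁ (here refl , v∈)) ◅ ε

  bag-shape : ∀ b (valid : IsBag b) → Shape (bagSubgraph b valid)
  bag-shape (point v) valid = single v λ w → mk⇔ to λ { refl → fromWitness {a? = w ∈ᴸ? _} (here refl) }
    where
    to : ∀ {w} → IsTrue ⌊ w ∈ᴸ? (v ∷ []) ⌋ → w ≡ v
    to {w} p with here refl ← toWitness {a? = w ∈ᴸ? (v ∷ [])} p = refl
  bag-shape b@(star c ls) valid = star c record
    { centre  = fromWitness {a? = c ∈ᴸ? body b} (here refl)
    ; leaf    = let (v , v∈) = terminal in
                v , fromWitness {a? = v ∈ᴸ? body b} (there v∈) , λ { refl → c∉ls v∈ }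
    ; centred = λ u v → mk⇔ (to u v ∘ toWitness) (fromWitness ∘ from u v)
    }
    where
    open IsBag valid
    B = bagSubgraph b valid
    c∉ls : c ∉ ls
    c∉ls c∈ = irreflexive (spokes (here refl) c∈)
    vertex : ∀ {v} → v ∈ ls → v ∈ᵛ B × v ≢ c
    vertex {v} v∈ = fromWitness {a? = v ∈ᴸ? body b} (there v∈) , λ { refl → c∉ls v∈ }
    leaf-∈ : ∀ v → v ∈ᵛ B → v ≢ c → v ∈ ls
    leaf-∈ v p v≢c with toWitness {a? = v ∈ᴸ? body b} p
    ... | here v≡c = contradiction v≡c v≢c
    ... | there v∈ = v∈
    to : ∀ u v → Spoke b u v → (u ≡ c × v ∈ᵛ B × v ≢ c) ⊎ (v ≡ c × u ∈ᵛ B × u ≢ c)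
    to u v (inj₁ (here refl , v∈)) = inj₁ (refl , vertex v∈)
    to u v (inj₂ (here refl , u∈)) = inj₂ (refl , vertex u∈)
    from : ∀ u v → (u ≡ c × v ∈ᵛ B × v ≢ c) ⊎ (v ≡ c × u ∈ᵛ B × u ≢ c) → Spoke b u v
    from u v (inj₁ (refl , v∈ , v≢c)) = inj₁ (here refl , leaf-∈ v v∈ v≢c)
    from u v (inj₂ (refl , u∈ , u≢c)) = inj₂ (here refl , leaf-∈ u u∈ u≢c)

  terminal-shape : ∀ b (valid : IsBag b) {v} → v ∈ terminals b → Terminal (bag-shape b valid) v
  terminal-shape (point _)     valid (here refl) = refl
  terminal-shape b@(star c ls) valid {v} v∈ =
    fromWitness {a? = v ∈ᴸ? body b} (there v∈) ,
    λ { refl → irreflexive (IsBag.spokes valid (here refl) v∈) }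

  completeMinor : ∀ {t} → BagFamily (Fin t) → Σ (CompleteMinor G t) StronglyOneShallow
  completeMinor F = minor , (λ i → bag-shape (bag i) (isBag i)) , λ i j i≢j →
    let (u , v , uv , u∈ , v∈) = linked i≢j in
    u , v , uv , terminal-shape (bag i) (isBag i) u∈ , terminal-shape (bag j) (isBag j) v∈
    where
    open BagFamily F
    minor : CompleteMinor G _
    minor = record
      { bag       = λ i → bagSubgraph (bag i) (isBag i)
      ; disjoint  = λ {i} {j} i≢j {v} v∈ v∈′ →
          i≢j (disjoint {i} {j} (toWitness {a? = v ∈ᴸ? body (bag i)} v∈) (toWitness {a? = v ∈ᴸ? body (bag j)} v∈′))
      ; connected = λ i →
          (let (v , v∈) = IsBag.terminal (isBag i) in
           v , fromWitness {a? = v ∈ᴸ? body (bag i)} (terminal-∈ (bag i) v∈)) ,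
          λ {u} {v} u∈ v∈ → bag-connected (bag i)
            (λ {u} {v} → fromWitness {a? = spoke? (bag i) u v})
            (toWitness {a? = u ∈ᴸ? body (bag i)} u∈) (toWitness {a? = v ∈ᴸ? body (bag i)} v∈)
      ; edges     = λ i j i≢j → let (u , v , uv , u∈ , v∈) = linked i≢j in
          u , v , uv , fromWitness {a? = u ∈ᴸ? body (bag i)} (terminal-∈ (bag i) u∈)
                     , fromWitness {a? = v ∈ᴸ? body (bag j)} (terminal-∈ (bag j) v∈)
      }

  switch-neither : ∀ {σ : Signature G} {u v} xs → u ∉ xs → v ∉ xs →
                   sign (foldr switch σ xs) u v ≡ sign σ u v
  switch-neither [] _ _ = refl
  switch-neither {u = u} {v} (x ∷ xs) u∉ v∉ with u ≟ᵛ x | v ≟ᵛ x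
  ... | yes u≡x | _       = contradiction (here u≡x) u∉
  ... | no _    | yes v≡x = contradiction (here v≡x) v∉
  ... | no _    | no _    = switch-neither xs (u∉ ∘ there) (v∉ ∘ there)

  -- `Unique` matters because a second switching at the same vertex would restore the sign.
  switch-one : ∀ {σ : Signature G} {u v xs} → Unique xs → u ∈ xs → v ∉ xs →
               sign (foldr switch σ xs) u v ≡ opposite (sign σ u v)
  switch-one {u = u} {v} {x ∷ xs} (x∉ ∷ !xs) u∈ v∉ with u ≟ᵛ x | v ≟ᵛ x
  ... | _        | yes v≡x = contradiction (here v≡x) v∉
  ... | yes refl | no _    =
    cong opposite (switch-neither xs (λ x∈ → All.lookup x∉ x∈ refl) (v∉ ∘ there))
  switch-one {xs = x ∷ xs} (x∉ ∷ !xs) (here u≡x) v∉ | no u≢x | no _ = contradiction u≡x u≢x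
  switch-one {xs = x ∷ xs} (x∉ ∷ !xs) (there u∈) v∉ | no _   | no _ =
    switch-one !xs u∈ (v∉ ∘ there)

  -- After switching at all centres the spokes are positive, whereas edges
  -- between terminals keep their negative sign.
  oddMinor : ∀ {t} → BagFamily (Fin t) → OddMinor G t
  oddMinor {t} F = record
    { τ          = τ
    ; equivalent = switched , λ _ _ _ → refl
    ; bag        = λ i → bagSubgraph (bag i) (isBag i)
    ; disjoint   = CompleteMinor.disjoint minor
    ; connected  = λ i → proj₁ (CompleteMinor.connected minor i) ,
        λ {u} {v} u∈ v∈ → bag-connected (bag i) (λ {u} {v} s → Equivalence.from T-∧
            ( fromWitness {a? = spoke? (bag i) u v} s
            , fromWitness {a? = sign τ u v Sign.≟ Sign.+} (positive i s)))
          (toWitness {a? = u ∈ᴸ? body (bag i)} u∈) (toWitness {a? = v ∈ᴸ? body (bag i)} v∈)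
    ; edges      = λ i j i≢j → let (u , v , uv , u∈ , v∈) = linked i≢j in
        u , v , uv , fromWitness {a? = u ∈ᴸ? body (bag i)} (terminal-∈ (bag i) u∈)
                   , fromWitness {a? = v ∈ᴸ? body (bag j)} (terminal-∈ (bag j) v∈)
                   , switch-neither switched (unswitched i u∈) (unswitched j v∈)
    }
    where
    open BagFamily F
    minor = proj₁ (completeMinor F)

    switched : List V
    switched = concat (List.tabulate (centres ∘ bag))

    τ : Signature G
    τ = foldr switch (allNegative G) switched

    centres-unique : ∀ b → Unique (centres {V} b)
    centres-unique (point _)  = []
    centres-unique (star _ _) = [] ∷ []

    switched-unique : Unique switched
    switched-unique = Unique.concat⁺
      (All.tabulate⁺ (λ i → centres-unique (bag i)))
      (AllPairs.tabulate⁺ λ {i} {j} i≢j (v∈ , v∈′) →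
        i≢j (disjoint {i} {j} (centre-∈ (bag i) v∈) (centre-∈ (bag j) v∈′)))

    -- A switched vertex is the centre of some bag. Were it also a terminal, disjointness would put
    -- both roles into one bag and make a spoke a loop.
    unswitched : ∀ i {v} → v ∈ terminals (bag i) → v ∉ switched
    unswitched i v∈ v∈s with ∈-concat⁻′ _ v∈s
    ... | _ , v∈c , c∈ with ∈-tabulate⁻ {f = centres ∘ bag} c∈
    ... | j , refl with disjoint {i} {j} (terminal-∈ (bag i) v∈) (centre-∈ (bag j) v∈c)
    ... | refl = irreflexive (IsBag.spokes (isBag i) v∈c v∈)

    centre-switched : ∀ i {v} → v ∈ centres (bag i) → v ∈ switched
    centre-switched i v∈ = ∈-concat⁺′ v∈ (∈-tabulate⁺ {f = centres ∘ bag} i)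

    positive : ∀ i {u v} → Spoke (bag i) u v → sign τ u v ≡ Sign.+
    positive i (inj₁ (u∈ , v∈)) =
      switch-one switched-unique (centre-switched i u∈) (unswitched i v∈)
    positive i {u} {v} (inj₂ (v∈ , u∈)) = trans (sign-sym τ u v)
      (switch-one switched-unique (centre-switched i v∈) (unswitched i u∈))

-- Integral rounding of matrices

𝟙 : ∀ {P : Set} → Dec P → ℕ
𝟙 P? = if does P? then 1 else 0

𝟙-yes : ∀ {P : Set} (P? : Dec P) → P → 𝟙 P? ≡ 1
𝟙-yes (yes _) p = refl
𝟙-yes (no ¬p) p = contradiction p ¬p

𝟙-no : ∀ {P : Set} (P? : Dec P) → ¬ P → 𝟙 P? ≡ 0
𝟙-no (yes p) ¬p = contradiction p ¬p
𝟙-no (no _)  ¬p = refl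

𝟙-mono : ∀ {P Q : Set} (P? : Dec P) (Q? : Dec Q) → (P → Q) → 𝟙 P? ≤ 𝟙 Q?
𝟙-mono (yes p) (yes q) f = ≤-refl
𝟙-mono (yes p) (no ¬q) f = contradiction (f p) ¬q
𝟙-mono (no _)  _       f = z≤n

𝟙-cong : ∀ {P Q : Set} (P? : Dec P) (Q? : Dec Q) → (P → Q) → (Q → P) → 𝟙 P? ≡ 𝟙 Q?
𝟙-cong P? Q? f g = ≤-antisym (𝟙-mono P? Q? f) (𝟙-mono Q? P? g)

∑-mono : ∀ {n} {f g : Fin n → ℕ} → (∀ i → f i ≤ g i) → sum f ≤ sum g
∑-mono {zero}  f≤g = z≤n
∑-mono {suc n} f≤g = +-mono-≤ (f≤g zero) (∑-mono (f≤g ∘ suc))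

∑-zero : ∀ {n} {f : Fin n → ℕ} → (∀ i → f i ≡ 0) → sum f ≡ 0
∑-zero {zero}  f≡0 = refl
∑-zero {suc n} f≡0 = cong₂ _+_ (f≡0 zero) (∑-zero (f≡0 ∘ suc))

≤-∑ : ∀ {n} (f : Fin n → ℕ) i → f i ≤ sum f
≤-∑ f zero    = m≤m+n _ _
≤-∑ f (suc i) = m≤n⇒m≤o+n (f zero) (≤-∑ (f ∘ suc) i)

∑-ones : ∀ n → ∑[ i < n ] 1 ≡ n
∑-ones zero    = refl
∑-ones (suc n) = cong suc (∑-ones n)

∑-mono-≡ : ∀ {n} {f g : Fin n → ℕ} → (∀ i → f i ≤ g i) → sum g ≤ sum f → ∀ i → f i ≡ g i
∑-mono-≡ {suc n} {f} {g} f≤g ∑g≤∑f = λ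
  { zero    → ≤-antisym (f≤g zero) (+-cancelʳ-≤ (sum (g ∘ suc)) (g zero) (f zero)
                (≤-trans ∑g≤∑f (+-monoʳ-≤ (f zero) (∑-mono (f≤g ∘ suc)))))
  ; (suc i) → ∑-mono-≡ (f≤g ∘ suc) (+-cancelˡ-≤ (f zero) _ _
                (≤-trans (+-monoˡ-≤ (sum (g ∘ suc)) (f≤g zero)) ∑g≤∑f)) i
  }

∑-select : ∀ {n} (s : Fin n) (g : Fin n → ℕ) → ∑[ i < n ] (𝟙 (s Fin.≟ i) * g i) ≡ g s
∑-select {suc n} zero g = trans
  (cong₂ _+_ (*-identityˡ (g zero)) (∑-zero {f = λ i → 𝟙 (zero Fin.≟ suc i) * g (suc i)} λ i → refl))
  (+-identityʳ (g zero))
∑-select {suc n} (suc s) g = trans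
  (sum-cong-≗ λ i → cong (_* g (suc i)) (𝟙-cong (suc s Fin.≟ suc i) (s Fin.≟ i) Fin.suc-injective (cong suc)))
  (∑-select s (g ∘ suc))

∑-one : ∀ {n} (s : Fin n) → ∑[ i < n ] 𝟙 (s Fin.≟ i) ≡ 1
∑-one s = trans (sum-cong-≗ λ i → sym (*-identityʳ (𝟙 (s Fin.≟ i)))) (∑-select s (λ _ → 1))

module _ {M L : ℕ} (t : Fin L → ℕ) where

  inside# : (Fin M → Subset L) → Subset L → ℕ
  inside# F R = ∑[ i < M ] 𝟙 (F i ⊆? R)

  capacity : Subset L → ℕ
  capacity R = ∑[ s < L ] (𝟙 (s ∈? R) * t s)

  -- Row i may receive the labels in `F i`, and label s may be used `t s` times. Hall's condition is
  -- phrased over sets of labels instead of sets of rows: the rows confined to R must fit into the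
  -- capacity of R. In this form the right side is modular in R.
  HallCondition : (Fin M → Subset L) → Set
  HallCondition F = ∀ R → inside# F R ≤ capacity R

  hall? : ∀ F → HallCondition F ⊎ ∃[ R ] capacity R < inside# F R
  hall? F with anySubset? (λ R → capacity R <? inside# F R)
  ... | yes violated = inj₂ violated
  ... | no ok        = inj₁ λ R → ≮⇒≥ λ lt → ok (R , lt)

  capacity-modular : ∀ R S → capacity (R ∪ S) + capacity (R ∩ S) ≡ capacity R + capacity S
  capacity-modular R S = begin
    capacity (R ∪ S) + capacity (R ∩ S)
      ≡⟨ ∑-distrib-+ (λ s → 𝟙 (s ∈? R ∪ S) * t s) (λ s → 𝟙 (s ∈? R ∩ S) * t s) ⟨
    ∑[ s < L ] (𝟙 (s ∈? R ∪ S) * t s + 𝟙 (s ∈? R ∩ S) * t s)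
      ≡⟨ sum-cong-≗ pointwise ⟩
    ∑[ s < L ] (𝟙 (s ∈? R) * t s + 𝟙 (s ∈? S) * t s)
      ≡⟨ ∑-distrib-+ (λ s → 𝟙 (s ∈? R) * t s) (λ s → 𝟙 (s ∈? S) * t s) ⟩
    capacity R + capacity S ∎
    where
    open ≡-Reasoning
    pointwise : ∀ s → 𝟙 (s ∈? R ∪ S) * t s + 𝟙 (s ∈? R ∩ S) * t s ≡ 𝟙 (s ∈? R) * t s + 𝟙 (s ∈? S) * t s
    pointwise s = trans (sym (*-distribʳ-+ (t s) (𝟙 (s ∈? R ∪ S)) _))
                        (trans (cong (_* t s) indicator) (*-distribʳ-+ (t s) (𝟙 (s ∈? R)) _))
      where
      indicator : 𝟙 (s ∈? R ∪ S) + 𝟙 (s ∈? R ∩ S) ≡ 𝟙 (s ∈? R) + 𝟙 (s ∈? S)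
      indicator with s ∈? R | s ∈? S
      ... | yes r | yes s = cong₂ _+_ (𝟙-yes (_ ∈? R ∪ S) (x∈p∪q⁺ (inj₁ r))) (𝟙-yes (_ ∈? R ∩ S) (x∈p∩q⁺ (r , s)))
      ... | yes r | no ¬s = cong₂ _+_ (𝟙-yes (_ ∈? R ∪ S) (x∈p∪q⁺ (inj₁ r))) (𝟙-no (_ ∈? R ∩ S) (¬s ∘ proj₂ ∘ x∈p∩q⁻ R S))
      ... | no ¬r | yes s = cong₂ _+_ (𝟙-yes (_ ∈? R ∪ S) (x∈p∪q⁺ (inj₂ s))) (𝟙-no (_ ∈? R ∩ S) (¬r ∘ proj₁ ∘ x∈p∩q⁻ R S))
      ... | no ¬r | no ¬s = cong₂ _+_
        (𝟙-no (_ ∈? R ∪ S) λ u → case x∈p∪q⁻ R S u of λ { (inj₁ r) → ¬r r ; (inj₂ s) → ¬s s })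
        (𝟙-no (_ ∈? R ∩ S) (¬r ∘ proj₁ ∘ x∈p∩q⁻ R S))

  -- Rado's argument: if deleting x and deleting y both violate the Hall
  -- condition, at R and S, then R ∪ S or R ∩ S violates it already.
  shrink : ∀ {F} → HallCondition F → ∀ i {x y} → x ∈ˢ F i → y ∈ˢ F i → x ≢ y →
           ∃[ z ] z ∈ˢ F i × HallCondition (updateAt F i (_- z))
  shrink {F} hall i {x} {y} x∈ y∈ x≢y with hall? (updateAt F i (_- x)) | hall? (updateAt F i (_- y))
  ... | inj₁ ok      | _       = x , x∈ , ok
  ... | inj₂ _       | inj₁ ok = y , y∈ , ok
  ... | inj₂ (R , r) | inj₂ (S , s) = contradiction bound (<⇒≱ excess)
    where
    open ≤-Reasoning
    Fˣ = updateAt F i (_- x)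
    Fʸ = updateAt F i (_- y)

    excess : suc (capacity R + capacity S) < inside# Fˣ R + inside# Fʸ S
    excess = ≤-trans (s≤s (≤-reflexive (sym (+-suc (capacity R) (capacity S))))) (+-mono-≤ r s)

    both : F i - x ⊆ R → F i - y ⊆ S → F i ⊆ R ∪ S
    both ⊆R ⊆S {z} z∈ with z Fin.≟ x
    ... | yes refl = x∈p∪q⁺ (inj₂ (⊆S (x∈p∧x≢y⇒x∈p-y z∈ x≢y)))
    ... | no z≢x   = x∈p∪q⁺ (inj₁ (⊆R (x∈p∧x≢y⇒x∈p-y z∈ z≢x)))

    -- Row i may count twice on the left while only R ∪ S is sure to contain `F i`, because x and y
    -- are different and each deletion keeps the other point. This costs one unit, whereas two
    -- strict violations give an excess of two.
    pointwise : ∀ j → 𝟙 (Fˣ j ⊆? R) + 𝟙 (Fʸ j ⊆? S) ≤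
                      (𝟙 (F j ⊆? R ∪ S) + 𝟙 (F j ⊆? R ∩ S)) + 𝟙 (i Fin.≟ j)
    pointwise j with i Fin.≟ j
    ... | yes refl rewrite updateAt-updates i {_- x} F | updateAt-updates i {_- y} F
        with F i - x ⊆? R | F i - y ⊆? S
    ... | yes p | yes q = +-monoˡ-≤ 1 (m≤n⇒m≤n+o _ (≤-reflexive (sym (𝟙-yes (F j ⊆? R ∪ S) (both p q)))))
    ... | yes _ | no _  = m≤n+m 1 _
    ... | no _  | yes _ = m≤n+m 1 _
    ... | no _  | no _  = z≤n
    pointwise j | no i≢j rewrite updateAt-minimal j i {_- x} F (i≢j ∘ sym) | updateAt-minimal j i {_- y} F (i≢j ∘ sym)
        with F j ⊆? R | F j ⊆? S
    ... | yes p | yes q = ≤-reflexive (sym (trans (+-identityʳ _)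
            (cong₂ _+_ (𝟙-yes (F j ⊆? R ∪ S) (λ z∈ → x∈p∪q⁺ (inj₁ (p z∈)))) (𝟙-yes (F j ⊆? R ∩ S) (λ z∈ → x∈p∩q⁺ (p z∈ , q z∈))))))
    ... | yes p | no _  = m≤n⇒m≤n+o 0 (m≤n⇒m≤n+o _ (≤-reflexive (sym (𝟙-yes (F j ⊆? R ∪ S) (λ z∈ → x∈p∪q⁺ (inj₁ (p z∈)))))))
    ... | no _  | yes q = m≤n⇒m≤n+o 0 (m≤n⇒m≤n+o _ (≤-reflexive (sym (𝟙-yes (F j ⊆? R ∪ S) (λ z∈ → x∈p∪q⁺ (inj₂ (q z∈)))))))
    ... | no _  | no _  = z≤n

    bound : inside# Fˣ R + inside# Fʸ S ≤ suc (capacity R + capacity S)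
    bound = begin
      inside# Fˣ R + inside# Fʸ S
        ≡⟨ ∑-distrib-+ (λ j → 𝟙 (Fˣ j ⊆? R)) (λ j → 𝟙 (Fʸ j ⊆? S)) ⟨
      ∑[ j < M ] (𝟙 (Fˣ j ⊆? R) + 𝟙 (Fʸ j ⊆? S))
        ≤⟨ ∑-mono pointwise ⟩
      ∑[ j < M ] ((𝟙 (F j ⊆? R ∪ S) + 𝟙 (F j ⊆? R ∩ S)) + 𝟙 (i Fin.≟ j))
        ≡⟨ ∑-distrib-+ (λ j → 𝟙 (F j ⊆? R ∪ S) + 𝟙 (F j ⊆? R ∩ S)) (λ j → 𝟙 (i Fin.≟ j)) ⟩
      ∑[ j < M ] (𝟙 (F j ⊆? R ∪ S) + 𝟙 (F j ⊆? R ∩ S)) + ∑[ j < M ] 𝟙 (i Fin.≟ j)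
        ≡⟨ cong₂ _+_ (∑-distrib-+ (λ j → 𝟙 (F j ⊆? R ∪ S)) (λ j → 𝟙 (F j ⊆? R ∩ S))) (∑-one i) ⟩
      (inside# F (R ∪ S) + inside# F (R ∩ S)) + 1
        ≤⟨ +-monoˡ-≤ 1 (+-mono-≤ (hall (R ∪ S)) (hall (R ∩ S))) ⟩
      (capacity (R ∪ S) + capacity (R ∩ S)) + 1
        ≡⟨ cong (_+ 1) (capacity-modular R S) ⟩
      (capacity R + capacity S) + 1
        ≡⟨ +-comm _ 1 ⟩
      suc (capacity R + capacity S) ∎

  totalSize : (Fin M → Subset L) → ℕ
  totalSize F = ∑[ i < M ] ∣ F i ∣

  totalSize-shrinks : ∀ F i {z} → z ∈ˢ F i → totalSize (updateAt F i (_- z)) < totalSize F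
  totalSize-shrinks F i {z} z∈ = begin-strict
    totalSize F′                                        <⟨ n<1+n _ ⟩
    1 + totalSize F′                                    ≡⟨ +-comm 1 _ ⟩
    totalSize F′ + 1                                    ≡⟨ cong (totalSize F′ +_) (∑-one i) ⟨
    totalSize F′ + ∑[ j < M ] 𝟙 (i Fin.≟ j)
      ≡⟨ ∑-distrib-+ (λ j → ∣ F′ j ∣) (λ j → 𝟙 (i Fin.≟ j)) ⟨
    ∑[ j < M ] (∣ F′ j ∣ + 𝟙 (i Fin.≟ j))          ≤⟨ ∑-mono pointwise ⟩
    totalSize F                                         ∎
    where
    open ≤-Reasoning
    F′ = updateAt F i (_- z)
    pointwise : ∀ j → ∣ F′ j ∣ + 𝟙 (i Fin.≟ j) ≤ ∣ F j ∣
    pointwise j with i Fin.≟ j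
    ... | yes refl rewrite updateAt-updates i {_- z} F =
      ≤-trans (≤-reflexive (+-comm _ 1)) (x∈p⇒∣p-x∣<∣p∣ z∈)
    ... | no i≢j rewrite updateAt-minimal j i {_- z} F (i≢j ∘ sym) = ≤-reflexive (+-identityʳ _)

  -- Labels are deleted one at a time while some row still has two; the total size drops each time.
  -- That no row becomes empty is a consequence of the Hall condition at ∅, drawn in `hall`.
  system : ∀ F → HallCondition F → Acc _<_ (totalSize F) →
           ∃[ G ] HallCondition G × (∀ i → G i ⊆ F i) × (∀ i {x y} → x ∈ˢ G i → y ∈ˢ G i → x ≡ y)
  system F hall (acc smaller)
    with Fin.any? (λ i → Fin.any? λ x → Fin.any? λ y → (x ∈? F i) ×-dec (y ∈? F i) ×-dec ¬? (x Fin.≟ y))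
  ... | no none = F , hall , (λ _ z∈ → z∈) , λ i {x} {y} x∈ y∈ →
        decidable-stable (x Fin.≟ y) λ x≢y → none (i , x , y , x∈ , y∈ , x≢y)
  ... | yes (i , x , y , x∈ , y∈ , x≢y) with shrink hall i x∈ y∈ x≢y
  ... | z , z∈ , hall′ with system _ hall′ (smaller (totalSize-shrinks F i z∈))
  ... | G , hallᴳ , G⊆ , thin = G , hallᴳ , (λ j → ⊆F j ∘ G⊆ j) , thin
    where
    ⊆F : ∀ j → updateAt F i (_- z) j ⊆ F j
    ⊆F j with i Fin.≟ j
    ... | yes refl rewrite updateAt-updates i {_- z} F = p─q⊆p _ _
    ... | no i≢j rewrite updateAt-minimal j i {_- z} F (i≢j ∘ sym) = λ z∈ → z∈

  -- A row reduced to the label s lies inside {s}, so the Hall condition at singletons bounds the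
  -- use of each label from above. Since the bounds add up to the number of rows, all of them are
  -- attained.
  hall : ∀ F → HallCondition F → sum t ≡ M →
         ∃[ f ] (∀ i → f i ∈ˢ F i) × (∀ s → ∑[ i < M ] 𝟙 (f i Fin.≟ s) ≡ t s)
  hall F hallF ∑t≡M with system F hallF (<-wellFounded _)
  ... | G , hallG , G⊆F , thin = f , (λ i → G⊆F i (f∈ i)) , ∑-mono-≡ below total
    where
    open ≤-Reasoning
    nonempty : ∀ i → ∃[ s ] s ∈ˢ G i
    nonempty i with Fin.any? (λ s → s ∈? G i)
    ... | yes found = found
    ... | no empty  = contradiction (hallG ∅) (<⇒≱ (begin-strict
      capacity ∅   ≡⟨ ∑-zero {f = λ s → 𝟙 (s ∈? ∅) * t s} (λ s → cong (_* t s) (𝟙-no (s ∈? ∅) ∉⊥)) ⟩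
      0            <⟨ n<1+n 0 ⟩
      1            ≡⟨ 𝟙-yes (G i ⊆? ∅) (λ s∈ → contradiction (_ , s∈) empty) ⟨
      𝟙 (G i ⊆? ∅) ≤⟨ ≤-∑ (λ i → 𝟙 (G i ⊆? ∅)) i ⟩
      inside# G ∅  ∎))

    f : Fin M → Fin L
    f i = proj₁ (nonempty i)
    f∈ : ∀ i → f i ∈ˢ G i
    f∈ i = proj₂ (nonempty i)

    below : ∀ s → ∑[ i < M ] 𝟙 (f i Fin.≟ s) ≤ t s
    below s = begin
      ∑[ i < M ] 𝟙 (f i Fin.≟ s)
        ≤⟨ ∑-mono (λ i → 𝟙-mono (f i Fin.≟ s) (G i ⊆? ⁅ s ⁆)
             λ { refl {z} z∈ → subst (_∈ˢ ⁅ s ⁆) (thin i (f∈ i) z∈) (x∈⁅x⁆ s) }) ⟩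
      inside# G ⁅ s ⁆
        ≤⟨ hallG ⁅ s ⁆ ⟩
      capacity ⁅ s ⁆
        ≡⟨ sum-cong-≗ (λ z → cong (_* t z) (𝟙-cong (z ∈? ⁅ s ⁆) (s Fin.≟ z)
             (sym ∘ x∈⁅y⁆⇒x≡y s) λ { refl → x∈⁅x⁆ s })) ⟩
      ∑[ z < L ] (𝟙 (s Fin.≟ z) * t z)
        ≡⟨ ∑-select s t ⟩
      t s ∎

    total : sum t ≤ ∑[ s < L ] ∑[ i < M ] 𝟙 (f i Fin.≟ s)
    total = begin
      sum t                                  ≡⟨ ∑t≡M ⟩
      M                                      ≡⟨ ∑-ones M ⟨
      ∑[ i < M ] 1                           ≡⟨ sum-cong-≗ (λ i → sym (∑-one (f i))) ⟩
      ∑[ i < M ] ∑[ s < L ] 𝟙 (f i Fin.≟ s)  ≡⟨ ∑-comm (λ i s → 𝟙 (f i Fin.≟ s)) ⟩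
      ∑[ s < L ] ∑[ i < M ] 𝟙 (f i Fin.≟ s)  ∎

  abstract
    -- w / d is a fractional assignment of labels to rows, and it is replaced by an integral one
    -- within its support. Hall's condition holds because each row confined to R carries its full
    -- weight d in the columns of R, whose total weight is d times the capacity.
    rounding : ∀ (w : Fin M → Fin L → ℕ) d .{{_ : NonZero d}} →
               (∀ i → ∑[ s < L ] w i s ≡ d) → (∀ s → ∑[ i < M ] w i s ≡ d * t s) →
               Σ (Fin M → Fin L) λ f → (∀ i → 0 < w i (f i)) × (∀ s → ∑[ i < M ] 𝟙 (f i Fin.≟ s) ≡ t s)
    rounding w d rows columns with hall F hallF ∑t≡M
      where
      open ≤-Reasoning
      F : Fin M → Subset L
      F i = Vec.tabulate λ s → does (0 <? w i s)

      support⁺ : ∀ i {s} → 0 < w i s → s ∈ˢ F i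
      support⁺ i {s} pos = lookup⇒[]= s (F i)
        (trans (lookup∘tabulate _ s) (cong does (proj₂ (dec-yes (0 <? w i s) pos))))

      hallF : HallCondition F
      hallF R = *-cancelˡ-≤ d (begin
        d * inside# F R                                  ≡⟨ *-distribˡ-sum d (λ i → 𝟙 (F i ⊆? R)) ⟩
        ∑[ i < M ] (d * 𝟙 (F i ⊆? R))                    ≤⟨ ∑-mono row ⟩
        ∑[ i < M ] ∑[ s < L ] (𝟙 (s ∈? R) * w i s)       ≡⟨ ∑-comm (λ i s → 𝟙 (s ∈? R) * w i s) ⟩
        ∑[ s < L ] ∑[ i < M ] (𝟙 (s ∈? R) * w i s)       ≡⟨ sum-cong-≗ column ⟩
        ∑[ s < L ] (d * (𝟙 (s ∈? R) * t s))
          ≡⟨ *-distribˡ-sum d (λ s → 𝟙 (s ∈? R) * t s) ⟨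
        d * capacity R                                   ∎)
        where
        column : ∀ s → ∑[ i < M ] (𝟙 (s ∈? R) * w i s) ≡ d * (𝟙 (s ∈? R) * t s)
        column s = begin-equality
          ∑[ i < M ] (𝟙 (s ∈? R) * w i s) ≡⟨ *-distribˡ-sum (𝟙 (s ∈? R)) (λ i → w i s) ⟨
          𝟙 (s ∈? R) * ∑[ i < M ] w i s   ≡⟨ cong (𝟙 (s ∈? R) *_) (columns s) ⟩
          𝟙 (s ∈? R) * (d * t s)          ≡⟨ *-assoc (𝟙 (s ∈? R)) d (t s) ⟨
          𝟙 (s ∈? R) * d * t s            ≡⟨ cong (_* t s) (*-comm (𝟙 (s ∈? R)) d) ⟩
          d * 𝟙 (s ∈? R) * t s            ≡⟨ *-assoc d (𝟙 (s ∈? R)) (t s) ⟩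
          d * (𝟙 (s ∈? R) * t s)          ∎
        row : ∀ i → d * 𝟙 (F i ⊆? R) ≤ ∑[ s < L ] (𝟙 (s ∈? R) * w i s)
        row i with F i ⊆? R
        ... | no _ = ≤-trans (≤-reflexive (*-zeroʳ d)) z≤n
        ... | yes F⊆R = begin
          d * 1            ≡⟨ *-identityʳ d ⟩
          d                ≡⟨ rows i ⟨
          ∑[ s < L ] w i s ≤⟨ ∑-mono entry ⟩
          ∑[ s < L ] (𝟙 (s ∈? R) * w i s) ∎
          where
          entry : ∀ s → w i s ≤ 𝟙 (s ∈? R) * w i s
          entry s with s ∈? R
          ... | yes _ = ≤-reflexive (sym (*-identityˡ _))
          ... | no s∉ = ≮⇒≥ (λ pos → s∉ (F⊆R (support⁺ i pos)))

      ∑t≡M : sum t ≡ M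
      ∑t≡M = *-cancelˡ-≡ (sum t) M d (begin-equality
        d * sum t                        ≡⟨ *-distribˡ-sum d t ⟩
        ∑[ s < L ] (d * t s)             ≡⟨ sum-cong-≗ (sym ∘ columns) ⟩
        ∑[ s < L ] ∑[ i < M ] w i s      ≡⟨ ∑-comm w ⟨
        ∑[ i < M ] ∑[ s < L ] w i s      ≡⟨ sum-cong-≗ rows ⟩
        ∑[ i < M ] d                     ≡⟨ sum-cong-≗ {M} (λ _ → sym (*-identityʳ d)) ⟩
        ∑[ i < M ] (d * 1)               ≡⟨ *-distribˡ-sum d (λ (_ : Fin M) → 1) ⟨
        d * ∑[ i < M ] 1                 ≡⟨ cong (d *_) (∑-ones M) ⟩
        d * M                            ∎)
    ... | f , f∈ , counts = f , (λ i → support⁻ i (f∈ i)) , counts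
      where
      support⁻ : ∀ i {s} → s ∈ˢ Vec.tabulate (λ s → does (0 <? w i s)) → 0 < w i s
      support⁻ i {s} s∈ with 0 <? w i s in eq
      ... | yes pos = pos
      ... | no _ = contradiction (trans (sym (cong does eq))
                     (trans (sym (lookup∘tabulate (λ s → does (0 <? w i s)) s)) ([]=⇒lookup s∈))) λ ()

-- Baranyai’s theorem

C-absorb : ∀ n k → (suc n C suc k) * suc k ≡ suc n * (n C k)
C-absorb zero zero = refl
C-absorb zero (suc k) = refl
C-absorb (suc n) zero = trans (*-identityʳ (suc (suc n) C 1)) (trans (nC1≡n (suc (suc n))) (sym (*-identityʳ (suc (suc n)))))
C-absorb (suc n) (suc k) = begin
  (suc (suc n) C suc (suc k)) * suc (suc k)
    ≡⟨ cong (_* suc (suc k)) (nCk+nC[k+1]≡[n+1]C[k+1] (suc n) (suc k)) ⟨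
  (A + suc n C suc (suc k)) * suc (suc k)
    ≡⟨ *-distribʳ-+ (suc (suc k)) A _ ⟩
  A * suc (suc k) + (suc n C suc (suc k)) * suc (suc k)
    ≡⟨ cong₂ _+_ (*-suc A (suc k)) (C-absorb n (suc k)) ⟩
  (A + A * suc k) + suc n * (n C suc k)
    ≡⟨ cong (λ z → (A + z) + suc n * (n C suc k)) (C-absorb n k) ⟩
  (A + suc n * (n C k)) + suc n * (n C suc k)
    ≡⟨ +-assoc A _ _ ⟩
  A + (suc n * (n C k) + suc n * (n C suc k))
    ≡⟨ cong (A +_) (*-distribˡ-+ (suc n) (n C k) _) ⟨
  A + suc n * (n C k + n C suc k)
    ≡⟨ cong (λ z → A + suc n * z) (nCk+nC[k+1]≡[n+1]C[k+1] n k) ⟩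
  suc (suc n) * (suc n C suc k) ∎
  where
  open ≡-Reasoning
  A = suc n C suc k

_≟ᴮ_ : ∀ {l} → DecidableEquality (Subset l)
_≟ᴮ_ = ≡-dec Bool._≟_

open Inverse Fin.2↔Bool using () renaming (to to side; from to bit; strictlyInverseˡ to side-bit; strictlyInverseʳ to bit-side)

-- Subsets are numbered by their binary digits because the labels of `rounding` are elements of some
-- `Fin L`.
encode : ∀ {l} → Subset l → Fin (2 ^ l)
encode []      = zero
encode (x ∷ S) = combine (bit x) (encode S)

decode : ∀ {l} → Fin (2 ^ l) → Subset l
decode {zero}  _ = []
decode {suc l} i = side (proj₁ (remQuot {2} (2 ^ l) i)) ∷ decode (proj₂ (remQuot {2} (2 ^ l) i))

decode-encode : ∀ {l} (S : Subset l) → decode (encode S) ≡ S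
decode-encode [] = refl
decode-encode {suc l} (x ∷ S) = trans
  (cong (λ p → side (proj₁ p) ∷ decode (proj₂ p)) (Fin.remQuot-combine (bit x) (encode S)))
  (cong₂ _∷_ (side-bit x) (decode-encode S))

encode-decode : ∀ {l} (i : Fin (2 ^ l)) → encode (decode {l} i) ≡ i
encode-decode {zero}  zero = refl
encode-decode {suc l} i = trans
  (cong₂ combine (bit-side (proj₁ (remQuot {2} (2 ^ l) i))) (encode-decode {l} (proj₂ (remQuot {2} (2 ^ l) i))))
  (Fin.combine-remQuot {2} (2 ^ l) i)

count : ∀ {l} → Subset l → List (Subset l) → ℕ
count S []       = 0
count S (x ∷ xs) = 𝟙 (S ≟ᴮ x) + count S xs

∈⇒count : ∀ {l} {S : Subset l} {xs} → S ∈ xs → 0 < count S xs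
∈⇒count {S = S} (here {x} S≡x) = m≤n⇒m≤n+o _ (≤-reflexive (sym (𝟙-yes (S ≟ᴮ x) S≡x)))
∈⇒count (there S∈) = m≤n⇒m≤o+n _ (∈⇒count S∈)

count⇒∈ : ∀ {l} {S : Subset l} {xs} → 0 < count S xs → S ∈ xs
count⇒∈ {S = S} {x ∷ xs} pos with S ≟ᴮ x
... | yes S≡x = here S≡x
... | no _    = there (count⇒∈ pos)

∑-count : ∀ {l} (h : Subset l → ℕ) xs →
          ∑[ s < 2 ^ l ] (count (decode s) xs * h (decode s)) ≡ sumᴸ (map h xs)
∑-count {l} h [] = ∑-zero {f = λ s → count (decode {l} s) [] * h (decode s)} λ _ → refl
∑-count {l} h (x ∷ xs) = begin
  ∑[ s < 2 ^ l ] ((𝟙 (decode s ≟ᴮ x) + count (decode s) xs) * h (decode s))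
    ≡⟨ sum-cong-≗ (λ s → *-distribʳ-+ (h (decode s)) (𝟙 (decode s ≟ᴮ x)) _) ⟩
  ∑[ s < 2 ^ l ] (𝟙 (decode s ≟ᴮ x) * h (decode s) + count (decode s) xs * h (decode s))
    ≡⟨ ∑-distrib-+ (λ s → 𝟙 (decode s ≟ᴮ x) * h (decode s)) (λ s → count (decode s) xs * h (decode s)) ⟩
  ∑[ s < 2 ^ l ] (𝟙 (decode s ≟ᴮ x) * h (decode s)) + ∑[ s < 2 ^ l ] (count (decode s) xs * h (decode s))
    ≡⟨ cong₂ _+_ selected (∑-count h xs) ⟩
  h x + sumᴸ (map h xs) ∎
  where
  open ≡-Reasoning
  selected : ∑[ s < 2 ^ l ] (𝟙 (decode s ≟ᴮ x) * h (decode s)) ≡ h x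
  selected = begin
    ∑[ s < 2 ^ l ] (𝟙 (decode s ≟ᴮ x) * h (decode s))
      ≡⟨ sum-cong-≗ (λ s → cong (_* h (decode s)) (𝟙-cong (decode s ≟ᴮ x) (encode x Fin.≟ s)
           (λ { refl → encode-decode {l} s }) (λ { refl → decode-encode x }))) ⟩
    ∑[ s < 2 ^ l ] (𝟙 (encode x Fin.≟ s) * h (decode s))
      ≡⟨ ∑-select (encode x) (h ∘ decode) ⟩
    h (decode (encode x))
      ≡⟨ cong h (decode-encode x) ⟩
    h x ∎

-- Partial sets can occur several times in a family, above all the empty one; only one copy of S
-- receives the new point.
insert : ∀ {l} → Subset l → List (Subset l) → List (Subset (suc l))
insert S []       = []
insert S (x ∷ xs) with S ≟ᴮ x
... | yes _ = (inside ∷ x) ∷ map (outside ∷_) xs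
... | no _  = (outside ∷ x) ∷ insert S xs

Disjoint : ∀ {l} → Subset l → Subset l → Set
Disjoint p q = ∀ i → i ∈ˢ p → i ∉ˢ q

disjoint-sym : ∀ {l} {p q : Subset l} → Disjoint p q → Disjoint q p
disjoint-sym d i i∈q i∈p = d i i∈p i∈q

module _ {l : ℕ} where

  length-insert : ∀ S (xs : List (Subset l)) → length (insert S xs) ≡ length xs
  length-insert S []       = refl
  length-insert S (x ∷ xs) with S ≟ᴮ x
  ... | yes _ = cong suc (length-map (outside ∷_) xs)
  ... | no _  = cong suc (length-insert S xs)

  count-inside-map : ∀ (T : Subset l) xs → count (inside ∷ T) (map (outside ∷_) xs) ≡ 0
  count-inside-map T []       = refl
  count-inside-map T (x ∷ xs) =
    cong₂ _+_ (𝟙-no ((inside ∷ T) ≟ᴮ (outside ∷ x)) λ ()) (count-inside-map T xs)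

  count-outside-map : ∀ (T : Subset l) xs → count (outside ∷ T) (map (outside ∷_) xs) ≡ count T xs
  count-outside-map T []       = refl
  count-outside-map T (x ∷ xs) =
    cong₂ _+_ (𝟙-cong ((outside ∷ T) ≟ᴮ (outside ∷ x)) (T ≟ᴮ x) ∷-injectiveʳ (cong (outside ∷_))) (count-outside-map T xs)

  count-inside-insert : ∀ {S : Subset l} {xs} T → S ∈ xs → count (inside ∷ T) (insert S xs) ≡ 𝟙 (S ≟ᴮ T)
  count-inside-insert {S} {x ∷ xs} T S∈ with S ≟ᴮ x
  ... | yes refl = trans (cong₂ _+_ (𝟙-cong ((inside ∷ T) ≟ᴮ (inside ∷ x)) (S ≟ᴮ T)
                     (sym ∘ ∷-injectiveʳ) (cong (inside ∷_) ∘ sym)) (count-inside-map T xs)) (+-identityʳ _)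
  ... | no S≢x   = cong₂ _+_ (𝟙-no ((inside ∷ T) ≟ᴮ (outside ∷ x)) λ ())
                     (count-inside-insert T (Any.tail S≢x S∈))

  count-outside-insert : ∀ {S : Subset l} {xs} T → S ∈ xs →
                         count (outside ∷ T) (insert S xs) + 𝟙 (S ≟ᴮ T) ≡ count T xs
  count-outside-insert {S} {x ∷ xs} T S∈ with S ≟ᴮ x
  ... | yes refl = trans
    (cong₂ _+_ (cong₂ _+_ (𝟙-no ((outside ∷ T) ≟ᴮ (inside ∷ x)) λ ()) (count-outside-map T xs))
               (𝟙-cong (S ≟ᴮ T) (T ≟ᴮ S) sym sym))
    (+-comm (count T xs) _)
  ... | no S≢x   = trans
    (+-assoc (𝟙 ((outside ∷ T) ≟ᴮ (outside ∷ x))) _ _)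
    (cong₂ _+_ (𝟙-cong ((outside ∷ T) ≟ᴮ (outside ∷ x)) (T ≟ᴮ x) ∷-injectiveʳ (cong (outside ∷_)))
               (count-outside-insert T (Any.tail S≢x S∈)))

  All-insert : ∀ {P : Subset l → Set} {Q : Subset (suc l) → Set} S →
               (∀ {x} → P x → Q (outside ∷ x)) → (P S → Q (inside ∷ S)) →
               ∀ {xs} → All P xs → All Q (insert S xs)
  All-insert S out ins [] = []
  All-insert S out ins {x ∷ xs} (p ∷ ps) with S ≟ᴮ x
  ... | yes refl = ins p ∷ All.map⁺ (All.map out ps)
  ... | no _     = out p ∷ All-insert S out ins ps

  disjoint-outside : ∀ {x} {p q : Subset l} → Disjoint p q → Disjoint (x ∷ p) (outside ∷ q)
  disjoint-outside d (suc i) (Vec.there i∈p) (Vec.there i∈q) = d i i∈p i∈q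

  AllPairs-insert : ∀ S {xs : List (Subset l)} → AllPairs Disjoint xs → AllPairs Disjoint (insert S xs)
  AllPairs-insert S [] = []
  AllPairs-insert S {x ∷ xs} (d ∷ ds) with S ≟ᴮ x
  ... | yes _ = All.map⁺ (All.map disjoint-outside d) ∷ AllPairs.map⁺ (AllPairs.map disjoint-outside ds)
  ... | no _  = All-insert S disjoint-outside
                  (λ {d → disjoint-sym (disjoint-outside (disjoint-sym d))}) d
                ∷ AllPairs-insert S ds

module _ (k : ℕ) where

  lack : ∀ {l} → List (Subset l) → ℕ
  lack xs = sumᴸ (map (λ S → k ∸ ∣ S ∣) xs)

  lack-map : ∀ {l} (xs : List (Subset l)) → lack (map (outside ∷_) xs) ≡ lack xs
  lack-map []       = refl
  lack-map (x ∷ xs) = cong (k ∸ ∣ x ∣ +_) (lack-map xs)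

  lack-insert : ∀ {l} {S : Subset l} {xs} → S ∈ xs → ∣ S ∣ < k → lack (insert S xs) < lack xs
  lack-insert {S = S} {x ∷ xs} S∈ S<k with S ≟ᴮ x
  ... | yes refl = +-mono-<-≤ (∸-monoʳ-< ≤-refl S<k) (≤-reflexive (lack-map xs))
  ... | no S≢x   = +-monoʳ-< (k ∸ ∣ x ∣) (lack-insert (Any.tail S≢x S∈) S<k)

  module _ {M : ℕ} (a : Fin M → ℕ) where

    -- With l points treated and ℓ to come, the members are the traces of the future k-sets on the
    -- treated points. A trace S extends to C(ℓ, k - |S|) sets of size k, hence `counts`; the
    -- members of a class need separate new points for all they lack, hence `room`.
    record Stage (l ℓ : ℕ) : Set where
      field
        family   : Fin M → List (Subset l)
        size     : ∀ i → length (family i) ≡ a i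
        disjoint : ∀ i → AllPairs Disjoint (family i)
        small    : ∀ i → All (λ S → ∣ S ∣ ≤ k) (family i)
        room     : ∀ i → lack (family i) ≤ ℓ
        counts   : ∀ S w → ∣ S ∣ + w ≡ k → ∑[ i < M ] count S (family i) ≡ ℓ C w

    module _ {l ℓ : ℕ} (stage : Stage l (suc ℓ)) where
      open Stage stage

      -- Among the k-sets extending a trace that lacks w points, the number that contain the next
      -- point.
      share : ℕ → ℕ
      share zero    = 0
      share (suc w) = ℓ C w

      -- Label zero stands for the elements outside all members of a family.
      target : Fin (suc (2 ^ l)) → ℕ
      target zero    = M ∸ ∑[ s < 2 ^ l ] share (k ∸ ∣ decode {l} s ∣)
      target (suc s) = share (k ∸ ∣ decode {l} s ∣)

      -- Baranyai's fractional solution: think of the next point as a uniformly random one of the ℓ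
      -- + 1 outstanding points. It is claimed by a copy of S in class i with probability `weight` /
      -- (ℓ + 1), each copy having one chance for each point it lacks.
      weight : Fin M → Fin (suc (2 ^ l)) → ℕ
      weight i zero    = suc ℓ ∸ lack (family i)
      weight i (suc s) = count (decode s) (family i) * (k ∸ ∣ decode {l} s ∣)

      rows : ∀ i → ∑[ s < suc (2 ^ l) ] weight i s ≡ suc ℓ
      rows i = trans (cong (suc ℓ ∸ lack (family i) +_) (∑-count (λ S → k ∸ ∣ S ∣) (family i)))
                     (m∸n+n≡m (room i))

      -- Absorption in binomial form: counting pairs of a k-set extending S and one of its
      -- outstanding points gives C(ℓ+1,w+1) (w+1) = (ℓ+1) C(ℓ,w).
      column : ∀ s → ∑[ i < M ] weight i (suc s) ≡ suc ℓ * target (suc s)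
      column s = trans (sym (*-distribʳ-sum (k ∸ ∣ S ∣) (λ i → count S (family i)))) (absorb refl)
        where
        S = decode {l} s
        absorb : ∀ {w} → k ∸ ∣ S ∣ ≡ w → ∑[ i < M ] count S (family i) * w ≡ suc ℓ * share w
        absorb {zero}  _  = trans (*-zeroʳ (∑[ i < M ] count S (family i))) (sym (*-zeroʳ (suc ℓ)))
        absorb {suc w} eq = trans
          (cong (_* suc w) (counts S (suc w) (trans (cong (∣ S ∣ +_) (sym eq)) (m+[n∸m]≡n (<⇒≤ ∣S∣<k)))))
          (C-absorb ℓ w)
          where
          ∣S∣<k : ∣ S ∣ < k
          ∣S∣<k = m∸n≢0⇒n<m λ eq′ → case trans (sym eq) eq′ of λ ()

      -- The column of label zero is what the other columns leave of the grand total (ℓ + 1) M; the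
      -- same total shows that nothing is truncated by the subtraction in `target`.
      column-zero : ∑[ i < M ] weight i zero ≡ suc ℓ * target zero
      column-zero = begin
        X                          ≡⟨ m+n≡o⇒m≡o∸n X whole ⟩
        suc ℓ * M ∸ suc ℓ * T      ≡⟨ *-distribˡ-∸ (suc ℓ) M T ⟨
        suc ℓ * (M ∸ T)            ∎
        where
        open ≡-Reasoning
        X = ∑[ i < M ] weight i zero
        T = ∑[ s < 2 ^ l ] target (suc s)
        m+n≡o⇒m≡o∸n : ∀ m {n o} → m + n ≡ o → m ≡ o ∸ n
        m+n≡o⇒m≡o∸n m {n} refl = sym (m+n∸n≡m m n)
        whole : X + suc ℓ * T ≡ suc ℓ * M
        whole = begin
          X + suc ℓ * T
            ≡⟨ cong (X +_) (*-distribˡ-sum (suc ℓ) (λ s → target (suc s))) ⟩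
          X + ∑[ s < 2 ^ l ] (suc ℓ * target (suc s))
            ≡⟨ cong (X +_) (sum-cong-≗ (sym ∘ column)) ⟩
          X + ∑[ s < 2 ^ l ] ∑[ i < M ] weight i (suc s)
            ≡⟨ ∑-comm (λ (s : Fin (suc (2 ^ l))) i → weight i s) ⟩
          ∑[ i < M ] ∑[ s < suc (2 ^ l) ] weight i s
            ≡⟨ sum-cong-≗ (λ i → trans (rows i) (sym (*-identityʳ (suc ℓ)))) ⟩
          ∑[ i < M ] (suc ℓ * 1)
            ≡⟨ *-distribˡ-sum (suc ℓ) (λ (_ : Fin M) → 1) ⟨
          suc ℓ * ∑[ i < M ] 1
            ≡⟨ cong (suc ℓ *_) (∑-ones M) ⟩
          suc ℓ * M ∎

      columns : ∀ s → ∑[ i < M ] weight i s ≡ suc ℓ * target s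
      columns zero    = column-zero
      columns (suc s) = column s

      choice = rounding target weight (suc ℓ) rows columns
      chosen : Fin M → Fin (suc (2 ^ l))
      chosen = proj₁ choice

      chosen-weight : ∀ i → 0 < weight i (chosen i)
      chosen-weight = proj₁ (proj₂ choice)
      chosen-count : ∀ s → ∑[ i < M ] 𝟙 (chosen i Fin.≟ s) ≡ target s
      chosen-count = proj₂ (proj₂ choice)

      extend : Fin (suc (2 ^ l)) → List (Subset l) → List (Subset (suc l))
      extend zero    xs = map (outside ∷_) xs
      extend (suc s) xs = insert (decode s) xs

      positive : ∀ {i s} → 0 < weight i (suc s) → decode s ∈ family i × ∣ decode {l} s ∣ < k
      positive {i} {s} pos = count⇒∈ (n≢0⇒n>0 λ eq → <⇒≢ pos (sym (cong (_* _) eq))) ,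
        m∸n≢0⇒n<m λ eq → <⇒≢ pos (sym (trans (cong (count (decode s) (family i) *_) eq) (*-zeroʳ (count (decode s) (family i)))))

      extend-length : ∀ s (xs : List (Subset l)) → length (extend s xs) ≡ length xs
      extend-length zero    xs = length-map _ xs
      extend-length (suc s) xs = length-insert (decode s) xs

      extend-disjoint : ∀ s {xs : List (Subset l)} → AllPairs Disjoint xs → AllPairs Disjoint (extend s xs)
      extend-disjoint zero    ds = AllPairs.map⁺ (AllPairs.map disjoint-outside ds)
      extend-disjoint (suc s) ds = AllPairs-insert (decode s) ds

      extend-small : ∀ i s → 0 < weight i s → All (λ S → ∣ S ∣ ≤ k) (extend s (family i))
      extend-small i zero    _   = All.map⁺ (small i)
      extend-small i (suc s) pos = All-insert (decode s) (λ p → p) (λ _ → proj₂ (positive {i} pos)) (small i)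

      -- One outstanding point is used up. If a member takes it, `lack` decreases; if none does,
      -- positive weight of label zero says that there was a point to spare.
      extend-room : ∀ i s → 0 < weight i s → lack (extend s (family i)) ≤ ℓ
      extend-room i zero    pos = ≤-trans (≤-reflexive (lack-map (family i)))
        (≤-pred (m∸n≢0⇒n<m λ eq → <⇒≢ pos (sym eq)))
      extend-room i (suc s) pos = let (S∈ , S<k) = positive {i} pos in
        ≤-pred (≤-trans (lack-insert S∈ S<k) (room i))

      label : ∀ s T → 𝟙 (decode {l} s ≟ᴮ T) ≡ 𝟙 (suc s Fin.≟ suc (encode T))
      label s T = 𝟙-cong (decode {l} s ≟ᴮ T) (suc s Fin.≟ suc (encode T))
        (λ { refl → cong suc (sym (encode-decode {l} s)) })
        (λ { refl → decode-encode T })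

      extend-inside : ∀ T i s → 0 < weight i s →
                      count (inside ∷ T) (extend s (family i)) ≡ 𝟙 (s Fin.≟ suc (encode T))
      extend-inside T i zero    pos = count-inside-map T (family i)
      extend-inside T i (suc s) pos =
        trans (count-inside-insert T (proj₁ (positive {i} pos))) (label s T)

      extend-outside : ∀ T i s → 0 < weight i s →
                       count (outside ∷ T) (extend s (family i)) + 𝟙 (s Fin.≟ suc (encode T)) ≡ count T (family i)
      extend-outside T i zero    pos = trans (+-identityʳ _) (count-outside-map T (family i))
      extend-outside T i (suc s) pos = trans (cong (count (outside ∷ T) (insert (decode s) (family i)) +_) (sym (label s T)))
        (count-outside-insert T (proj₁ (positive {i} pos)))

      picked : ∀ T {w} → ∣ T ∣ + w ≡ k → ∑[ i < M ] 𝟙 (chosen i Fin.≟ suc (encode T)) ≡ share w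
      picked T {w} eq = begin
        ∑[ i < M ] 𝟙 (chosen i Fin.≟ suc (encode T)) ≡⟨ chosen-count (suc (encode T)) ⟩
        share (k ∸ ∣ decode {l} (encode T) ∣)
          ≡⟨ cong (λ S → share (k ∸ ∣ S ∣)) (decode-encode {l} T) ⟩
        share (k ∸ ∣ T ∣)                            ≡⟨ cong (λ z → share (z ∸ ∣ T ∣)) (sym eq) ⟩
        share (∣ T ∣ + w ∸ ∣ T ∣)                    ≡⟨ cong share (m+n∸m≡n ∣ T ∣ w) ⟩
        share w                                      ∎
        where open ≡-Reasoning

      nextStage : Stage (suc l) ℓ
      nextStage = record
        { family   = family′
        ; size     = λ i → trans (extend-length (chosen i) (family i)) (size i)
        ; disjoint = λ i → extend-disjoint (chosen i) (disjoint i)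
        ; small    = λ i → extend-small i (chosen i) (chosen-weight i)
        ; room     = λ i → extend-room i (chosen i) (chosen-weight i)
        ; counts   = counts′
        }
        where
        open ≡-Reasoning
        family′ : Fin M → List (Subset (suc l))
        family′ i = extend (chosen i) (family i)
        counts′ : ∀ S w → ∣ S ∣ + w ≡ k → ∑[ i < M ] count S (family′ i) ≡ ℓ C w
        counts′ (inside ∷ T) w eq = trans
          (sum-cong-≗ (λ i → extend-inside T i (chosen i) (chosen-weight i)))
          (picked T {suc w} (trans (+-suc ∣ T ∣ w) eq))
        -- The copies of T without the new point are all old copies minus the chosen ones, so
        -- Pascal's rule C(ℓ+1,w) = C(ℓ,w) + C(ℓ,w-1) gives their number.
        counts′ (outside ∷ T) w eq = +-cancelʳ-≡ (share w) _ _ (begin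
          ∑[ i < M ] count (outside ∷ T) (family′ i) + share w
            ≡⟨ cong (∑[ i < M ] count (outside ∷ T) (family′ i) +_) (picked T {w} eq) ⟨
          ∑[ i < M ] count (outside ∷ T) (family′ i) + ∑[ i < M ] 𝟙 (chosen i Fin.≟ suc (encode T))
            ≡⟨ ∑-distrib-+ (λ i → count (outside ∷ T) (family′ i)) (λ i → 𝟙 (chosen i Fin.≟ suc (encode T))) ⟨
          ∑[ i < M ] (count (outside ∷ T) (family′ i) + 𝟙 (chosen i Fin.≟ suc (encode T)))
            ≡⟨ sum-cong-≗ (λ i → extend-outside T i (chosen i) (chosen-weight i)) ⟩
          ∑[ i < M ] count T (family i)
            ≡⟨ counts T w eq ⟩
          suc ℓ C w
            ≡⟨ pascal w ⟩
          ℓ C w + share w ∎)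
          where
          pascal : ∀ w → suc ℓ C w ≡ ℓ C w + share w
          pascal zero    = refl
          pascal (suc w) = trans (sym (nCk+nC[k+1]≡[n+1]C[k+1] ℓ w)) (+-comm (ℓ C w) _)

    abstract
      stages : ∀ {g} ℓ {l} → ℓ + l ≡ g → Stage l ℓ → Stage g 0
      stages zero    refl stage = stage
      stages (suc ℓ) eq   stage = stages ℓ (trans (+-suc ℓ _) eq) (nextStage stage)

    -- Before any point is treated every k-set has the empty trace, so each class consists of copies
    -- of the empty set and `counts` amounts to the total number of sets.
    initial : ∀ {g} → (∀ i → a i * k ≤ g) → sum a ≡ g C k → Stage 0 g
    initial {g} fits total = record
      { family   = λ i → replicate (a i) []
      ; size     = λ i → length-replicate (a i)
      ; disjoint = λ i → disjoint-replicate (a i)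
      ; small    = λ i → All.replicate⁺ (a i) z≤n
      ; room     = λ i → ≤-trans (≤-reflexive (lack-replicate (a i))) (fits i)
      ; counts   = λ { [] w refl → trans (sum-cong-≗ (λ i → count-replicate (a i))) total }
      }
      where
      disjoint-replicate : ∀ b → AllPairs (Disjoint {0}) (replicate b [])
      disjoint-replicate zero    = []
      disjoint-replicate (suc b) = All.replicate⁺ b (λ ()) ∷ disjoint-replicate b
      lack-replicate : ∀ b → lack {0} (replicate b []) ≡ b * k
      lack-replicate zero    = refl
      lack-replicate (suc b) = cong (k +_) (lack-replicate b)
      count-replicate : ∀ b → count [] (replicate b []) ≡ b
      count-replicate zero    = refl
      count-replicate (suc b) = cong suc (count-replicate b)

record SetPartition (g k : ℕ) {M : ℕ} (a : Fin M → ℕ) : Set where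
  field
    member    : ∀ i → Fin (a i) → Subset g
    sized     : ∀ i j → ∣ member i j ∣ ≡ k
    disjoint  : ∀ i {j j′} → j ≢ j′ → Disjoint (member i j) (member i j′)
    injective : ∀ {i i′ j j′} → member i j ≡ member i′ j′ → _≡_ {A = Σ (Fin M) (Fin ∘ a)} (i , j) (i′ , j′)
    covers    : ∀ S → ∣ S ∣ ≡ k → ∃[ i ] ∃[ j ] member i j ≡ S

∑-unique : ∀ {n} (f : Fin n → ℕ) → sum f ≤ 1 → ∀ {i j} → 0 < f i → 0 < f j → i ≡ j
∑-unique f ≤1 {zero}  {zero}  fi fj = refl
∑-unique f ≤1 {zero}  {suc j} fi fj = contradiction ≤1
  (<⇒≱ (+-mono-≤ fi (≤-trans fj (≤-∑ (f ∘ suc) j))))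
∑-unique f ≤1 {suc i} {zero}  fi fj = contradiction ≤1
  (<⇒≱ (+-mono-≤ fj (≤-trans fi (≤-∑ (f ∘ suc) i))))
∑-unique f ≤1 {suc i} {suc j} fi fj =
  cong suc (∑-unique (f ∘ suc) (≤-trans (m≤n+m _ (f zero)) ≤1) fi fj)

∑-positive : ∀ {n} (f : Fin n → ℕ) → 0 < sum f → ∃[ i ] 0 < f i
∑-positive {suc n} f pos with f zero in eq
... | suc _ = zero , subst (0 <_) (sym eq) (s≤s z≤n)
... | zero  = let (i , fi) = ∑-positive (f ∘ suc) pos in suc i , fi

AllPairs-lookup : ∀ {A : Set} {R : A → A → Set} → (∀ {x y} → R x y → R y x) →
                  ∀ {xs} → AllPairs R xs → ∀ {i j} → i ≢ j → R (List.lookup xs i) (List.lookup xs j)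
AllPairs-lookup R-sym (r ∷ rs) {zero}  {zero}  i≢j = contradiction refl i≢j
AllPairs-lookup R-sym (r ∷ rs) {zero}  {suc j} i≢j = All.lookup r (∈-lookup j)
AllPairs-lookup R-sym (r ∷ rs) {suc i} {zero}  i≢j = R-sym (All.lookup r (∈-lookup i))
AllPairs-lookup R-sym (r ∷ rs) {suc i} {suc j} i≢j = AllPairs-lookup R-sym rs (i≢j ∘ cong suc)

∣p∣>0⇒nonempty : ∀ {n} (p : Subset n) → 0 < ∣ p ∣ → ∃[ i ] i ∈ˢ p
∣p∣>0⇒nonempty (inside ∷ p)  _   = zero , Vec.here
∣p∣>0⇒nonempty (outside ∷ p) pos = let (i , i∈) = ∣p∣>0⇒nonempty p pos in suc i , Vec.there i∈

-- When no points are outstanding, `room` forces every member to have size k, and C(0,0) = 1 makes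
-- every k-set occur once. The class sizes are prescribed individually, so that large classes can be
-- combined with classes of size one.
baranyai : ∀ {g k M} (a : Fin M → ℕ) → 0 < k → (∀ i → a i * k ≤ g) → sum a ≡ g C k → SetPartition g k a
baranyai {g} {k} {M} a k>0 fits total = record
  { member    = member
  ; sized     = sized
  ; disjoint  = disjoint′
  ; injective = injective
  ; covers    = covers
  }
  where
  final : Stage k a g 0
  final = stages k a g (+-identityʳ g) (initial k a fits total)
  open Stage final

  position : ∀ i → Fin (a i) → Fin (length (family i))
  position i = cast (sym (size i))

  position-injective : ∀ i {j j′} → position i j ≡ position i j′ → j ≡ j′
  position-injective i {j} {j′} eq = Fin.toℕ-injective
    (trans (sym (Fin.toℕ-cast _ j)) (trans (cong toℕ eq) (Fin.toℕ-cast _ j′)))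

  member : ∀ i → Fin (a i) → Subset g
  member i j = List.lookup (family i) (position i j)

  member-∈ : ∀ i j → member i j ∈ family i
  member-∈ i j = ∈-lookup (position i j)

  all-full : ∀ xs → lack k xs ≤ 0 → All (λ S → ∣ S ∣ ≤ k) xs → All (λ S → ∣ S ∣ ≡ k) xs
  all-full []       _ []       = []
  all-full (x ∷ xs) l (p ∷ ps) =
    ≤-antisym p (m∸n≡0⇒m≤n (n≤0⇒n≡0 (m+n≤o⇒m≤o _ l))) ∷ all-full xs (m+n≤o⇒n≤o (k ∸ ∣ x ∣) l) ps

  sized : ∀ i j → ∣ member i j ∣ ≡ k
  sized i j = All.lookup (all-full (family i) (room i) (small i)) (member-∈ i j)

  disjoint′ : ∀ i {j j′} → j ≢ j′ → Disjoint (member i j) (member i j′)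
  disjoint′ i j≢j′ = AllPairs-lookup disjoint-sym (disjoint i) (j≢j′ ∘ position-injective i)

  once : ∀ S → ∣ S ∣ ≡ k → ∑[ i < M ] count S (family i) ≡ 1
  once S eq = counts S 0 (trans (+-identityʳ _) eq)

  injective : ∀ {i i′ j j′} → member i j ≡ member i′ j′ → (i , j) ≡ (i′ , j′)
  injective {i} {i′} {j} {j′} eq
    with ∑-unique (λ z → count (member i j) (family z)) (≤-reflexive (once _ (sized i j)))
           (∈⇒count (member-∈ i j)) (∈⇒count (subst (_∈ family i′) (sym eq) (member-∈ i′ j′)))
  ... | refl with j Fin.≟ j′
  ... | yes refl = refl
  -- Equal sets at two places of one class would be disjoint from themselves, which k > 0 rules out.
  ... | no j≢j′  = let (x , x∈) = ∣p∣>0⇒nonempty (member i j) (subst (0 <_) (sym (sized i j)) k>0) in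
    contradiction (subst (x ∈ˢ_) eq x∈) (disjoint′ i j≢j′ x x∈)

  covers : ∀ S → ∣ S ∣ ≡ k → ∃[ i ] ∃[ j ] member i j ≡ S
  covers S eq with ∑-positive (λ i → count S (family i)) (≤-reflexive (sym (once S eq)))
  ... | i , pos = i , cast (size i) (index S∈) , trans (cong (List.lookup (family i)) cast-cast) (sym (lookup-index S∈))
    where
    S∈ : S ∈ family i
    S∈ = count⇒∈ pos
    cast-cast : position i (cast (size i) (index S∈)) ≡ index S∈
    cast-cast = Fin.toℕ-injective (trans (Fin.toℕ-cast (sym (size i)) (cast (size i) (index S∈))) (Fin.toℕ-cast (size i) (index S∈)))

-- Colourings and dominating stars of the Kneser complement

distribute : ∀ q M N → N ≤ M * q → ∃[ a ] (∀ (i : Fin M) → a i ≤ q) × sum a ≡ N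
distribute q zero    N N≤ = (λ ()) , (λ ()) , sym (n≤0⇒n≡0 N≤)
distribute q (suc M) N N≤ with distribute q M (N ∸ q) (m≤n+o⇒m∸n≤o N q N≤)
... | a , a≤q , total = (λ { zero → q ⊓ N ; (suc i) → a i })
                      , (λ { zero → m⊓n≤m q N ; (suc i) → a≤q i })
                      , trans (cong (q ⊓ N +_) total) (m⊓n+n∸m≡n q N)

module _ {n k M : ℕ} {a : Fin M → ℕ} (P : SetPartition n k a) where
  open SetPartition P

  class-disjoint : ∀ {i i′ j j′} → i ≡ i′ → member i j ≢ member i′ j′ →
                   Disjoint (member i j) (member i′ j′)
  class-disjoint {i} refl distinct = disjoint i λ { refl → distinct refl }

  partition-colouring : Colourable (K̄ n k) M
  partition-colouring = colour , proper
    where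
    colour : KSubset n k → Fin M
    colour (A , ∣A∣) = proj₁ (covers A ∣A∣)
    proper : ∀ u v → Adj (K̄ n k) u v → colour u ≢ colour v
    proper u@(A , ∣A∣) v@(B , ∣B∣) (u≢v , ¬disjoint) same = ¬disjoint (u≢v , λ (x , x∈) →
      let (_ , _ , A≡) = covers A ∣A∣
          (_ , _ , B≡) = covers B ∣B∣
          (x∈A , x∈B)  = x∈p∩q⁻ A B x∈
      in class-disjoint same (λ eq → u≢v (kSubset-≡ (trans (sym A≡) (trans eq B≡))))
           x (subst (x ∈ˢ_) (sym A≡) x∈A) (subst (x ∈ˢ_) (sym B≡) x∈B))

χ-bound : ∀ {n k} q M → 0 < k → q * k ≤ n → n C k ≤ M * q → χ (K̄ n k) ≤ M
χ-bound {n} {k} q M k>0 qk≤n few with distribute q M (n C k) few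
... | a , a≤q , total = proj₂ (χ-isChromaticNumber (K̄ n k)) (partition-colouring
        (baranyai a k>0 (λ i → ≤-trans (*-monoˡ-≤ k (a≤q i)) qk≤n) total))

-- Baranyai's theorem with all classes of size one serves as a numbering of the k-subsets.
enumerate : ∀ {g k} → 0 < k → k ≤ g →
            ∃[ e ] Injective _≡_ _≡_ e × (∀ (i : Fin (g C k)) → ∣ e i ∣ ≡ k)
enumerate {g} {k} k>0 k≤g =
  (λ i → member i zero) , (λ eq → case injective eq of λ { refl → refl }) , λ i → sized i zero
  where
  open SetPartition (baranyai {M = g C k} (λ _ → 1) k>0
    (λ _ → ≤-trans (≤-reflexive (*-identityˡ k)) k≤g) (∑-ones (g C k)))

pigeonhole : ∀ {n} (p q : Subset n) → n < ∣ p ∣ + ∣ q ∣ → ∃[ x ] x ∈ˢ p × x ∈ˢ q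
pigeonhole [] [] ()
pigeonhole (inside ∷ p) (inside ∷ q) _ = zero , here , here
pigeonhole (inside ∷ p) (outside ∷ q) lt =
  let (x , x∈p , x∈q) = pigeonhole p q (≤-pred lt) in suc x , there x∈p , there x∈q
pigeonhole (outside ∷ p) (inside ∷ q) lt =
  let (x , x∈p , x∈q) = pigeonhole p q (≤-pred (≤-trans lt (≤-reflexive (+-suc ∣ p ∣ ∣ q ∣)))) in
  suc x , there x∈p , there x∈q
pigeonhole (outside ∷ p) (outside ∷ q) lt =
  let (x , x∈p , x∈q) = pigeonhole p q (≤-trans (n≤1+n _) lt) in suc x , there x∈p , there x∈q

-- Stars of k-subsets of [m] with centre `member i zero` whose leaves cover at
-- least m - k + 2 points and thus meet every (k - 1)-subset of [m].
record Dominators (m k b : ℕ) (I : Set) : Set where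
  field
    member    : I → Fin (suc b) → Subset m
    sized     : ∀ i j → ∣ member i j ∣ ≡ k
    injective : ∀ {i i′ j j′} → member i j ≡ member i′ j′ → i ≡ i′ × j ≡ j′
    meets     : ∀ i j → ∃[ x ] x ∈ˢ member i zero × x ∈ˢ member i (suc j)
    cover     : I → Subset m
    covered   : ∀ i {x} → x ∈ˢ cover i → ∃[ j ] x ∈ˢ member i (suc j)
    large     : ∀ i → m + 2 ≤ ∣ cover i ∣ + k

adjacent : ∀ {n k} {A B : KSubset n k} {x} → proj₁ A ≢ proj₁ B → x ∈ˢ proj₁ A → x ∈ˢ proj₁ B →
           Adj (K̄ n k) A B
adjacent {x = x} A≢B x∈A x∈B = A≢B ∘ cong proj₁ , λ (_ , empty) → empty (x , x∈p∩q⁺ (x∈A , x∈B))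

module _ {m k : ℕ} (k>0 : 0 < k) (2k≤n : 2 * suc k ≤ suc m) where

  private
    G = K̄ (suc m) (suc k)

    k≤m : k ≤ m
    k≤m = ≤-pred (≤-trans (m≤m+n (suc k) (suc k + 0)) 2k≤n)

    points = enumerate k>0 k≤m

    point-vertex : Fin (m C k) → KSubset (suc m) (suc k)
    point-vertex e = inside ∷ proj₁ points e , cong suc (proj₂ (proj₂ points) e)

    heads-differ : {p q : Subset m} → _≢_ {A = Subset (suc m)} (inside ∷ p) (outside ∷ q)
    heads-differ ()

  cliqueFamily : BagFamily G (Fin (m C k))
  cliqueFamily = record
    { bag      = λ e → point (point-vertex e)
    ; isBag    = λ e → record { terminal = point-vertex e , here refl ; spokes = λ () }
    ; disjoint = λ { (here refl) (here eq) → proj₁ (proj₂ points) (∷-injectiveʳ (cong proj₁ eq)) }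
    ; linked   = λ {e} {e′} e≢e′ → point-vertex e , point-vertex e′ ,
        adjacent (λ eq → e≢e′ (proj₁ (proj₂ points) (∷-injectiveʳ eq))) here here ,
        here refl , here refl
    }

  module _ {b : ℕ} {I : Set} (D : Dominators m (suc k) b I) where
    open Dominators D

    private
      vertex : I → Fin (suc b) → KSubset (suc m) (suc k)
      vertex i j = outside ∷ member i j , sized i j

      vertex-injective : ∀ {i i′ j j′} → vertex i j ≡ vertex i′ j′ → i ≡ i′ × j ≡ j′
      vertex-injective eq = injective (∷-injectiveʳ (cong proj₁ eq))

      bag : Fin (m C k) ⊎ I → Bag (KSubset (suc m) (suc k))
      bag (inj₁ e) = point (point-vertex e)
      bag (inj₂ i) = star (vertex i zero) (List.tabulate (vertex i ∘ suc))

      leaf-∈ : ∀ i j → vertex i (suc j) ∈ terminals (bag (inj₂ i))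
      leaf-∈ i j = ∈-tabulate⁺ {f = vertex i ∘ suc} j

      body-member : ∀ i {v} → v ∈ body (bag (inj₂ i)) → ∃[ j ] v ≡ vertex i j
      body-member i (here refl) = zero , refl
      body-member i (there v∈)  = let (j , eq) = ∈-tabulate⁻ {f = vertex i ∘ suc} v∈ in suc j , eq

      hits : ∀ i p → m < ∣ p ∣ + ∣ cover i ∣ → ∃[ j ] ∃[ x ] x ∈ˢ p × x ∈ˢ member i (suc j)
      hits i p lt = let (x , x∈p , x∈c) = pigeonhole p (cover i) lt
                        (j , x∈j) = covered i x∈c in j , x , x∈p , x∈j

      cover-points : ∀ i → m < k + ∣ cover i ∣
      cover-points i = ≤-pred (≤-trans (≤-reflexive (+-comm 2 m)) (≤-trans (large i)
        (≤-reflexive (+-comm ∣ cover i ∣ (suc k)))))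

      -- The vertices are sets of size k + 1, so each cover has at least m - k + 1 of the m points,
      -- while n ≥ 2(k + 1) means 2 k ≤ m - 1. Hence any two covers overlap; applied to one cover
      -- twice, this also yields a leaf.
      cover-cover : ∀ i i′ → m < ∣ cover i ∣ + ∣ cover i′ ∣
      cover-cover i i′ = +-cancelʳ-≤ (suc k + k) (suc m) _ (begin
        suc m + (suc k + k)                                ≤⟨ +-monoʳ-≤ (suc m) bound ⟩
        suc m + suc m
          ≤⟨ +-mono-≤ (cover-points i) (cover-points i′) ⟩
        (k + ∣ cover i ∣) + (k + ∣ cover i′ ∣)
          ≤⟨ ≤-reflexive (rearrange k (∣ cover i ∣) (∣ cover i′ ∣)) ⟩
        ∣ cover i ∣ + ∣ cover i′ ∣ + (k + k)
          ≤⟨ +-monoʳ-≤ (∣ cover i ∣ + ∣ cover i′ ∣) (n≤1+n _) ⟩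
        ∣ cover i ∣ + ∣ cover i′ ∣ + (suc k + k)           ∎)
        where
        open ≤-Reasoning
        bound : suc k + k ≤ suc m
        bound = ≤-trans (+-monoʳ-≤ (suc k) (≤-trans (m≤m+n k 0) (n≤1+n _))) 2k≤n
        rearrange : ∀ k c d → (k + c) + (k + d) ≡ c + d + (k + k)
        rearrange = solve-∀

    dominatorFamily : BagFamily G (Fin (m C k) ⊎ I)
    dominatorFamily = record
      { bag      = bag
      ; isBag    = isBag
      ; disjoint = disjoint
      ; linked   = linked
      }
      where
      isBag : ∀ i → IsBag G (bag i)
      isBag (inj₁ e) = record { terminal = point-vertex e , here refl ; spokes = λ () }
      isBag (inj₂ i) = record
        { terminal = let (j , _) = hits i (cover i) (cover-cover i i) in vertex i (suc j) , leaf-∈ i j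
        ; spokes   = λ { (here refl) l∈ → spoke l∈ }
        }
        where
        spoke : ∀ {l} → l ∈ List.tabulate (vertex i ∘ suc) → Adj G (vertex i zero) l
        spoke l∈ with ∈-tabulate⁻ {f = vertex i ∘ suc} l∈
        ... | j , refl = let (x , x∈ , x∈′) = meets i j in
          adjacent (λ eq → case proj₂ (injective (∷-injectiveʳ eq)) of λ ()) (there x∈) (there x∈′)

      disjoint : ∀ {i j v} → v ∈ body (bag i) → v ∈ body (bag j) → i ≡ j
      disjoint {inj₁ e} {inj₁ e′} v∈ v∈′ = cong inj₁ (BagFamily.disjoint cliqueFamily v∈ v∈′)
      disjoint {inj₁ e} {inj₂ i}  (here refl) v∈ = contradiction (cong proj₁ (proj₂ (body-member i v∈))) heads-differ
      disjoint {inj₂ i} {inj₁ e}  v∈ (here refl) = contradiction (cong proj₁ (proj₂ (body-member i v∈))) heads-differ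
      disjoint {inj₂ i} {inj₂ i′} v∈ v∈′ with body-member i v∈ | body-member i′ v∈′
      ... | _ , refl | _ , eq = cong inj₂ (proj₁ (vertex-injective eq))

      linked : ∀ {i j} → i ≢ j →
               ∃[ u ] ∃[ v ] Adj G u v × u ∈ terminals (bag i) × v ∈ terminals (bag j)
      linked {inj₁ e} {inj₁ e′} i≢j = BagFamily.linked cliqueFamily (i≢j ∘ cong inj₁)
      linked {inj₁ e} {inj₂ i} _ =
        let (j , x , x∈ , x∈′) = hits i (proj₁ points e) (subst (λ z → m < z + ∣ cover i ∣)
                                   (sym (proj₂ (proj₂ points) e)) (cover-points i)) in
        point-vertex e , vertex i (suc j) , adjacent heads-differ (there x∈) (there x∈′) , here refl , leaf-∈ i j
      linked {inj₂ i} {inj₁ e} _ =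
        let (j , x , x∈ , x∈′) = hits i (proj₁ points e) (subst (λ z → m < z + ∣ cover i ∣)
                                   (sym (proj₂ (proj₂ points) e)) (cover-points i)) in
        vertex i (suc j) , point-vertex e , adjacent (heads-differ ∘ sym) (there x∈′) (there x∈) , leaf-∈ i j , here refl
      linked {inj₂ i} {inj₂ i′} i≢i′ =
        let (x , x∈c , x∈c′) = pigeonhole (cover i) (cover i′) (cover-cover i i′)
            (j , x∈) = covered i x∈c
            (j′ , x∈′) = covered i′ x∈c′ in
        vertex i (suc j) , vertex i′ (suc j′) ,
        adjacent (λ eq → i≢i′ (cong inj₂ (proj₁ (injective (∷-injectiveʳ eq))))) (there x∈) (there x∈′) ,
        leaf-∈ i j , leaf-∈ i′ j′

-- Stars through one and through two of three points

-- The grouped sets are meant as the leaves of y stars, disjoint within a star; the ungrouped ones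
-- are a reserve from which centres may be drawn.
record Classes (g k y b z : ℕ) : Set where
  field
    grouped             : Fin y → Fin b → Subset g
    ungrouped           : Fin z → Subset g
    grouped-sized       : ∀ i j → ∣ grouped i j ∣ ≡ k
    ungrouped-sized     : ∀ i → ∣ ungrouped i ∣ ≡ k
    grouped-disjoint    : ∀ i {j j′} → j ≢ j′ → Disjoint (grouped i j) (grouped i j′)
    grouped-injective   : ∀ {i i′ j j′} → grouped i j ≡ grouped i′ j′ → i ≡ i′ × j ≡ j′
    ungrouped-injective : ∀ {i i′} → ungrouped i ≡ ungrouped i′ → i ≡ i′
    grouped≢ungrouped   : ∀ {i j i′} → grouped i j ≢ ungrouped i′

∑-split : ∀ m {n} (f : Fin (m + n) → ℕ) → sum f ≡ ∑[ i < m ] f (i ↑ˡ n) + ∑[ j < n ] f (m ↑ʳ j)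
∑-split zero    f = refl
∑-split (suc m) f = trans (cong (f zero +_) (∑-split m (f ∘ suc))) (sym (+-assoc (f zero) _ _))

∑-const : ∀ n c → ∑[ i < n ] c ≡ n * c
∑-const zero    c = refl
∑-const (suc n) c = cong (c +_) (∑-const n c)

classes : ∀ {g k} y b z → 0 < k → k ≤ g → b * k ≤ g → y * b + z ≡ g C k → Classes g k y b z
classes {g} {k} y b z k>0 k≤g bk≤g total = record
  { grouped             = λ i j → member (i ↑ˡ z) (place i j)
  ; ungrouped           = λ i → member (y ↑ʳ i) (place′ i)
  ; grouped-sized       = λ i j → sized (i ↑ˡ z) (place i j)
  ; ungrouped-sized     = λ i → sized (y ↑ʳ i) (place′ i)
  ; grouped-disjoint    = λ i j≢j′ → disjoint (i ↑ˡ z) (j≢j′ ∘ place-injective i)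
  ; grouped-injective   = λ eq → grouped-inj (injective eq)
  ; ungrouped-injective = λ eq → Fin.↑ʳ-injective y _ _ (cong proj₁ (injective eq))
  ; grouped≢ungrouped   = λ {i} {j} {i′} eq → case trans (sym (Fin.splitAt-↑ˡ y i z))
      (trans (cong (splitAt y) (cong proj₁ (injective eq))) (Fin.splitAt-↑ʳ y z i′)) of λ ()
  }
  where
  size : Fin (y + z) → ℕ
  size i = [ const b , const 1 ]′ (splitAt y i)

  size-grouped : ∀ i → size (i ↑ˡ z) ≡ b
  size-grouped i = cong [ const b , const 1 ]′ (Fin.splitAt-↑ˡ y i z)

  size-single : ∀ i → size (y ↑ʳ i) ≡ 1
  size-single i = cong [ const b , const 1 ]′ (Fin.splitAt-↑ʳ y z i)

  fits : ∀ i → size i * k ≤ g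
  fits i with splitAt y i
  ... | inj₁ _ = bk≤g
  ... | inj₂ _ = ≤-trans (≤-reflexive (*-identityˡ k)) k≤g

  sizes : sum size ≡ g C k
  sizes = begin
    sum size                                                  ≡⟨ ∑-split y size ⟩
    ∑[ i < y ] size (i ↑ˡ z) + ∑[ i < z ] size (y ↑ʳ i)
      ≡⟨ cong₂ _+_ (sum-cong-≗ size-grouped) (sum-cong-≗ size-single) ⟩
    ∑[ i < y ] b + ∑[ i < z ] 1
      ≡⟨ cong₂ _+_ (∑-const y b) (∑-ones z) ⟩
    y * b + z                                                 ≡⟨ total ⟩
    g C k                                                     ∎
    where open ≡-Reasoning

  open SetPartition (baranyai size k>0 fits sizes)

  place : ∀ i → Fin b → Fin (size (i ↑ˡ z))
  place i = cast (sym (size-grouped i))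

  place′ : ∀ i → Fin (size (y ↑ʳ i))
  place′ i = cast (sym (size-single i)) zero

  place-injective : ∀ i {j j′} → place i j ≡ place i j′ → j ≡ j′
  place-injective i {j} {j′} eq = Fin.toℕ-injective
    (trans (sym (Fin.toℕ-cast (sym (size-grouped i)) j)) (trans (cong toℕ eq) (Fin.toℕ-cast (sym (size-grouped i)) j′)))

  grouped-inj : ∀ {i i′ j j′} → _≡_ {A = Σ (Fin (y + z)) (Fin ∘ size)} (i ↑ˡ z , place i j) (i′ ↑ˡ z , place i′ j′) → i ≡ i′ × j ≡ j′
  grouped-inj {i} {i′} {j} {j′} eq = Fin.↑ˡ-injective z i i′ (cong proj₁ eq) , Fin.toℕ-injective (begin
    toℕ j                    ≡⟨ Fin.toℕ-cast (sym (size-grouped i)) j ⟨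
    toℕ (place i j)          ≡⟨ cong (λ p → toℕ (proj₂ p)) eq ⟩
    toℕ (place i′ j′)        ≡⟨ Fin.toℕ-cast (sym (size-grouped i′)) j′ ⟩
    toℕ j′                   ∎)
    where open ≡-Reasoning

⋃ : ∀ {b g} → (Fin b → Subset g) → Subset g
⋃ {zero}  f = ∅
⋃ {suc b} f = f zero ∪ ⋃ (f ∘ suc)

∈-⋃ : ∀ {b g} (f : Fin b → Subset g) {x} → x ∈ˢ ⋃ f → ∃[ j ] x ∈ˢ f j
∈-⋃ {zero}  f x∈ = contradiction x∈ ∉⊥
∈-⋃ {suc b} f x∈ with x∈p∪q⁻ (f zero) (⋃ (f ∘ suc)) x∈
... | inj₁ x∈f = zero , x∈f
... | inj₂ x∈⋃ = let (j , x∈f) = ∈-⋃ (f ∘ suc) x∈⋃ in suc j , x∈f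

disjoint-tail : ∀ {n a b} {p q : Subset n} → Disjoint (a ∷ p) (b ∷ q) → Disjoint p q
disjoint-tail d i i∈p i∈q = d (suc i) (there i∈p) (there i∈q)

∣disjoint-∪∣ : ∀ {n} (p q : Subset n) → Disjoint p q → ∣ p ∪ q ∣ ≡ ∣ p ∣ + ∣ q ∣
∣disjoint-∪∣ [] [] d = refl
∣disjoint-∪∣ (outside ∷ p) (outside ∷ q) d = ∣disjoint-∪∣ p q (disjoint-tail d)
∣disjoint-∪∣ (outside ∷ p) (inside ∷ q)  d = trans (cong suc (∣disjoint-∪∣ p q (disjoint-tail d))) (sym (+-suc ∣ p ∣ ∣ q ∣))
∣disjoint-∪∣ (inside ∷ p)  (outside ∷ q) d = cong suc (∣disjoint-∪∣ p q (disjoint-tail d))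
∣disjoint-∪∣ (inside ∷ p)  (inside ∷ q)  d = contradiction here (d zero here)

∣⋃∣ : ∀ {b g k} (f : Fin b → Subset g) → (∀ j → ∣ f j ∣ ≡ k) →
      (∀ {j j′} → j ≢ j′ → Disjoint (f j) (f j′)) → ∣ ⋃ f ∣ ≡ b * k
∣⋃∣ {zero}  {g} f sized disjoint = ∣⊥∣≡0 g
∣⋃∣ {suc b} {k = k} f sized disjoint = trans
  (∣disjoint-∪∣ (f zero) (⋃ (f ∘ suc)) λ x x∈ x∈⋃ →
    let (j , x∈j) = ∈-⋃ (f ∘ suc) x∈⋃ in disjoint (λ ()) x x∈ x∈j)
  (cong₂ _+_ (sized zero) (∣⋃∣ (f ∘ suc) (sized ∘ suc) λ j≢j′ → disjoint (j≢j′ ∘ Fin.suc-injective)))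

-- The three points are ordered cyclically: j is present, its predecessor absent and its successor
-- optional. Each nonempty proper subset of the three points arises in this way just once, which
-- keeps the three copies apart.
prefix : Fin 3 → Bool → Subset 3
prefix 0F x = inside ∷ x ∷ outside ∷ []
prefix 1F x = outside ∷ inside ∷ x ∷ []
prefix 2F x = x ∷ outside ∷ inside ∷ []

prefix⁻¹ : Subset 3 → Maybe (Fin 3 × Bool)
prefix⁻¹ (inside ∷ x ∷ outside ∷ [])  = just (0F , x)
prefix⁻¹ (outside ∷ inside ∷ x ∷ [])  = just (1F , x)
prefix⁻¹ (x ∷ outside ∷ inside ∷ [])  = just (2F , x)
prefix⁻¹ _                            = nothing

prefix⁻¹-prefix : ∀ j x → prefix⁻¹ (prefix j x) ≡ just (j , x)
prefix⁻¹-prefix 0F outside = refl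
prefix⁻¹-prefix 0F inside  = refl
prefix⁻¹-prefix 1F outside = refl
prefix⁻¹-prefix 1F inside  = refl
prefix⁻¹-prefix 2F outside = refl
prefix⁻¹-prefix 2F inside  = refl

prefix-injective : ∀ {j j′ x x′} → prefix j x ≡ prefix j′ x′ → j ≡ j′ × x ≡ x′
prefix-injective {j} {j′} {x} {x′} eq with refl ← just-injective
  (trans (sym (prefix⁻¹-prefix j x)) (trans (cong prefix⁻¹ eq) (prefix⁻¹-prefix j′ x′))) = refl , refl

∣++∣ : ∀ {m n} (p : Subset m) (q : Subset n) → ∣ p ++ⱽ q ∣ ≡ ∣ p ∣ + ∣ q ∣
∣++∣ []            q = refl
∣++∣ (inside ∷ p)  q = cong suc (∣++∣ p q)
∣++∣ (outside ∷ p) q = ∣++∣ p q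

++⁻ : ∀ {m n} (p : Subset m) {q : Subset n} {x} → x ∈ˢ p ++ⱽ q →
      (∃[ y ] y ∈ˢ p × x ≡ y ↑ˡ n) ⊎ (∃[ y ] y ∈ˢ q × x ≡ m ↑ʳ y)
++⁻ []      x∈ = inj₂ (_ , x∈ , refl)
++⁻ (_ ∷ p) here = inj₁ (zero , here , refl)
++⁻ (_ ∷ p) (there x∈) with ++⁻ p x∈
... | inj₁ (y , y∈ , refl) = inj₁ (suc y , there y∈ , refl)
... | inj₂ (y , y∈ , refl) = inj₂ (y , y∈ , refl)

++⁺ˡ : ∀ {m n} {p : Subset m} (q : Subset n) {x} → x ∈ˢ p → x ↑ˡ n ∈ˢ p ++ⱽ q
++⁺ˡ q here       = here
++⁺ˡ q (there x∈) = there (++⁺ˡ q x∈)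

++⁺ʳ : ∀ {m n} (p : Subset m) {q : Subset n} {x} → x ∈ˢ q → m ↑ʳ x ∈ˢ p ++ⱽ q
++⁺ʳ []      x∈ = x∈
++⁺ʳ (_ ∷ p) x∈ = there (++⁺ʳ p x∈)

-- The sets meeting {1, 2, 3} in one or two points fall into three copies of
-- the k-subsets of a (g + 1)-set, each consisting of sets through one point.
rotate : ∀ {g} → Fin 3 → Subset (suc g) → Subset (3 + g)
rotate j (x ∷ S) = prefix j x ++ⱽ S

module _ {g : ℕ} where

  rotate-injective : ∀ {j j′} (S S′ : Subset (suc g)) → rotate j S ≡ rotate j′ S′ → j ≡ j′ × S ≡ S′
  rotate-injective {j} {j′} (x ∷ S) (x′ ∷ S′) eq =
    let (j≡ , x≡) = prefix-injective {j} {j′} (++-injectiveˡ (prefix j x) (prefix j′ x′) eq)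
    in j≡ , cong₂ _∷_ x≡ (++-injectiveʳ (prefix j x) (prefix j′ x′) eq)

  ∣rotate∣ : ∀ j (S : Subset (suc g)) → ∣ rotate j S ∣ ≡ suc ∣ S ∣
  ∣rotate∣ 0F (inside ∷ S)  = refl
  ∣rotate∣ 0F (outside ∷ S) = refl
  ∣rotate∣ 1F (inside ∷ S)  = refl
  ∣rotate∣ 1F (outside ∷ S) = refl
  ∣rotate∣ 2F (inside ∷ S)  = refl
  ∣rotate∣ 2F (outside ∷ S) = refl

  apex : Fin 3 → Fin (3 + g)
  apex j = j ↑ˡ g

  apex-∈ : ∀ j S → apex j ∈ˢ rotate j S
  apex-∈ 0F (x ∷ S) = here
  apex-∈ 1F (x ∷ S) = there here
  apex-∈ 2F (x ∷ S) = there (there here)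

  ∈-rotate : ∀ j (S : Subset (suc g)) {z} → z ∈ˢ rotate j S →
             z ≡ apex j ⊎ ∃[ y ] y ∈ˢ S × (∀ T → y ∈ˢ T → z ∈ˢ rotate j T)
  ∈-rotate 0F (x ∷ S)       here                       = inj₁ refl
  ∈-rotate 0F (.inside ∷ S) (there here)               = inj₂ (zero , here , λ { (_ ∷ T) here → there here })
  ∈-rotate 0F (x ∷ S)       (there (there (there z∈))) = inj₂ (suc _ , there z∈ , λ { (_ ∷ T) (there y∈) → there (there (there y∈)) })
  ∈-rotate 1F (x ∷ S)       (there here)               = inj₁ refl
  ∈-rotate 1F (.inside ∷ S) (there (there here))       = inj₂ (zero , here , λ { (_ ∷ T) here → there (there here) })
  ∈-rotate 1F (x ∷ S)       (there (there (there z∈))) = inj₂ (suc _ , there z∈ , λ { (_ ∷ T) (there y∈) → there (there (there y∈)) })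
  ∈-rotate 2F (x ∷ S)       (there (there here))       = inj₁ refl
  ∈-rotate 2F (.inside ∷ S) here                       = inj₂ (zero , here , λ { (_ ∷ T) here → here })
  ∈-rotate 2F (x ∷ S)       (there (there (there z∈))) = inj₂ (suc _ , there z∈ , λ { (_ ∷ T) (there y∈) → there (there (there y∈)) })

through-one-point : ∀ {g k b y} → 0 < k → k ≤ suc g → suc b * k ≤ suc g → g + 3 ≤ (2 + b) * k →
                    y * (2 + b) ≤ suc g C k → Dominators (3 + g) (suc k) (suc b) (Fin 3 × Fin y)
through-one-point {g} {k} {b} {y} k>0 k≤g bk≤g wide enough = record
  { member    = λ (j , i) → rotate j ∘ source i
  ; sized     = λ (j , i) l → trans (∣rotate∣ j (source i l)) (cong suc (source-sized i l))
  ; injective = λ { {j , i} {j′ , i′} {l} {l′} eq →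
      let (j≡ , S≡) = rotate-injective {g} {j} {j′} (source i l) (source i′ l′) eq
          (i≡ , l≡) = source-injective i i′ l l′ S≡
      in cong₂ _,_ j≡ i≡ , l≡ }
  ; meets     = λ (j , i) l → apex j , apex-∈ j (source i zero) , apex-∈ j (source i (suc l))
  ; cover     = λ (j , i) → rotate j (⋃ (grouped i))
  ; covered   = λ (j , i) z∈ → covered j i (∈-rotate j (⋃ (grouped i)) z∈)
  ; large     = λ (j , i) → begin
      3 + g + 2
        ≡⟨ cong (2 +_) (trans (+-comm (suc g) 2) (+-comm 3 g)) ⟩
      2 + (g + 3)                             ≤⟨ +-monoʳ-≤ 2 wide ⟩
      2 + (k + suc b * k)                     ≡⟨ cong (2 +_) (+-comm k (suc b * k)) ⟩
      2 + (suc b * k + k)                     ≡⟨ cong suc (+-suc (suc b * k) k) ⟨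
      suc (suc b * k) + suc k
        ≡⟨ cong (λ z → suc z + suc k) (∣⋃∣ (grouped i) (grouped-sized i) (grouped-disjoint i)) ⟨
      suc ∣ ⋃ (grouped i) ∣ + suc k           ≡⟨ cong (_+ suc k) (∣rotate∣ j (⋃ (grouped i))) ⟨
      ∣ rotate j (⋃ (grouped i)) ∣ + suc k    ∎
  }
  where
  open ≤-Reasoning
  -- The sets left after grouping; one of them becomes the centre of each star, whence b + 2 sets
  -- per star in `enough`.
  rest = (suc g C k) ∸ y * suc b
  y≤rest : y ≤ rest
  y≤rest = m+n≤o⇒m≤o∸n y (≤-trans (≤-reflexive (sym (*-suc y (suc b)))) enough)
  open Classes (classes y (suc b) rest k>0 k≤g bk≤g
    (m+[n∸m]≡n (≤-trans (*-monoʳ-≤ y (n≤1+n (suc b))) enough)))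

  source : Fin y → Fin (2 + b) → Subset (suc g)
  source i zero    = ungrouped (inject≤ i y≤rest)
  source i (suc l) = grouped i l

  source-sized : ∀ i l → ∣ source i l ∣ ≡ k
  source-sized i zero    = ungrouped-sized _
  source-sized i (suc l) = grouped-sized i l

  source-injective : ∀ i i′ l l′ → source i l ≡ source i′ l′ → i ≡ i′ × l ≡ l′
  source-injective i i′ zero    zero     eq = Fin.inject≤-injective y≤rest y≤rest i i′ (ungrouped-injective eq) , refl
  source-injective i i′ zero    (suc l′) eq = contradiction (sym eq) grouped≢ungrouped
  source-injective i i′ (suc l) zero     eq = contradiction eq grouped≢ungrouped
  source-injective i i′ (suc l) (suc l′) eq =
    let (i≡ , l≡) = grouped-injective eq in i≡ , cong suc l≡

  covered : ∀ j i {z} → z ≡ apex j ⊎ (∃[ x ] x ∈ˢ ⋃ (grouped i) × (∀ T → x ∈ˢ T → z ∈ˢ rotate j T)) →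
            ∃[ l ] z ∈ˢ rotate j (source i (suc l))
  covered j i (inj₁ refl)           = zero , apex-∈ j (source i (suc zero))
  covered j i (inj₂ (x , x∈ , up)) =
    let (l , x∈l) = ∈-⋃ (grouped i) x∈ in l , up (grouped i l) x∈l

next : Fin 3 → Fin 3
next 0F = 1F
next 1F = 2F
next 2F = 0F

next-injective : ∀ {j j′} → next j ≡ next j′ → j ≡ j′
next-injective {0F} {0F} _ = refl
next-injective {1F} {1F} _ = refl
next-injective {2F} {2F} _ = refl
next-injective {0F} {1F} ()
next-injective {0F} {2F} ()
next-injective {1F} {2F} ()

-- For the case in which stars with one apex fall a single point short. The first leaf contains j
-- and the others `next j`, so that the cover gains both points, and the centre contains both in
-- order to meet all leaves. Centres have two of the three points and leaves one, so they never
-- coincide.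
through-two-points : ∀ {g k b y} → 0 < k → suc k ≤ g → (3 + b) * suc k ≡ g + 2 →
                     y * (2 + b) ≤ g C suc k → y ≤ g C k →
                     Dominators (3 + g) (2 + k) (2 + b) (Fin 3 × Fin y)
through-two-points {g} {k} {b} {y} k>0 k<g exact enough centres = record
  { member    = λ (j , i) → member j i
  ; sized     = λ (j , i) → sized j i
  ; injective = λ { {j , i} {j′ , i′} eq → let (j≡ , i≡ , l≡) = injective j i j′ i′ _ _ eq in cong₂ _,_ j≡ i≡ , l≡ }
  ; meets     = λ (j , i) → meets j i
  ; cover     = λ (j , i) → prefix j inside ++ⱽ ⋃ (grouped i)
  ; covered   = λ (j , i) → covered j i
  ; large     = λ (j , i) → begin
      3 + g + 2                                   ≡⟨ cong (3 +_) (sym exact) ⟩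
      3 + (suc k + (2 + b) * suc k)               ≡⟨ cong (3 +_) (+-comm (suc k) _) ⟩
      3 + ((2 + b) * suc k + suc k)               ≡⟨ cong (2 +_) (+-suc ((2 + b) * suc k) (suc k)) ⟨
      2 + (2 + b) * suc k + (2 + k)
        ≡⟨ cong (λ z → 2 + z + (2 + k)) (∣⋃∣ (grouped i) (grouped-sized i) (grouped-disjoint i)) ⟨
      2 + ∣ ⋃ (grouped i) ∣ + (2 + k)
        ≡⟨ cong (λ z → z + ∣ ⋃ (grouped i) ∣ + (2 + k)) (∣prefix∣ j inside) ⟨
      ∣ prefix j inside ∣ + ∣ ⋃ (grouped i) ∣ + (2 + k)
        ≡⟨ cong (_+ (2 + k)) (∣++∣ (prefix j inside) (⋃ (grouped i))) ⟨
      ∣ prefix j inside ++ⱽ ⋃ (grouped i) ∣ + (2 + k) ∎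
  }
  where
  open ≤-Reasoning
  open Classes (classes {g} {suc k} y (2 + b) ((g C suc k) ∸ y * (2 + b)) (s≤s z≤n) k<g
    (+-cancelˡ-≤ 2 _ _ (≤-trans (+-monoˡ-≤ _ (s≤s k>0)) (≤-reflexive (trans exact (+-comm g 2)))))
    (m+[n∸m]≡n enough))
  centre = enumerate k>0 (<⇒≤ k<g)

  ∣prefix∣ : ∀ j x → ∣ prefix j x ∣ ≡ suc ∣ x ∷ [] ∣
  ∣prefix∣ 0F inside  = refl
  ∣prefix∣ 0F outside = refl
  ∣prefix∣ 1F inside  = refl
  ∣prefix∣ 1F outside = refl
  ∣prefix∣ 2F inside  = refl
  ∣prefix∣ 2F outside = refl

  centre-set : Fin y → Subset g
  centre-set i = proj₁ centre (inject≤ i centres)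

  member : Fin 3 → Fin y → Fin (3 + b) → Subset (3 + g)
  member j i zero          = prefix j inside ++ⱽ centre-set i
  member j i (suc zero)    = prefix j outside ++ⱽ grouped i zero
  member j i (suc (suc l)) = prefix (next j) outside ++ⱽ grouped i (suc l)

  sized : ∀ j i l → ∣ member j i l ∣ ≡ 2 + k
  sized j i zero          = trans (∣++∣ (prefix j inside) (centre-set i))
    (cong₂ _+_ (∣prefix∣ j inside) (proj₂ (proj₂ centre) _))
  sized j i (suc zero)    = trans (∣++∣ (prefix j outside) (grouped i zero))
    (cong₂ _+_ (∣prefix∣ j outside) (grouped-sized i zero))
  sized j i (suc (suc l)) = trans (∣++∣ (prefix (next j) outside) (grouped i (suc l)))
    (cong₂ _+_ (∣prefix∣ (next j) outside) (grouped-sized i (suc l)))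

  split : ∀ j x {S : Subset g} j′ x′ {S′ : Subset g} → prefix j x ++ⱽ S ≡ prefix j′ x′ ++ⱽ S′ →
          (j ≡ j′ × x ≡ x′) × S ≡ S′
  split j x j′ x′ eq = let (p≡ , S≡) = ++-injective (prefix j x) (prefix j′ x′) eq in
    prefix-injective {j} {j′} p≡ , S≡

  injective : ∀ j i j′ i′ l l′ → member j i l ≡ member j′ i′ l′ → j ≡ j′ × i ≡ i′ × l ≡ l′
  injective j i j′ i′ zero zero eq = let ((j≡ , _) , S≡) = split j inside j′ inside eq in
    j≡ , Fin.inject≤-injective centres centres i i′ (proj₁ (proj₂ centre) S≡) , refl
  injective j i j′ i′ zero (suc zero) eq = case proj₂ (proj₁ (split j inside j′ outside eq)) of λ ()
  injective j i j′ i′ zero (suc (suc l′)) eq = case proj₂ (proj₁ (split j inside (next j′) outside eq)) of λ ()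
  injective j i j′ i′ (suc zero) zero eq = case proj₂ (proj₁ (split j outside j′ inside eq)) of λ ()
  injective j i j′ i′ (suc (suc l)) zero eq = case proj₂ (proj₁ (split (next j) outside j′ inside eq)) of λ ()
  injective j i j′ i′ (suc zero) (suc zero) eq = let ((j≡ , _) , S≡) = split j outside j′ outside eq in
    j≡ , proj₁ (grouped-injective S≡) , refl
  -- A first leaf of one copy and a later leaf of the preceding copy have the same prefix; their
  -- different places in the Baranyai classes keep them apart.
  injective j i j′ i′ (suc zero) (suc (suc l′)) eq =
    case proj₂ (grouped-injective (proj₂ (split j outside (next j′) outside eq))) of λ ()
  injective j i j′ i′ (suc (suc l)) (suc zero) eq =
    case proj₂ (grouped-injective (proj₂ (split (next j) outside j′ outside eq))) of λ ()
  injective j i j′ i′ (suc (suc l)) (suc (suc l′)) eq =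
    let ((j≡ , _) , S≡) = split (next j) outside (next j′) outside eq
        (i≡ , l≡) = grouped-injective S≡
    in next-injective j≡ , i≡ , cong suc l≡

  first-∈ : ∀ j x → j ∈ˢ prefix j x
  first-∈ 0F x = here
  first-∈ 1F x = there here
  first-∈ 2F x = there (there here)

  next-∈ : ∀ j → next j ∈ˢ prefix j inside
  next-∈ 0F = there here
  next-∈ 1F = there (there here)
  next-∈ 2F = here

  meets : ∀ j i l → ∃[ x ] x ∈ˢ member j i zero × x ∈ˢ member j i (suc l)
  meets j i zero    = j ↑ˡ g , ++⁺ˡ (centre-set i) (first-∈ j inside) , ++⁺ˡ (grouped i zero) (first-∈ j outside)
  meets j i (suc l) = next j ↑ˡ g , ++⁺ˡ (centre-set i) (next-∈ j) , ++⁺ˡ (grouped i (suc l)) (first-∈ (next j) outside)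

  prefix-∈ : ∀ j {x} → x ∈ˢ prefix j inside → x ≡ j ⊎ x ≡ next j
  prefix-∈ 0F here                 = inj₁ refl
  prefix-∈ 0F (there here)         = inj₂ refl
  prefix-∈ 0F (there (there (there ())))
  prefix-∈ 1F (there here)         = inj₁ refl
  prefix-∈ 1F (there (there here)) = inj₂ refl
  prefix-∈ 2F here                 = inj₂ refl
  prefix-∈ 2F (there (there here)) = inj₁ refl

  covered : ∀ j i {x} → x ∈ˢ prefix j inside ++ⱽ ⋃ (grouped i) → ∃[ l ] x ∈ˢ member j i (suc l)
  covered j i {x} x∈ = [ by-prefix , by-union ]′ (++⁻ (prefix j inside) x∈)
    where
    leaf : ∀ {y} → ∃[ l ] y ∈ˢ grouped i l → ∃[ l ] 3 ↑ʳ y ∈ˢ member j i (suc l)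
    leaf (zero  , y∈) = zero , ++⁺ʳ (prefix j outside) y∈
    leaf (suc l , y∈) = suc l , ++⁺ʳ (prefix (next j) outside) y∈

    at-prefix : ∀ {y} → y ≡ j ⊎ y ≡ next j → ∃[ l ] y ↑ˡ g ∈ˢ member j i (suc l)
    at-prefix (inj₁ refl) = zero , ++⁺ˡ (grouped i zero) (first-∈ j outside)
    at-prefix (inj₂ refl) = suc zero , ++⁺ˡ (grouped i (suc zero)) (first-∈ (next j) outside)

    by-prefix : ∃[ y ] y ∈ˢ prefix j inside × x ≡ y ↑ˡ g → ∃[ l ] x ∈ˢ member j i (suc l)
    by-prefix (y , y∈ , refl) = at-prefix (prefix-∈ j y∈)

    by-union : ∃[ y ] y ∈ˢ ⋃ (grouped i) × x ≡ 3 ↑ʳ y → ∃[ l ] x ∈ˢ member j i (suc l)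
    by-union (y , y∈ , refl) = leaf (∈-⋃ (grouped i) y∈)

-- The centre is {0,1}. The leaves {0,x} with x ≥ 2 cover everything but 1, which is supplied by the
-- leaf {1,2}.
pairs-dominator : ∀ m → Dominators (2 + suc m) 2 (2 + m) (Fin 1)
pairs-dominator m = record
  { member    = λ _ → member
  ; sized     = λ _ → sized
  ; injective = λ { {zero} {zero} {j} {j′} eq → refl , injective j j′ eq }
  ; meets     = λ { _ zero → 1F , there here , there here ; _ (suc i) → 0F , here , here }
  ; cover     = λ _ → full
  ; covered   = λ _ {x} _ → covered x
  ; large     = λ _ → ≤-reflexive (cong (_+ 2) (sym (∣⊤∣≡n (3 + m))))
  }
  where
  member : Fin (3 + m) → Subset (3 + m)
  member 0F            = inside ∷ inside ∷ ∅
  member 1F            = outside ∷ inside ∷ ⁅ zero ⁆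
  member (suc (suc i)) = inside ∷ outside ∷ ⁅ i ⁆

  sized : ∀ j → ∣ member j ∣ ≡ 2
  sized 0F            = cong (2 +_) (∣⊥∣≡0 (suc m))
  sized 1F            = cong suc (∣⁅x⁆∣≡1 {suc m} zero)
  sized (suc (suc i)) = cong suc (∣⁅x⁆∣≡1 i)

  ⁅⁆-injective : ∀ {n} {i j : Fin n} → ⁅ i ⁆ ≡ ⁅ j ⁆ → i ≡ j
  ⁅⁆-injective {i = i} {j} eq = x∈⁅y⁆⇒x≡y j (subst (i ∈ˢ_) eq (x∈⁅x⁆ i))

  injective : ∀ j j′ → member j ≡ member j′ → j ≡ j′
  injective 0F 0F eq = refl
  injective 0F 1F ()
  injective 0F (suc (suc _)) ()
  injective 1F 1F eq = refl
  injective (suc (suc i)) (suc (suc i′)) eq = cong (λ z → suc (suc z)) (⁅⁆-injective (∷-injectiveʳ (∷-injectiveʳ eq)))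

  covered : ∀ x → ∃[ j ] x ∈ˢ member (suc j)
  covered 0F            = 1F , here
  covered 1F            = 0F , there here
  covered (suc (suc i)) = suc i , there (there (x∈⁅x⁆ i))

-- Disjoint pairs with a common neighbour

-- The last of x indices finds at most β bad values and x - 1 values already taken, fewer than z
-- together.
greedy : ∀ {x z} {Bad : Fin x → Fin z → Set} (bad? : ∀ i j → Dec (Bad i j)) β →
         (∀ i → ∑[ j < z ] 𝟙 (bad? i j) ≤ β) → x + β ≤ z →
         Σ (Fin x → Fin z) λ f → Injective _≡_ _≡_ f × (∀ i → ¬ Bad i (f i))
greedy {zero} bad? β few room = (λ ()) , (λ { {()} }) , λ ()
greedy {suc x} {z} {Bad} bad? β few room
  with greedy (bad? ∘ suc) β (few ∘ suc) (≤-trans (n≤1+n _) room)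
... | f , f-injective , good = lengthen (Fin.any? λ j → ¬? (bad? zero j) ×-dec ¬? (Fin.any? λ i → f i Fin.≟ j))
  where
  lengthen : Dec (∃[ j ] ¬ Bad zero j × ¬ (∃[ i ] f i ≡ j)) →
           Σ (Fin (suc x) → Fin z) λ f → Injective _≡_ _≡_ f × (∀ i → ¬ Bad i (f i))
  lengthen (yes (j , ¬bad , unused)) = f′ , f′-injective , λ { zero → ¬bad ; (suc i) → good i }
    where
    f′ : Fin (suc x) → Fin z
    f′ zero    = j
    f′ (suc i) = f i
    f′-injective : Injective _≡_ _≡_ f′
    f′-injective {zero}  {zero}   eq = refl
    f′-injective {zero}  {suc i′} eq = contradiction (i′ , sym eq) unused
    f′-injective {suc i} {zero}   eq = contradiction (i , eq) unused
    f′-injective {suc i} {suc i′} eq = cong suc (f-injective eq)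
  lengthen (no none) = contradiction room (<⇒≱ (s≤s (begin
    z
      ≡⟨ ∑-ones z ⟨
    ∑[ j < z ] 1
      ≤⟨ ∑-mono pointwise ⟩
    ∑[ j < z ] (𝟙 (bad? zero j) + ∑[ i < x ] 𝟙 (f i Fin.≟ j))
      ≡⟨ ∑-distrib-+ (λ j → 𝟙 (bad? zero j)) (λ j → ∑[ i < x ] 𝟙 (f i Fin.≟ j)) ⟩
    ∑[ j < z ] 𝟙 (bad? zero j) + ∑[ j < z ] ∑[ i < x ] 𝟙 (f i Fin.≟ j)
      ≡⟨ cong (∑[ j < z ] 𝟙 (bad? zero j) +_) (∑-comm (λ i j → 𝟙 (f i Fin.≟ j))) ⟨
    ∑[ j < z ] 𝟙 (bad? zero j) + ∑[ i < x ] ∑[ j < z ] 𝟙 (f i Fin.≟ j)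
      ≡⟨ cong (∑[ j < z ] 𝟙 (bad? zero j) +_) (trans (sum-cong-≗ (∑-one ∘ f)) (∑-ones x)) ⟩
    ∑[ j < z ] 𝟙 (bad? zero j) + x
      ≤⟨ +-monoˡ-≤ x (few zero) ⟩
    β + x
      ≡⟨ +-comm β x ⟩
    x + β ∎)))
    where
    open ≤-Reasoning
    pointwise : ∀ j → 1 ≤ 𝟙 (bad? zero j) + ∑[ i < x ] 𝟙 (f i Fin.≟ j)
    pointwise j with bad? zero j
    ... | yes _ = m≤m+n 1 _
    ... | no ¬bad with Fin.any? (λ i → f i Fin.≟ j)
    ...   | no unused   = contradiction (j , ¬bad , unused) none
    ...   | yes (i , eq) = ≤-trans (≤-reflexive (sym (𝟙-yes (f i Fin.≟ j) eq))) (≤-∑ (λ i → 𝟙 (f i Fin.≟ j)) i)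

-- Counting the sets that avoid a given set

tails : ∀ {m} → Bool → List (Subset (suc m)) → List (Subset m)
tails b             []                   = []
tails inside  ((inside  ∷ S) ∷ xs) = S ∷ tails inside xs
tails inside  ((outside ∷ S) ∷ xs) = tails inside xs
tails outside ((inside  ∷ S) ∷ xs) = tails outside xs
tails outside ((outside ∷ S) ∷ xs) = S ∷ tails outside xs

length-tails : ∀ {m} (xs : List (Subset (suc m))) → length (tails inside xs) + length (tails outside xs) ≡ length xs
length-tails []                    = refl
length-tails ((inside  ∷ S) ∷ xs)  = cong suc (length-tails xs)
length-tails ((outside ∷ S) ∷ xs)  = trans (+-suc _ _) (cong suc (length-tails xs))

All-tails : ∀ {m} b {P : Subset (suc m) → Set} {xs} → All P xs → All (P ∘ (b ∷_)) (tails b xs)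
All-tails b       []                                 = []
All-tails inside  {xs = (inside  ∷ S) ∷ xs} (p ∷ ps) = p ∷ All-tails inside ps
All-tails inside  {xs = (outside ∷ S) ∷ xs} (p ∷ ps) = All-tails inside ps
All-tails outside {xs = (inside  ∷ S) ∷ xs} (p ∷ ps) = All-tails outside ps
All-tails outside {xs = (outside ∷ S) ∷ xs} (p ∷ ps) = p ∷ All-tails outside ps

Unique-tails : ∀ {m} b {xs : List (Subset (suc m))} → Unique xs → Unique (tails b xs)
Unique-tails b       []                                 = []
Unique-tails inside  {(inside  ∷ S) ∷ xs} (x∉ ∷ !xs) = All.map (_∘ cong (inside ∷_)) (All-tails inside x∉) ∷ Unique-tails inside !xs
Unique-tails inside  {(outside ∷ S) ∷ xs} (x∉ ∷ !xs) = Unique-tails inside !xs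
Unique-tails outside {(inside  ∷ S) ∷ xs} (x∉ ∷ !xs) = Unique-tails outside !xs
Unique-tails outside {(outside ∷ S) ∷ xs} (x∉ ∷ !xs) = All.map (_∘ cong (outside ∷_)) (All-tails outside x∉) ∷ Unique-tails outside !xs

Avoids : ∀ {m} → Subset m → ℕ → Subset m → Set
Avoids p k S = ∣ S ∣ ≡ k × Disjoint S p

All-false : ∀ {A : Set} {P : A → Set} → (∀ {x} → ¬ P x) → ∀ {xs} → All P xs → length xs ≡ 0
All-false none []       = refl
All-false none (p ∷ ps) = contradiction p none

-- Induction on the ground set: sort the list by its first point. If that point lies in p, no set
-- contains it; otherwise Pascal's rule adds the two bounds.
avoiding-bound : ∀ {m} (p : Subset m) k {xs} → Unique xs → All (Avoids p k) xs → length xs ≤ (m ∸ ∣ p ∣) C k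
avoiding-bound [] k {[]}           _ _ = z≤n
avoiding-bound [] k {[] ∷ []}      _ ((refl , _) ∷ []) = ≤-refl
avoiding-bound [] k {[] ∷ [] ∷ _} ((≢ ∷ _) ∷ _) _ = contradiction refl ≢
avoiding-bound {suc m} (inside ∷ p) k {xs} !xs av = begin
  length xs                                               ≡⟨ length-tails xs ⟨
  length (tails inside xs) + length (tails outside xs)
    ≡⟨ cong (_+ length (tails outside xs)) (All-false (λ (_ , d) → d zero here here) (All-tails inside av)) ⟩
  length (tails outside xs)
    ≤⟨ avoiding-bound p k (Unique-tails outside !xs) (All.map (λ (s , d) → s , disjoint-tail d) (All-tails outside av)) ⟩
  (m ∸ ∣ p ∣) C k                                         ∎
  where open ≤-Reasoning
avoiding-bound {suc m} (outside ∷ p) zero {xs} !xs av = begin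
  length xs                                               ≡⟨ length-tails xs ⟨
  length (tails inside xs) + length (tails outside xs)
    ≡⟨ cong (_+ length (tails outside xs)) (All-false (λ { (() , _) }) (All-tails inside av)) ⟩
  length (tails outside xs)
    ≤⟨ avoiding-bound p zero (Unique-tails outside !xs) (All.map (λ (s , d) → s , disjoint-tail d) (All-tails outside av)) ⟩
  1                                                       ∎
  where open ≤-Reasoning
avoiding-bound {suc m} (outside ∷ p) (suc k) {xs} !xs av = begin
  length xs                                               ≡⟨ length-tails xs ⟨
  length (tails inside xs) + length (tails outside xs)
    ≤⟨ +-mono-≤
         (avoiding-bound p k (Unique-tails inside !xs) (All.map (λ (s , d) → suc-injective s , disjoint-tail d) (All-tails inside av)))
         (avoiding-bound p (suc k) (Unique-tails outside !xs) (All.map (λ (s , d) → s , disjoint-tail d) (All-tails outside av))) ⟩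
  (m ∸ ∣ p ∣) C k + (m ∸ ∣ p ∣) C suc k                   ≡⟨ nCk+nC[k+1]≡[n+1]C[k+1] (m ∸ ∣ p ∣) k ⟩
  suc (m ∸ ∣ p ∣) C suc k
    ≡⟨ cong (_C suc k) (+-∸-assoc 1 (∣p∣≤n p)) ⟨
  (suc m ∸ ∣ p ∣) C suc k                                 ∎
  where
  open ≤-Reasoning

length-filter-tabulate : ∀ {n} {A : Set} {P : A → Set} (P? : ∀ x → Dec (P x)) (f : Fin n → A) →
                         length (filter P? (tabulate f)) ≡ ∑[ i < n ] 𝟙 (P? (f i))
length-filter-tabulate {zero}  P? f = refl
length-filter-tabulate {suc n} P? f with P? (f zero)
... | yes _ = cong suc (length-filter-tabulate P? (f ∘ suc))
... | no _  = length-filter-tabulate P? (f ∘ suc)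

Meets : ∀ {m} → Subset m → Subset m → Set
Meets p q = ∃[ x ] x ∈ˢ p × x ∈ˢ q

meets? : ∀ {m} (p q : Subset m) → Dec (Meets p q)
meets? p q = Fin.any? λ x → (x ∈? p) ×-dec (x ∈? q)

missing-bound : ∀ {m k z} (p : Subset m) (e : Fin z → Subset m) → Injective _≡_ _≡_ e →
                (∀ i → ∣ e i ∣ ≡ k) → ∑[ i < z ] 𝟙 (¬? (meets? (e i) p)) ≤ (m ∸ ∣ p ∣) C k
missing-bound {m} {k} {z} p e e-injective sized = begin
  ∑[ i < z ] 𝟙 (missing? (e i))                   ≡⟨ length-filter-tabulate missing? e ⟨
  length (filter missing? (tabulate e))           ≤⟨ avoiding-bound p k
      (Unique.filter⁺ missing? (Unique.tabulate⁺ e-injective))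
      (All.zipWith (λ (s , ¬meets) → s , λ x x∈ x∈p → ¬meets (x , x∈ , x∈p))
        (All.filter⁺ missing? (All.tabulate⁺ {f = e} sized) , All.all-filter missing? (tabulate e))) ⟩
  (m ∸ ∣ p ∣) C k ∎
  where
  open ≤-Reasoning
  missing? : ∀ S → Dec (¬ Meets S p)
  missing? S = ¬? (meets? S p)

-- Two disjoint leaves cover 2 k points, which suffices as m + 2 ≤ 3 k. A leaf is missed by at most
-- D = C(m-k,k) sets, so each pair excludes at most 2 D centres, and the C(m,k) - 2 x ungrouped sets
-- leave room for a greedy choice of x different centres.
triples : ∀ {m k x} → 0 < k → 2 * k ≤ m → m + 2 ≤ 3 * k → 3 * x + 2 * ((m ∸ k) C k) ≤ m C k →
          Dominators m k 2 (Fin x)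
triples {m} {k} {x} k>0 2k≤m m+2≤3k enough = record
  { member    = member
  ; sized     = sized
  ; injective = λ {i} {i′} {j} {j′} → injective i i′ j j′
  ; meets     = meets
  ; cover     = λ i → ⋃ (grouped i)
  ; covered   = λ i x∈ → covered i (∈-⋃ (grouped i) x∈)
  ; large     = λ i → begin
      m + 2                     ≤⟨ m+2≤3k ⟩
      k + 2 * k                 ≡⟨ +-comm k (2 * k) ⟩
      2 * k + k
        ≡⟨ cong (_+ k) (∣⋃∣ (grouped i) (grouped-sized i) (grouped-disjoint i)) ⟨
      ∣ ⋃ (grouped i) ∣ + k     ∎
  }
  where
  open ≤-Reasoning
  D = (m ∸ k) C k
  z = (m C k) ∸ x * 2

  enough′ : (x + (D + D)) + x * 2 ≤ m C k
  enough′ = begin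
    (x + (D + D)) + x * 2    ≡⟨ +-assoc x (D + D) (x * 2) ⟩
    x + (D + D + x * 2)      ≡⟨ cong (x +_) (+-comm (D + D) (x * 2)) ⟩
    x + (x * 2 + (D + D))
      ≡⟨ cong₂ (λ a b → x + (a + (D + b))) (*-comm x 2) (sym (+-identityʳ D)) ⟩
    x + (2 * x + 2 * D)      ≡⟨ +-assoc x (2 * x) (2 * D) ⟨
    3 * x + 2 * D            ≤⟨ enough ⟩
    m C k                    ∎

  open Classes (classes {m} {k} x 2 z k>0 (≤-trans (m≤m+n k (k + 0)) 2k≤m) 2k≤m
    (m+[n∸m]≡n (m+n≤o⇒n≤o (x + (D + D)) enough′)))

  Bad : Fin x → Fin z → Set
  Bad i j = ¬ Meets (ungrouped j) (grouped i 0F) ⊎ ¬ Meets (ungrouped j) (grouped i 1F)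

  bad? : ∀ i j → Dec (Bad i j)
  bad? i j = ¬? (meets? (ungrouped j) (grouped i 0F)) ⊎-dec ¬? (meets? (ungrouped j) (grouped i 1F))

  few : ∀ i → ∑[ j < z ] 𝟙 (bad? i j) ≤ D + D
  few i = begin
    ∑[ j < z ] 𝟙 (bad? i j)
      ≤⟨ ∑-mono (λ j → 𝟙-⊎ (¬? (meets? (ungrouped j) (grouped i 0F))) (¬? (meets? (ungrouped j) (grouped i 1F)))) ⟩
    ∑[ j < z ] (𝟙 (¬? (meets? (ungrouped j) (grouped i 0F))) + 𝟙 (¬? (meets? (ungrouped j) (grouped i 1F))))
      ≡⟨ ∑-distrib-+ (λ j → 𝟙 (¬? (meets? (ungrouped j) (grouped i 0F)))) (λ j → 𝟙 (¬? (meets? (ungrouped j) (grouped i 1F)))) ⟩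
    ∑[ j < z ] 𝟙 (¬? (meets? (ungrouped j) (grouped i 0F))) + ∑[ j < z ] 𝟙 (¬? (meets? (ungrouped j) (grouped i 1F)))
      ≤⟨ +-mono-≤ (bound 0F) (bound 1F) ⟩
    D + D ∎
    where
    𝟙-⊎ : ∀ {P Q : Set} (P? : Dec P) (Q? : Dec Q) → 𝟙 (P? ⊎-dec Q?) ≤ 𝟙 P? + 𝟙 Q?
    𝟙-⊎ (yes _) _       = m≤m+n 1 _
    𝟙-⊎ (no _)  (yes _) = ≤-refl
    𝟙-⊎ (no _)  (no _)  = ≤-refl
    bound : ∀ l → ∑[ j < z ] 𝟙 (¬? (meets? (ungrouped j) (grouped i l))) ≤ D
    bound l = subst (λ w → ∑[ j < z ] 𝟙 (¬? (meets? (ungrouped j) (grouped i l))) ≤ (m ∸ w) C k) (grouped-sized i l)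
      (missing-bound (grouped i l) ungrouped ungrouped-injective ungrouped-sized)

  selection = greedy bad? (D + D) few (m+n≤o⇒m≤o∸n (x + (D + D)) enough′)

  centre : Fin x → Fin z
  centre = proj₁ selection

  member : Fin x → Fin 3 → Subset m
  member i zero    = ungrouped (centre i)
  member i (suc l) = grouped i l

  sized : ∀ i l → ∣ member i l ∣ ≡ k
  sized i zero    = ungrouped-sized _
  sized i (suc l) = grouped-sized i l

  injective : ∀ i i′ l l′ → member i l ≡ member i′ l′ → i ≡ i′ × l ≡ l′
  injective i i′ zero    zero     eq = proj₁ (proj₂ selection) (ungrouped-injective eq) , refl
  injective i i′ zero    (suc l′) eq = contradiction (sym eq) grouped≢ungrouped
  injective i i′ (suc l) zero     eq = contradiction eq grouped≢ungrouped
  injective i i′ (suc l) (suc l′) eq = let (i≡ , l≡) = grouped-injective eq in i≡ , cong suc l≡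

  meets : ∀ i l → Meets (member i zero) (member i (suc l))
  meets i 0F = decidable-stable (meets? _ _) (proj₂ (proj₂ selection) i ∘ inj₁)
  meets i 1F = decidable-stable (meets? _ _) (proj₂ (proj₂ selection) i ∘ inj₂)

  covered : ∀ i {x} → ∃[ l ] x ∈ˢ grouped i l → ∃[ l ] x ∈ˢ member i (suc l)
  covered i found = found

-- Coefficientwise comparison of polynomials

infixl 6 _⊕_
infixl 7 _⊗_
data Expr (n : ℕ) : Set where
  con     : ℕ → Expr n
  var     : Fin n → Expr n
  _⊕_ _⊗_ : Expr n → Expr n → Expr n

⟦_⟧ : ∀ {n} → Expr n → Vec ℕ n → ℕ
⟦ con c ⟧ ρ = c
⟦ var i ⟧ ρ = Vec.lookup ρ i
⟦ e ⊕ f ⟧ ρ = ⟦ e ⟧ ρ + ⟦ f ⟧ ρ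
⟦ e ⊗ f ⟧ ρ = ⟦ e ⟧ ρ * ⟦ f ⟧ ρ

-- Polynomials in n variables, as lists of coefficients of powers of the first.
Poly : ℕ → Set
Poly zero    = ℕ
Poly (suc n) = List (Poly n)

eval : ∀ {n} → Poly n → Vec ℕ n → ℕ
eval {zero}  c        _       = c
eval {suc n} []       _       = 0
eval {suc n} (p ∷ ps) (x ∷ ρ) = eval p ρ + x * eval ps (x ∷ ρ)

constant : ∀ {n} → ℕ → Poly n
constant {zero}  c = c
constant {suc n} c = constant c ∷ []

indeterminate : ∀ {n} → Fin n → Poly n
indeterminate zero    = constant 0 ∷ constant 1 ∷ []
indeterminate (suc i) = indeterminate i ∷ []

add : ∀ {n} → Poly n → Poly n → Poly n
add {zero}  c        d        = c + d
add {suc n} []       q        = q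
add {suc n} (p ∷ ps) []       = p ∷ ps
add {suc n} (p ∷ ps) (q ∷ qs) = add p q ∷ add ps qs

mul : ∀ {n} → Poly n → Poly n → Poly n
mul {zero}  c        d = c * d
mul {suc n} []       q = []
mul {suc n} (p ∷ ps) q = add (map (mul p) q) (constant 0 ∷ mul ps q)

normalise : ∀ {n} → Expr n → Poly n
normalise (con c) = constant c
normalise (var i) = indeterminate i
normalise (e ⊕ f) = add (normalise e) (normalise f)
normalise (e ⊗ f) = mul (normalise e) (normalise f)

_≤ᶜ_ : ∀ {n} → Poly n → Poly n → Bool
_≤ᶜ_ {zero}  c        d        = c ≤ᵇ d
_≤ᶜ_ {suc n} []       q        = true
_≤ᶜ_ {suc n} (p ∷ ps) []       = (p ≤ᶜ constant 0) ∧ (ps ≤ᶜ [])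
_≤ᶜ_ {suc n} (p ∷ ps) (q ∷ qs) = (p ≤ᶜ q) ∧ (ps ≤ᶜ qs)

eval-constant : ∀ {n} c (ρ : Vec ℕ n) → eval (constant c) ρ ≡ c
eval-constant c []      = refl
eval-constant c (x ∷ ρ) = trans (cong₂ _+_ (eval-constant c ρ) (*-zeroʳ x)) (+-identityʳ c)

eval-variable : ∀ {n} i (ρ : Vec ℕ n) → eval (indeterminate i) ρ ≡ Vec.lookup ρ i
eval-variable zero (x ∷ ρ) = begin
  eval (constant 0) ρ + x * (eval (constant 1) ρ + x * 0)
    ≡⟨ cong₂ (λ a b → a + x * (b + x * 0)) (eval-constant 0 ρ) (eval-constant 1 ρ) ⟩
  x * (1 + x * 0)
    ≡⟨ cong (λ z → x * suc z) (*-zeroʳ x) ⟩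
  x * 1
    ≡⟨ *-identityʳ x ⟩
  x ∎
  where open ≡-Reasoning
eval-variable (suc i) (x ∷ ρ) =
  trans (cong₂ _+_ (eval-variable i ρ) (*-zeroʳ x)) (+-identityʳ _)

eval-add : ∀ {n} (p q : Poly n) ρ → eval (add p q) ρ ≡ eval p ρ + eval q ρ
eval-add {zero}  p        q        ρ       = refl
eval-add {suc n} []       q        ρ       = refl
eval-add {suc n} (p ∷ ps) []       ρ       = sym (+-identityʳ _)
eval-add {suc n} (p ∷ ps) (q ∷ qs) (x ∷ ρ) = trans
  (cong₂ (λ a b → a + x * b) (eval-add p q ρ) (eval-add ps qs (x ∷ ρ)))
  (rearrange (eval p ρ) (eval q ρ) x (eval ps (x ∷ ρ)) (eval qs (x ∷ ρ)))
  where
  rearrange : ∀ a b x c d → a + b + x * (c + d) ≡ a + x * c + (b + x * d)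
  rearrange = solve-∀

eval-mul : ∀ {n} (p q : Poly n) ρ → eval (mul p q) ρ ≡ eval p ρ * eval q ρ
eval-mul {zero}  p        q ρ       = refl
eval-mul {suc n} []       q ρ       = refl
eval-mul {suc n} (p ∷ ps) q (x ∷ ρ) = begin
  eval (add (map (mul p) q) (constant 0 ∷ mul ps q)) (x ∷ ρ)
    ≡⟨ eval-add (map (mul p) q) (constant 0 ∷ mul ps q) (x ∷ ρ) ⟩
  eval (map (mul p) q) (x ∷ ρ) + (eval (constant 0) ρ + x * eval (mul ps q) (x ∷ ρ))
    ≡⟨ cong₂ _+_ (scale q) (cong₂ (λ a b → a + x * b) (eval-constant 0 ρ) (eval-mul ps q (x ∷ ρ))) ⟩
  eval p ρ * eval q (x ∷ ρ) + x * (eval ps (x ∷ ρ) * eval q (x ∷ ρ))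
    ≡⟨ rearrange (eval p ρ) (eval q (x ∷ ρ)) x (eval ps (x ∷ ρ)) ⟩
  (eval p ρ + x * eval ps (x ∷ ρ)) * eval q (x ∷ ρ) ∎
  where
  open ≡-Reasoning
  rearrange : ∀ a b x c → a * b + x * (c * b) ≡ (a + x * c) * b
  rearrange = solve-∀
  distribute′ : ∀ a b x c → a * b + x * (a * c) ≡ a * (b + x * c)
  distribute′ = solve-∀
  scale : ∀ q → eval (map (mul p) q) (x ∷ ρ) ≡ eval p ρ * eval q (x ∷ ρ)
  scale []       = sym (*-zeroʳ (eval p ρ))
  scale (q ∷ qs) = trans (cong₂ (λ a b → a + x * b) (eval-mul p q ρ) (scale qs))
                         (distribute′ (eval p ρ) (eval q ρ) x (eval qs (x ∷ ρ)))

normalise-correct : ∀ {n} (e : Expr n) ρ → eval (normalise e) ρ ≡ ⟦ e ⟧ ρ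
normalise-correct (con c) ρ = eval-constant c ρ
normalise-correct (var i) ρ = eval-variable i ρ
normalise-correct (e ⊕ f) ρ = trans (eval-add (normalise e) (normalise f) ρ)
  (cong₂ _+_ (normalise-correct e ρ) (normalise-correct f ρ))
normalise-correct (e ⊗ f) ρ = trans (eval-mul (normalise e) (normalise f) ρ)
  (cong₂ _*_ (normalise-correct e ρ) (normalise-correct f ρ))

≤ᶜ-sound : ∀ {n} (p q : Poly n) → IsTrue (p ≤ᶜ q) → ∀ ρ → eval p ρ ≤ eval q ρ
≤ᶜ-sound {zero}  p        q        le ρ       = ≤ᵇ⇒≤ p q le
≤ᶜ-sound {suc n} []       q        le ρ       = z≤n
≤ᶜ-sound {suc n} (p ∷ ps) []       le (x ∷ ρ) = let (le₁ , le₂) = Equivalence.to T-∧ le in begin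
  eval p ρ + x * eval ps (x ∷ ρ)
    ≤⟨ +-mono-≤ (≤ᶜ-sound p (constant 0) le₁ ρ) (*-monoʳ-≤ x (≤ᶜ-sound ps [] le₂ (x ∷ ρ))) ⟩
  eval (constant 0) ρ + x * 0        ≡⟨ cong₂ _+_ (eval-constant 0 ρ) (*-zeroʳ x) ⟩
  0                                  ∎
  where open ≤-Reasoning
≤ᶜ-sound {suc n} (p ∷ ps) (q ∷ qs) le (x ∷ ρ) = let (le₁ , le₂) = Equivalence.to T-∧ le in
  +-mono-≤ (≤ᶜ-sound p q le₁ ρ) (*-monoʳ-≤ x (≤ᶜ-sound ps qs le₂ (x ∷ ρ)))

-- Natural arguments preserve domination of coefficients, so an inequality is proved by computing
-- both normal forms. The test is only sufficient; it succeeds when the variables are shifted so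
-- that the whole nonnegative range is wanted.
coefficientwise : ∀ {n} (e f : Expr n) → IsTrue (normalise e ≤ᶜ normalise f) → ∀ ρ → ⟦ e ⟧ ρ ≤ ⟦ f ⟧ ρ
coefficientwise e f le ρ = subst₂ _≤_ (normalise-correct e ρ) (normalise-correct f ρ)
  (≤ᶜ-sound (normalise e) (normalise f) le ρ)

-- Here m + 1 = qk + r and c = m - k′.  The inequality lhsᵢ ≤ rhsᵢ is the third
-- hypothesis of `ratio` for stars through i of the three points; p, s and u are
-- chosen so that no subtraction occurs.
module Parameters {n : ℕ} (p s u : Expr n) where
  q r k k′ e m c : Expr n
  q  = con 3 ⊕ p
  r  = con 1 ⊕ s
  k′ = con 1 ⊕ (s ⊕ u)
  k  = con 1 ⊕ k′
  e  = (s ⊕ u) ⊕ ((con 1 ⊕ p) ⊗ k ⊕ s)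
  m  = con 3 ⊕ (k′ ⊕ e)
  c  = con 3 ⊕ e

  lhs₁ rhs₁ lhs₂ rhs₂ : Expr n
  lhs₁ = r ⊗ (m ⊗ (con 2 ⊕ (k′ ⊕ e))) ⊗ ((con 1 ⊕ (k′ ⊕ e)) ⊕ k′) ⊕ con 2 ⊗ (con 3 ⊗ q ⊗ k) ⊗ (con 1 ⊕ (k′ ⊕ e))
  rhs₁ = con 3 ⊗ q ⊗ k ⊗ k′ ⊗ (c ⊗ (con 2 ⊕ e))
  lhs₂ = r ⊗ (m ⊗ (con 2 ⊕ (k′ ⊕ e)) ⊗ (con 1 ⊕ (k′ ⊕ e))) ⊗ (con 2 ⊕ e) ⊕ con 2 ⊗ c ⊗ (con 3 ⊗ q ⊗ k) ⊗ (con 2 ⊕ e)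
  rhs₂ = con 3 ⊗ q ⊗ k ⊗ k′ ⊗ (c ⊗ (con 2 ⊕ e) ⊗ (con 1 ⊕ e))

module _ (p s u : ℕ) where

  open Parameters {3} (var 0F) (var 1F) (var 2F)
  open Parameters {3} (var 0F) (con 1 ⊕ var 1F) (var 2F) using () renaming (lhs₂ to lhs₂ˢ; rhs₂ to rhs₂ˢ)
  open Parameters {3} (var 0F) (con 0) (con 1 ⊕ var 2F) using () renaming (lhs₂ to lhs₂ᵘ; rhs₂ to rhs₂ᵘ)

  estimate₁ : ⟦ lhs₁ ⟧ (p ∷ s ∷ u ∷ []) ≤ ⟦ rhs₁ ⟧ (p ∷ s ∷ u ∷ [])
  estimate₁ = coefficientwise lhs₁ rhs₁ _ (p ∷ s ∷ u ∷ [])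

  -- At p = s = u = 0 the two sides are 1200 and 1080, so the inequality fails there and k = 2 has
  -- to be excluded. Hence the split into s > 0 and s = 0 < u, each with its own shifted variable.
  estimate₂ˢ : ⟦ lhs₂ ⟧ (p ∷ suc s ∷ u ∷ []) ≤ ⟦ rhs₂ ⟧ (p ∷ suc s ∷ u ∷ [])
  estimate₂ˢ = coefficientwise lhs₂ˢ rhs₂ˢ _ (p ∷ s ∷ u ∷ [])

  estimate₂ᵘ : ⟦ lhs₂ ⟧ (p ∷ 0 ∷ suc u ∷ []) ≤ ⟦ rhs₂ ⟧ (p ∷ 0 ∷ suc u ∷ [])
  estimate₂ᵘ = coefficientwise lhs₂ᵘ rhs₂ᵘ _ (p ∷ s ∷ u ∷ [])

-- Estimates for binomial coefficients

C-row : ∀ n j → (n C suc j) * suc j + (n C j) * j ≡ n * (n C j)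
C-row n j = +-cancelˡ-≡ (n C j) _ _ (begin
  n C j + ((n C suc j) * suc j + (n C j) * j)   ≡⟨ rearrange (n C j) (n C suc j) j ⟩
  (n C j + n C suc j) * suc j                   ≡⟨ cong (_* suc j) (nCk+nC[k+1]≡[n+1]C[k+1] n j) ⟩
  (suc n C suc j) * suc j                       ≡⟨ C-absorb n j ⟩
  suc n * (n C j)                               ∎)
  where
  open ≡-Reasoning
  rearrange : ∀ x y j → x + (y * suc j + x * j) ≡ (x + y) * suc j
  rearrange = solve-∀

C-top : ∀ {n k} j → k + j ≡ n → suc j * (suc n C k) ≡ suc n * (n C k)
C-top {k = zero}  j refl = refl
C-top {n} {suc k} j refl = +-cancelʳ-≡ ((suc n C suc k) * suc k) _ _ (begin
  suc j * X + X * suc k                      ≡⟨ rearrange j X k ⟩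
  suc (suc k + j) * X                        ≡⟨ cong (suc n *_) (nCk+nC[k+1]≡[n+1]C[k+1] n k) ⟨
  suc n * (n C k + n C suc k)                ≡⟨ *-distribˡ-+ (suc n) (n C k) (n C suc k) ⟩
  suc n * (n C k) + suc n * (n C suc k)      ≡⟨ +-comm (suc n * (n C k)) _ ⟩
  suc n * (n C suc k) + suc n * (n C k)      ≡⟨ cong (suc n * (n C suc k) +_) (C-absorb n k) ⟨
  suc n * (n C suc k) + X * suc k            ∎)
  where
  open ≡-Reasoning
  X = suc n C suc k
  rearrange : ∀ j x k → suc j * x + x * suc k ≡ suc (suc k + j) * x
  rearrange = solve-∀

C-mono : ∀ {n n′} k → n ≤ n′ → n C k ≤ n′ C k
C-mono zero    _   = ≤-refl
C-mono {n} (suc k) n≤n′ = go (≤⇒≤′ n≤n′)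
  where
  go : ∀ {n′} → n ≤′ n′ → n C suc k ≤ n′ C suc k
  go ≤′-refl          = ≤-refl
  go (≤′-step {n′} le) = ≤-trans (go le) (≤-trans (m≤n+m (n′ C suc k) (n′ C k))
                          (≤-reflexive (nCk+nC[k+1]≡[n+1]C[k+1] n′ k)))

-- The case k = 0 is an equality, and moving down a diagonal of Pascal's triangle only increases the
-- entry. The bound serves to absorb rounding losses in `ratio`.
C-lower : ∀ k e → (2 + e) * (1 + e) ≤ 2 * ((2 + k + e) C (2 + k))
C-lower zero e = ≤-reflexive (begin
  (2 + e) * (1 + e)          ≡⟨ cong ((2 + e) *_) (nC1≡n (1 + e)) ⟨
  (2 + e) * ((1 + e) C 1)    ≡⟨ C-absorb (1 + e) 1 ⟨
  ((2 + e) C 2) * 2          ≡⟨ *-comm ((2 + e) C 2) 2 ⟩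
  2 * ((2 + e) C 2)          ∎)
  where open ≡-Reasoning
C-lower (suc k) e = ≤-trans (C-lower k e) (*-monoʳ-≤ 2 (≤-trans (m≤m+n _ ((2 + k + e) C (3 + k)))
  (≤-reflexive (nCk+nC[k+1]≡[n+1]C[k+1] (2 + k + e) (2 + k)))))

C-power : ∀ j {n} → 2 * j ≤ n → 2 ^ j ≤ n C j
C-power zero    {n}     2j≤n = ≤-refl
C-power (suc j) {suc n} 2j≤n = *-cancelʳ-≤ _ _ (suc j) (begin
  2 ^ suc j * suc j           ≡⟨ rearrange (2 ^ j) (suc j) ⟩
  2 * suc j * 2 ^ j
    ≤⟨ *-mono-≤ 2j≤n (C-power j (≤-trans (+-monoʳ-≤ j (n≤1+n (j + 0))) (≤-pred 2j≤n))) ⟩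
  suc n * (n C j)             ≡⟨ C-absorb n j ⟨
  (suc n C suc j) * suc j     ∎)
  where
  open ≤-Reasoning
  rearrange : ∀ a b → 2 * a * b ≡ 2 * b * a
  rearrange = solve-∀

module _ {r B a a′ k cc mm G Q y w v t : ℕ} .{{_ : NonZero a′}} .{{_ : NonZero k}} .{{_ : NonZero cc}} where

  -- The shape of both counting estimates: B cc = mm G and G ≤ y a′ + a, where
  -- G sets are packed into y bags.
  ratio : B * cc ≡ mm * G → a′ * k ≤ w → r * mm * w + t * Q * v ≤ Q * k * cc → cc ≤ t * G →
          G ≤ y * a′ + a → a * k ≤ v → r * B ≤ Q * y
  ratio scaled a′k≤w estimate cc≤tG G≤ ak≤v = *-cancelʳ-≤ _ _ (a′ * k * cc) {{nz}}
    (+-cancelʳ-≤ (Q * cc * v) _ _ (begin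
      r * B * (a′ * k * cc) + Q * cc * v            ≡⟨ cong (_+ Q * cc * v) (e₁ r B (a′ * k) cc) ⟩
      r * (B * cc) * (a′ * k) + Q * cc * v
        ≡⟨ cong (λ z → r * z * (a′ * k) + Q * cc * v) scaled ⟩
      r * (mm * G) * (a′ * k) + Q * cc * v
        ≤⟨ +-mono-≤ (*-monoʳ-≤ (r * (mm * G)) a′k≤w) (*-monoˡ-≤ v (*-monoʳ-≤ Q cc≤tG)) ⟩
      r * (mm * G) * w + Q * (t * G) * v            ≡⟨ e₂ r mm G w Q t v ⟩
      -- `estimate` is multiplied by G, and G is bounded by y a′ + a on the right only. The
      -- contribution of the remainder a is at most the term added to both sides, and cancels.
      (r * mm * w + t * Q * v) * G                  ≤⟨ *-mono-≤ estimate G≤ ⟩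
      Q * k * cc * (y * a′ + a)                     ≡⟨ e₃ Q k cc y a′ a ⟩
      Q * y * (a′ * k * cc) + Q * cc * (a * k)
        ≤⟨ +-monoʳ-≤ (Q * y * (a′ * k * cc)) (*-monoʳ-≤ (Q * cc) ak≤v) ⟩
      Q * y * (a′ * k * cc) + Q * cc * v            ∎))
    where
    open ≤-Reasoning
    nz : NonZero (a′ * k * cc)
    nz = m*n≢0 (a′ * k) cc {{m*n≢0 a′ k}}
    e₁ : ∀ r B x cc → r * B * (x * cc) ≡ r * (B * cc) * x
    e₁ = solve-∀
    e₂ : ∀ r mm G w Q t v → r * (mm * G) * w + Q * (t * G) * v ≡ (r * mm * w + t * Q * v) * G
    e₂ = solve-∀
    e₃ : ∀ Q k cc y a′ a → Q * k * cc * (y * a′ + a) ≡ Q * y * (a′ * k * cc) + Q * cc * (a * k)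
    e₃ = solve-∀

module _ (k e : ℕ) where

  two-steps : ((3 + (k + e)) C k) * ((3 + e) * (2 + e)) ≡ (3 + (k + e)) * (2 + (k + e)) * ((1 + (k + e)) C k)
  two-steps = begin
    X₃ * ((3 + e) * (2 + e))                 ≡⟨ e₁ X₃ (3 + e) (2 + e) ⟩
    (3 + e) * X₃ * (2 + e)
      ≡⟨ cong (_* (2 + e)) (C-top (2 + e) (trans (+-suc k (suc e)) (cong suc (+-suc k e)))) ⟩
    (3 + (k + e)) * X₂ * (2 + e)             ≡⟨ e₂ (3 + (k + e)) X₂ (2 + e) ⟩
    (3 + (k + e)) * ((2 + e) * X₂)
      ≡⟨ cong ((3 + (k + e)) *_) (C-top (1 + e) (+-suc k e)) ⟩
    (3 + (k + e)) * ((2 + (k + e)) * X₁)     ≡⟨ *-assoc (3 + (k + e)) (2 + (k + e)) X₁ ⟨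
    (3 + (k + e)) * (2 + (k + e)) * X₁       ∎
    where
    open ≡-Reasoning
    X₁ = (1 + (k + e)) C k
    X₂ = (2 + (k + e)) C k
    X₃ = (3 + (k + e)) C k
    e₁ : ∀ x a b → x * (a * b) ≡ a * x * b
    e₁ = solve-∀
    e₂ : ∀ x a b → x * a * b ≡ x * (b * a)
    e₂ = solve-∀

  three-steps : ((3 + (k + e)) C k) * ((3 + e) * (2 + e) * (1 + e)) ≡
                (3 + (k + e)) * (2 + (k + e)) * (1 + (k + e)) * ((k + e) C k)
  three-steps = begin
    ((3 + (k + e)) C k) * ((3 + e) * (2 + e) * (1 + e))
      ≡⟨ *-assoc ((3 + (k + e)) C k) ((3 + e) * (2 + e)) (1 + e) ⟨
    ((3 + (k + e)) C k) * ((3 + e) * (2 + e)) * (1 + e)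
      ≡⟨ cong (_* (1 + e)) two-steps ⟩
    (3 + (k + e)) * (2 + (k + e)) * ((1 + (k + e)) C k) * (1 + e)
      ≡⟨ e₁ ((3 + (k + e)) * (2 + (k + e))) ((1 + (k + e)) C k) (1 + e) ⟩
    (3 + (k + e)) * (2 + (k + e)) * ((1 + e) * ((1 + (k + e)) C k))
      ≡⟨ cong ((3 + (k + e)) * (2 + (k + e)) *_) (C-top {k = k} e refl) ⟩
    (3 + (k + e)) * (2 + (k + e)) * ((1 + (k + e)) * ((k + e) C k))
      ≡⟨ *-assoc ((3 + (k + e)) * (2 + (k + e))) (1 + (k + e)) ((k + e) C k) ⟨
    (3 + (k + e)) * (2 + (k + e)) * (1 + (k + e)) * ((k + e) C k)       ∎
    where
    open ≡-Reasoning
    e₁ : ∀ x a b → x * a * b ≡ x * (b * a)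
    e₁ = solve-∀

module QuotientEstimates (p s u : ℕ) (s+u>0 : 0 < s + u) where
  open Parameters {3} (var 0F) (var 1F) (var 2F) using (lhs₂; rhs₂)

  estimate₂ : ⟦ lhs₂ ⟧ (p ∷ s ∷ u ∷ []) ≤ ⟦ rhs₂ ⟧ (p ∷ s ∷ u ∷ [])
  estimate₂ = go s u s+u>0
    where
    go : ∀ s u → 0 < s + u → ⟦ lhs₂ ⟧ (p ∷ s ∷ u ∷ []) ≤ ⟦ rhs₂ ⟧ (p ∷ s ∷ u ∷ [])
    go (suc s) u       _ = estimate₂ˢ p s u
    go zero    (suc u) _ = estimate₂ᵘ p zero u

  private
    q  = 3 + p
    r  = 1 + s
    k′ = 1 + (s + u)
    k  = 1 + k′
    e  = (s + u) + ((1 + p) * k + s)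
    B  = (3 + (k′ + e)) C k′

    lower : ∀ e → (2 + e) * (1 + e) ≤ 2 * ((k′ + e) C k′)
    lower e = subst (λ j → (2 + e) * (1 + e) ≤ 2 * ((j + e) C j)) (cong suc (suc-pred (s + u) {{>-nonZero s+u>0}}))
      (C-lower (pred (s + u)) e)

  -- The conclusion is the colouring condition n B ≤ (B + 3 y) q k after substituting n = q k + r.
  -- Here a star uses a leaves and a centre from the same pool, hence the divisor a + 1; in `bound₂`
  -- the centres come from another pool and the divisor is a.
  bound₁ : ∀ a {y} → a * k′ ≤ 1 + (k′ + e) → (1 + (k′ + e)) C k′ ≤ y * suc a + a → r * B ≤ 3 * q * k * y
  bound₁ a {y} ak≤ G≤ = ratio {r} {B} {a} {suc a} {k′} {(3 + e) * (2 + e)} {(3 + (k′ + e)) * (2 + (k′ + e))}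
    {(1 + (k′ + e)) C k′} {3 * q * k} {y} {(1 + (k′ + e)) + k′} {1 + (k′ + e)} {2}
    (two-steps k′ e)
    (≤-trans (≤-reflexive (+-comm k′ (a * k′))) (+-monoˡ-≤ k′ ak≤))
    (estimate₁ p s u)
    (subst (λ n → (3 + e) * (2 + e) ≤ 2 * (n C k′)) (+-suc k′ e) (lower (suc e)))
    G≤ ak≤

  bound₂ : ∀ a .{{_ : NonZero a}} {y} → a * k′ ≡ 2 + e → (k′ + e) C k′ ≤ y * a + a → r * B ≤ 3 * q * k * y
  bound₂ a {y} ak≡ G≤ = ratio {r} {B} {a} {a} {k′} {(3 + e) * (2 + e) * (1 + e)}
    {(3 + (k′ + e)) * (2 + (k′ + e)) * (1 + (k′ + e))}
    {(k′ + e) C k′} {3 * q * k} {y} {2 + e} {2 + e} {2 * (3 + e)}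
    (three-steps k′ e)
    (≤-reflexive ak≡)
    estimate₂
    (begin
      (3 + e) * (2 + e) * (1 + e)            ≡⟨ *-assoc (3 + e) (2 + e) (1 + e) ⟩
      (3 + e) * ((2 + e) * (1 + e))          ≤⟨ *-monoʳ-≤ (3 + e) (lower e) ⟩
      (3 + e) * (2 * ((k′ + e) C k′))        ≡⟨ e₁ (3 + e) ((k′ + e) C k′) ⟩
      2 * (3 + e) * ((k′ + e) C k′)          ∎)
    G≤ (≤-reflexive ak≡)
    where
    open ≤-Reasoning
    e₁ : ∀ a b → a * (2 * b) ≡ 2 * a * b
    e₁ = solve-∀

  -- Multiply the packing bound by k′: then y (2 + e) ≤ C(g,k′) k′ = (1 + e) C(g,k′-1), where g = k′
  -- + e.
  centres-suffice : ∀ a {y} → a * k′ ≡ 2 + e → y * a ≤ (k′ + e) C k′ → y ≤ (k′ + e) C (s + u)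
  centres-suffice a {y} ak≡ ya≤ = *-cancelʳ-≤ y S (2 + e) (begin
    y * (2 + e)               ≡⟨ cong (y *_) ak≡ ⟨
    y * (a * k′)              ≡⟨ *-assoc y a k′ ⟨
    y * a * k′                ≤⟨ *-monoˡ-≤ k′ ya≤ ⟩
    ((k′ + e) C k′) * k′
      ≡⟨ +-cancelʳ-≡ (S * (s + u)) _ _ (trans (C-row (k′ + e) (s + u)) (e₁ (s + u) e S)) ⟩
    (1 + e) * S               ≤⟨ *-monoˡ-≤ S (n≤1+n (1 + e)) ⟩
    (2 + e) * S               ≡⟨ *-comm (2 + e) S ⟩
    S * (2 + e)               ∎)
    where
    open ≤-Reasoning
    S = (k′ + e) C (s + u)
    e₁ : ∀ t e S → (1 + t + e) * S ≡ (1 + e) * S + S * t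
    e₁ = solve-∀

open QuotientEstimates using (bound₁; bound₂; centres-suffice)

-- Quotients n / k other than two

splitAt-injective : ∀ m {n} → Injective _≡_ _≡_ (splitAt m {n})
splitAt-injective m {n} {i} {j} eq =
  trans (sym (Fin.join-splitAt m n i)) (trans (cong (join m n) eq) (Fin.join-splitAt m n j))

remQuot-injective : ∀ {m} n → Injective _≡_ _≡_ (remQuot {m} n)
remQuot-injective {m} n {i} {j} eq =
  trans (sym (Fin.combine-remQuot {m} n i)) (trans (cong (uncurry combine) eq) (Fin.combine-remQuot {m} n j))

flatten : ∀ {A : Set} m {n} (f : Fin n → A) → Injective _≡_ _≡_ f →
          Σ (Fin (m + n) → Fin m ⊎ A) (Injective _≡_ _≡_)
flatten {A} m {n} f f-injective = Sum.map₂ f ∘ splitAt m , λ eq → splitAt-injective m (map₂-injective _ _ eq)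
  where
  map₂-injective : ∀ (x y : Fin m ⊎ Fin n) → Sum.map₂ f x ≡ Sum.map₂ f y → x ≡ y
  map₂-injective (inj₁ _) (inj₁ _) refl = refl
  map₂-injective (inj₂ _) (inj₂ _) eq = cong inj₂ (f-injective (inj₂-injective eq))

flatFamily : ∀ {m k b y} {I : Set} → 0 < k → 2 * suc k ≤ suc m → Dominators m (suc k) b I →
             (f : Fin y → I) → Injective _≡_ _≡_ f → BagFamily (K̄ (suc m) (suc k)) (Fin (m C k + y))
flatFamily {m} {k} {y = y} k>0 2k≤n D f f-injective =
  let (index , index-injective) = flatten (m C k) f f-injective in
  reindex (K̄ (suc m) (suc k)) index index-injective (dominatorFamily k>0 2k≤n D)

Large : ℕ → ℕ → Set
Large n k = ∃[ t ] χ (K̄ n k) ≤ t × BagFamily (K̄ n k) (Fin t)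

divisible : ∀ {q k m} → 0 < k → 2 ≤ q → q * suc k ≡ suc m → Large (suc m) (suc k)
divisible {q} {k} {m} k>0 q≥2 exact = m C k ,
  χ-bound q (m C k) (s≤s z≤n) (≤-reflexive exact) (≤-reflexive (*-cancelʳ-≡ _ _ (suc k) (begin
    (suc m C suc k) * suc k       ≡⟨ C-absorb m k ⟩
    suc m * (m C k)               ≡⟨ cong (_* (m C k)) exact ⟨
    q * suc k * (m C k)           ≡⟨ rearrange q (suc k) (m C k) ⟩
    (m C k) * q * suc k           ∎))) ,
  cliqueFamily k>0 (≤-trans (*-monoˡ-≤ (suc k) q≥2) (≤-reflexive exact))
  where
  open ≡-Reasoning
  rearrange : ∀ q k c → q * k * c ≡ c * q * k
  rearrange = solve-∀

-- With m = 2 q and k = 2 one has C(m+1,2) = (m + 1) q, so m + 1 colours suffice, which is the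
-- clique of size m and a single star.
odd-pairs : ∀ h → Large (suc (2 * (2 + h))) 2
odd-pairs h = subst (λ n → Large (suc n) 2) m≡ (m C 1 + 1 ,
  χ-bound (2 + h) (m C 1 + 1) (s≤s z≤n) (≤-trans (≤-reflexive (trans (*-comm (2 + h) 2) (sym m≡))) (n≤1+n m))
    (≤-reflexive (*-cancelʳ-≡ _ _ 2 (begin
      (suc m C 2) * 2                  ≡⟨ C-absorb m 1 ⟩
      suc m * (m C 1)                  ≡⟨ cong₂ _*_ (+-comm 1 m) (trans (nC1≡n m) m≡) ⟩
      (m + 1) * (2 * (2 + h))          ≡⟨ rearrange (m + 1) (2 + h) ⟩
      (m + 1) * (2 + h) * 2            ≡⟨ cong (λ z → (z + 1) * (2 + h) * 2) (nC1≡n m) ⟨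
      (m C 1 + 1) * (2 + h) * 2        ∎))) ,
  flatFamily (s≤s z≤n) (s≤s (s≤s (s≤s (s≤s z≤n)))) (pairs-dominator (h + suc h)) id id)
  where
  open ≡-Reasoning
  m = 3 + (h + suc h)
  m≡ : m ≡ 2 * (2 + h)
  m≡ = identity h
    where
    identity : ∀ h → 3 + (h + suc h) ≡ 2 * (2 + h)
    identity = solve-∀
  rearrange : ∀ a b → a * (2 * b) ≡ a * b * 2
  rearrange = solve-∀

module LargeQuotient (p s u : ℕ) (s+u>0 : 0 < s + u) where

  private
    q  = 3 + p
    r  = 1 + s
    k′ = 1 + (s + u)
    k  = 1 + k′
    e  = (s + u) + ((1 + p) * k + s)
    g  = k′ + e
    m  = 3 + g
    B  = m C k′
    w  = 1 + g
    -- The largest number of disjoint k′-sets in the g + 1 points on which `rotate` acts.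
    a  = w div k′

    n≡ : suc m ≡ q * k + r
    n≡ = identity p s u
      where
      identity : ∀ p s u → 4 + (1 + (s + u) + ((s + u) + ((1 + p) * (2 + (s + u)) + s))) ≡
                           (3 + p) * (2 + (s + u)) + (1 + s)
      identity = solve-∀

    2k≤n : 2 * k ≤ suc m
    2k≤n = ≤-trans (*-monoˡ-≤ k {2} {q} (s≤s (s≤s z≤n))) (≤-trans (m≤m+n (q * k) r) (≤-reflexive (sym n≡)))

    w≡ : w ≡ w mod k′ + a * k′
    w≡ = m≡m%n+[m/n]*n w k′

    enough-colours : ∀ y → r * B ≤ 3 * q * k * y → suc m C k ≤ (B + 3 * y) * q
    enough-colours y bound = *-cancelʳ-≤ _ _ k (begin
      (suc m C k) * k               ≡⟨ C-absorb m k′ ⟩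
      suc m * B                     ≡⟨ cong (_* B) n≡ ⟩
      (q * k + r) * B               ≡⟨ *-distribʳ-+ B (q * k) r ⟩
      q * k * B + r * B             ≤⟨ +-monoʳ-≤ (q * k * B) bound ⟩
      q * k * B + 3 * q * k * y     ≡⟨ rearrange q k B y ⟩
      (B + 3 * y) * q * k           ∎)
      where
      open ≤-Reasoning
      rearrange : ∀ q k B y → q * k * B + 3 * q * k * y ≡ (B + 3 * y) * q * k
      rearrange = solve-∀

    conclude : ∀ {b} y → r * B ≤ 3 * q * k * y → Dominators m k b (Fin 3 × Fin y) → Large (suc m) k
    conclude y bound D = B + 3 * y ,
      χ-bound q (B + 3 * y) (s≤s z≤n) (≤-trans (m≤m+n (q * k) r) (≤-reflexive (sym n≡))) (enough-colours y bound) ,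
      flatFamily (s≤s z≤n) 2k≤n D (remQuot y) (remQuot-injective {3} y)

    packed : ∀ G d .{{_ : NonZero d}} → G ≤ G div suc d * suc d + d
    packed G d = ≤-trans (≤-reflexive (m≡m%n+[m/n]*n G (suc d)))
      (≤-trans (+-monoˡ-≤ (G div suc d * suc d) (≤-pred (m%n<n G (suc d)))) (≤-reflexive (+-comm d _)))

    one-point : ∀ b → a ≡ suc b → suc (w mod k′) < k′ → Large (suc m) k
    one-point b a≡ ρ<k = conclude y
      (bound₁ p s u s+u>0 (suc b) {y} ak≤ (packed G (suc b)))
      (through-one-point {g} {k′} {b} {y} (s≤s z≤n) (≤-trans (m≤m+n k′ e) (n≤1+n g)) ak≤ wide (m/n*n≤m G (2 + b)))
      where
      open ≤-Reasoning
      G = w C k′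
      y = G div (2 + b)
      ak≤ : suc b * k′ ≤ w
      ak≤ = subst (λ a → a * k′ ≤ w) a≡ (m/n*n≤m w k′)
      wide : g + 3 ≤ (2 + b) * k′
      wide = begin
        g + 3                          ≡⟨ +-comm g 3 ⟩
        2 + w                          ≡⟨ cong (2 +_) w≡ ⟩
        2 + (w mod k′) + a * k′          ≤⟨ +-monoˡ-≤ (a * k′) ρ<k ⟩
        k′ + a * k′                    ≡⟨ cong (λ a → k′ + a * k′) a≡ ⟩
        (2 + b) * k′                   ∎

    two-points : ∀ b → a ≡ 2 + b → a * k′ ≡ 2 + e → Large (suc m) k
    two-points b a≡ ak≡ = conclude y
      (bound₂ p s u s+u>0 (2 + b) {y} ak≡′ (≤-trans (packed G (suc b)) (+-monoʳ-≤ (y * (2 + b)) (n≤1+n (suc b)))))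
      (through-two-points {g} {s + u} {b} {y} s+u>0 (m≤m+n k′ e) exact (m/n*n≤m G (2 + b))
        (centres-suffice p s u s+u>0 (2 + b) {y} ak≡′ (m/n*n≤m G (2 + b))))
      where
      open ≡-Reasoning
      G = g C k′
      y = G div (2 + b)
      ak≡′ : (2 + b) * k′ ≡ 2 + e
      ak≡′ = subst (λ a → a * k′ ≡ 2 + e) a≡ ak≡
      exact : (3 + b) * k′ ≡ g + 2
      exact = begin
        k′ + (2 + b) * k′    ≡⟨ cong (k′ +_) ak≡′ ⟩
        k′ + (2 + e)         ≡⟨ cong (k′ +_) (+-comm 2 e) ⟩
        k′ + (e + 2)         ≡⟨ +-assoc k′ e 2 ⟨
        g + 2                ∎

    k′<2+e : k′ < 2 + e
    k′<2+e = s≤s (s≤s (m≤m+n (s + u) ((1 + p) * k + s)))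

  large-quotient : Large (q * k + r) k
  large-quotient = subst (λ n → Large n k) n≡ (by-remainder (suc (w mod k′) ≟ k′) a refl)
    where
    no-quotient : a ≢ 0
    no-quotient a≡0 = <⇒≱ (m%n<n w k′) (≤-trans (≤-trans (m≤m+n k′ e) (n≤1+n g))
      (≤-reflexive (trans w≡ (trans (cong (λ a → w mod k′ + a * k′) a≡0) (+-identityʳ _)))))

    ak≡ : suc (w mod k′) ≡ k′ → a * k′ ≡ 2 + e
    ak≡ eq = +-cancelˡ-≡ k′ _ _ (begin
      k′ + a * k′                    ≡⟨ cong (_+ a * k′) eq ⟨
      suc (w mod k′ + a * k′)          ≡⟨ cong suc w≡ ⟨
      suc (suc (k′ + e))             ≡⟨ cong suc (+-suc k′ e) ⟨
      suc (k′ + suc e)               ≡⟨ +-suc k′ (suc e) ⟨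
      k′ + (2 + e)                   ∎)
      where open ≡-Reasoning

    -- One-apex stars cover enough when w mod k′ ≤ k′ - 2. In the remaining residue two points are
    -- used, which takes at least two leaves; a = 1 would mean k′ = 2 + e, contrary to the size of
    -- e.
    by-remainder : Dec (suc (w mod k′) ≡ k′) → ∀ a′ → a ≡ a′ → Large (suc m) k
    by-remainder _        zero          a≡ = contradiction a≡ no-quotient
    by-remainder (no ρ≢)  (suc b)       a≡ = one-point b a≡ (≤∧≢⇒< (m%n<n w k′) ρ≢)
    by-remainder (yes ρ≡) (suc zero)    a≡ = contradiction
      (trans (sym (+-identityʳ k′)) (trans (cong (_* k′) (sym a≡)) (ak≡ ρ≡))) (<⇒≢ k′<2+e)
    by-remainder (yes ρ≡) (suc (suc b)) a≡ = two-points b a≡ (ak≡ ρ≡)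

open LargeQuotient using (large-quotient)

-- The quotient two

module CliqueEstimate (s u : ℕ) where

  private
    k′ = 1 + (s + u)
    k  = 1 + k′
    S  = k + s
    m  = k + S
    B  = m C k′
    N  = m C k
    D  = S C k
    Y  = S C k′
    X  = S C (s + u)

  Y+3X≤ : Y + 3 * X ≤ (3 + S) C k′
  Y+3X≤ = begin
    Y + 3 * X                      ≡⟨ rearrange X Y ⟩
    X + (X + (X + Y))              ≡⟨ cong (λ z → X + (X + z)) (nCk+nC[k+1]≡[n+1]C[k+1] S (s + u)) ⟩
    X + (X + ((1 + S) C k′))       ≤⟨ +-monoʳ-≤ X (step 1) ⟩
    X + ((2 + S) C k′)             ≤⟨ step 2 ⟩
    (3 + S) C k′                   ∎
    where
    open ≤-Reasoning
    rearrange : ∀ x y → y + 3 * x ≡ x + (x + (x + y))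
    rearrange = solve-∀
    step : ∀ j → X + ((j + S) C k′) ≤ (suc j + S) C k′
    step j = ≤-trans (+-monoˡ-≤ ((j + S) C k′) (C-mono (s + u) (m≤n+m S j)))
      (≤-reflexive (nCk+nC[k+1]≡[n+1]C[k+1] (j + S) (s + u)))

  -- Neighbouring entries in row S of Pascal's triangle give D k ≤ k′ Y and k′ Y ≤ k X. One copy of
  -- D is compared with Y and the other three with X.
  4D≤ : 4 * D ≤ Y + 3 * X
  4D≤ = *-cancelʳ-≤ _ _ k (begin
    4 * D * k                          ≡⟨ *-assoc 4 D k ⟩
    4 * (D * k)                        ≤⟨ *-monoʳ-≤ 4 Dk≤ ⟩
    4 * (k′ * Y)                       ≡⟨⟩
    k′ * Y + 3 * (k′ * Y)              ≤⟨ +-mono-≤ (*-monoˡ-≤ Y (n≤1+n k′)) (*-monoʳ-≤ 3 Yk≤) ⟩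
    k * Y + 3 * (k * X)                ≡⟨ rearrange k Y X ⟩
    (Y + 3 * X) * k                    ∎)
    where
    open ≤-Reasoning
    rearrange : ∀ k y x → k * y + 3 * (k * x) ≡ (y + 3 * x) * k
    rearrange = solve-∀
    Dk≤ : D * k ≤ k′ * Y
    Dk≤ = +-cancelʳ-≤ (Y * k′) _ _ (begin
      D * k + Y * k′          ≡⟨ C-row S k′ ⟩
      (1 + k′ + s) * Y
        ≤⟨ *-monoˡ-≤ Y (≤-trans (≤-reflexive (sym (+-suc k′ s))) (+-monoʳ-≤ k′ (s≤s (m≤m+n s u)))) ⟩
      (k′ + k′) * Y           ≡⟨ distribute₂ k′ Y ⟩
      k′ * Y + Y * k′         ∎)
      where
      distribute₂ : ∀ a b → (a + a) * b ≡ a * b + b * a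
      distribute₂ = solve-∀
    Yk≤ : k′ * Y ≤ k * X
    Yk≤ = +-cancelʳ-≤ (X * (s + u)) _ _ (begin
      k′ * Y + X * (s + u)        ≡⟨ cong (_+ X * (s + u)) (*-comm k′ Y) ⟩
      Y * k′ + X * (s + u)        ≡⟨ C-row S (s + u) ⟩
      (k + s) * X                 ≤⟨ *-monoˡ-≤ X (+-monoʳ-≤ k (m≤m+n s u)) ⟩
      (k + (s + u)) * X           ≡⟨ distribute₂ k (s + u) X ⟩
      k * X + X * (s + u)         ∎)
      where
      distribute₂ : ∀ a b c → (a + b) * c ≡ a * c + c * b
      distribute₂ = solve-∀

  -- Pascal's rule splits B into two entries of the row above: C(k′+S,k′) pays for 4 D, which uses
  -- k′ ≥ 3, and C(k′+S,k′-1) exceeds the power of two.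
  clique-large-generic : 2 ≤ s + u → 4 * D + 2 ^ (s + u) ≤ B
  clique-large-generic 2≤ = begin
    4 * D + 2 ^ (s + u)
      ≤⟨ +-mono-≤ (≤-trans 4D≤ (≤-trans Y+3X≤ (C-mono k′ (+-monoˡ-≤ S (s≤s 2≤)))))
                                                            (C-power (s + u) double) ⟩
    ((k′ + S) C k′) + ((k′ + S) C (s + u))      ≡⟨ +-comm ((k′ + S) C k′) _ ⟩
    ((k′ + S) C (s + u)) + ((k′ + S) C k′)      ≡⟨ nCk+nC[k+1]≡[n+1]C[k+1] (k′ + S) (s + u) ⟩
    B                                           ∎
    where
    open ≤-Reasoning
    double : 2 * (s + u) ≤ k′ + S
    double = +-mono-≤ (n≤1+n (s + u)) (≤-trans (≤-reflexive (+-identityʳ (s + u)))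
      (≤-trans (≤-trans (n≤1+n (s + u)) (n≤1+n k′)) (m≤m+n k s)))

open CliqueEstimate using (clique-large-generic)

clique-large : ∀ s u → 0 < s + u → let k = 2 + (s + u) in
               4 * ((k + s) C k) + 2 ^ (s + u) ≤ (k + (k + s)) C (1 + (s + u))
-- The two cases with k = 3 are numerical: 6 ≤ 15 and 18 ≤ 21.
clique-large 0             1             _ = ≤ᵇ⇒≤ _ _ _
clique-large 1             0             _ = ≤ᵇ⇒≤ _ _ _
clique-large 0             (suc (suc u)) _ = clique-large-generic 0 (suc (suc u)) (s≤s (s≤s z≤n))
clique-large 1             (suc u)       _ = clique-large-generic 1 (suc u) (s≤s (s≤s z≤n))
clique-large (suc (suc s)) u             _ = clique-large-generic (suc (suc s)) u (s≤s (s≤s z≤n))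

module QuotientTwo (s u : ℕ) (s+u>0 : 0 < s + u) where

  private
    k′ = 1 + (s + u)
    k  = 1 + k′
    S  = k + s
    m  = k + S
    B  = m C k′
    N  = m C k
    D  = S C k
    -- The largest number of triples that leaves 2 D sets in reserve for the greedy choice; M below
    -- is C(n,k) / 2 rounded up.
    x  = (N ∸ 2 * D) div 3
    M  = suc (B + N) div 2
    c  = χ (K̄ (suc m) k)

    Nk≡ : N * k ≡ (1 + S) * B
    Nk≡ = +-cancelʳ-≡ (B * k′) _ _ (trans (C-row m k′) (rearrange k′ S B))
      where
      rearrange : ∀ a b c → (1 + a + b) * c ≡ (1 + b) * c + c * a
      rearrange = solve-∀

    N≤2B : N ≤ 2 * B
    N≤2B = *-cancelʳ-≤ N (2 * B) k (begin
      N * k             ≡⟨ Nk≡ ⟩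
      (1 + S) * B
        ≤⟨ *-monoˡ-≤ B (≤-trans (≤-reflexive (sym (+-suc k s))) (+-monoʳ-≤ k (s≤s (≤-trans (m≤m+n s u) (n≤1+n (s + u)))))) ⟩
      (k + k) * B       ≡⟨ rearrange k B ⟩
      2 * B * k         ∎)
      where
      open ≤-Reasoning
      rearrange : ∀ a b → (a + a) * b ≡ 2 * b * a
      rearrange = solve-∀

    B≤N : B ≤ N
    B≤N = *-cancelʳ-≤ B N k (begin
      B * k             ≡⟨ *-comm B k ⟩
      k * B             ≤⟨ *-monoˡ-≤ B (≤-trans (m≤m+n k s) (n≤1+n S)) ⟩
      (1 + S) * B       ≡⟨ Nk≡ ⟨
      N * k             ∎)
      where open ≤-Reasoning

    4D+2^≤B : 4 * D + 2 ^ (s + u) ≤ B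
    4D+2^≤B = clique-large s u s+u>0

    2D≤N : 2 * D ≤ N
    2D≤N = ≤-trans (*-monoˡ-≤ D {2} {4} (s≤s (s≤s z≤n))) (≤-trans (m+n≤o⇒m≤o (4 * D) 4D+2^≤B) B≤N)

    fits : 3 * x + 2 * D ≤ N
    fits = begin
      3 * x + 2 * D                ≡⟨ cong (_+ 2 * D) (*-comm 3 x) ⟩
      x * 3 + 2 * D                ≤⟨ +-monoˡ-≤ (2 * D) (m/n*n≤m (N ∸ 2 * D) 3) ⟩
      (N ∸ 2 * D) + 2 * D          ≡⟨ m∸n+n≡m 2D≤N ⟩
      N                            ∎
      where open ≤-Reasoning

    maximal : N ≤ 3 * x + 2 + 2 * D
    maximal = begin
      N                                          ≡⟨ m∸n+n≡m 2D≤N ⟨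
      (N ∸ 2 * D) + 2 * D                        ≡⟨ cong (_+ 2 * D) (m≡m%n+[m/n]*n (N ∸ 2 * D) 3) ⟩
      (N ∸ 2 * D) mod 3 + x * 3 + 2 * D
        ≤⟨ +-monoˡ-≤ (2 * D) (+-monoˡ-≤ (x * 3) (≤-pred (m%n<n (N ∸ 2 * D) 3))) ⟩
      2 + x * 3 + 2 * D
        ≡⟨ cong (_+ 2 * D) (trans (+-comm 2 (x * 3)) (cong (_+ 2) (*-comm x 3))) ⟩
      3 * x + 2 + 2 * D                          ∎
      where open ≤-Reasoning

    c≤M : c ≤ M
    c≤M = χ-bound 2 M (s≤s z≤n) (≤-trans (+-monoʳ-≤ k (≤-trans (≤-reflexive (+-identityʳ k)) (m≤m+n k s))) (n≤1+n m))
      (begin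
        suc m C k                     ≡⟨ nCk+nC[k+1]≡[n+1]C[k+1] m k′ ⟨
        B + N                         ≤⟨ ≤-pred (begin
          suc (B + N)                 ≡⟨ m≡m%n+[m/n]*n (suc (B + N)) 2 ⟩
          suc (B + N) mod 2 + M * 2     ≤⟨ +-monoˡ-≤ (M * 2) (≤-pred (m%n<n (suc (B + N)) 2)) ⟩
          suc (M * 2)                 ∎) ⟩
        M * 2                         ∎)
      where open ≤-Reasoning

    -- Up to rounding, 6 (B + x) - 6 M = 6 B + 2 (N - 2 D) - 3 (B + N) = 3 B - N - 4 D, and N ≤ 2 B
    -- leaves B - 4 D. The constant 8 is 3 for rounding M up, 4 for rounding x down, and the 1
    -- beside the power of two.
    surplus : 6 * c + (2 ^ (s + u) + 1) ≤ 6 * (B + x) + 8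
    surplus = begin
      6 * c + (2 ^ (s + u) + 1)
        ≤⟨ +-monoˡ-≤ (2 ^ (s + u) + 1) (*-monoʳ-≤ 6 c≤M) ⟩
      6 * M + (2 ^ (s + u) + 1)                                ≡⟨ e₁ M (2 ^ (s + u)) ⟩
      3 * (M * 2) + (2 ^ (s + u) + 1)
        ≤⟨ +-monoˡ-≤ (2 ^ (s + u) + 1) (*-monoʳ-≤ 3 (m/n*n≤m (suc (B + N)) 2)) ⟩
      3 * suc (B + N) + (2 ^ (s + u) + 1)                      ≡⟨ e₂ B N (2 ^ (s + u)) ⟩
      N + 2 * N + (3 * B + 2 ^ (s + u) + 4)
        ≤⟨ +-monoˡ-≤ (3 * B + 2 ^ (s + u) + 4) (+-mono-≤ N≤2B (*-monoʳ-≤ 2 maximal)) ⟩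
      2 * B + 2 * (3 * x + 2 + 2 * D) + (3 * B + 2 ^ (s + u) + 4)  ≡⟨ e₃ B x D (2 ^ (s + u)) ⟩
      5 * B + 6 * x + 8 + (4 * D + 2 ^ (s + u))
        ≤⟨ +-monoʳ-≤ (5 * B + 6 * x + 8) 4D+2^≤B ⟩
      5 * B + 6 * x + 8 + B                                    ≡⟨ e₄ B x ⟩
      6 * (B + x) + 8                                          ∎
      where
      open ≤-Reasoning
      e₁ : ∀ M p → 6 * M + (p + 1) ≡ 3 * (M * 2) + (p + 1)
      e₁ = solve-∀
      e₂ : ∀ B N p → 3 * suc (B + N) + (p + 1) ≡ N + 2 * N + (3 * B + p + 4)
      e₂ = solve-∀
      e₃ : ∀ B x D p → 2 * B + 2 * (3 * x + 2 + 2 * D) + (3 * B + p + 4) ≡ 5 * B + 6 * x + 8 + (4 * D + p)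
      e₃ = solve-∀
      e₄ : ∀ B x → 5 * B + 6 * x + 8 + B ≡ 6 * (B + x) + 8
      e₄ = solve-∀

  double-quotient : ∃[ t ] χ (K̄ (suc m) k) ≤ t × BagFamily (K̄ (suc m) k) (Fin t) ×
                    6 * χ (K̄ (suc m) k) + (2 ^ (s + u) + 1) ≤ 6 * t + 11
  double-quotient = B + x , below , flatFamily (s≤s z≤n) 2k≤n
      (triples (s≤s z≤n) (+-monoʳ-≤ k (≤-trans (≤-reflexive (+-identityʳ k)) (m≤m+n k s))) wide
        (subst (λ d → 3 * x + 2 * (d C k) ≤ N) (sym (m+n∸m≡n k S)) fits)) id id ,
    -- The constant 8 is relaxed to the 11 of the theorem.
    ≤-trans surplus (+-monoʳ-≤ (6 * (B + x)) (s≤s (s≤s (s≤s (s≤s (s≤s (s≤s (s≤s (s≤s z≤n)))))))))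
    where
    open ≤-Reasoning
    2k≤n : 2 * k ≤ suc m
    2k≤n = ≤-trans (+-monoʳ-≤ k (≤-trans (≤-reflexive (+-identityʳ k)) (m≤m+n k s))) (n≤1+n m)
    wide : m + 2 ≤ 3 * k
    wide = begin
      k + (k + s) + 2         ≡⟨ e₁ k s ⟩
      k + (k + (2 + s))
        ≤⟨ +-monoʳ-≤ k (+-monoʳ-≤ k (≤-trans (s≤s (s≤s (m≤m+n s u))) (≤-reflexive (sym (+-identityʳ k))))) ⟩
      3 * k                   ∎
      where
      e₁ : ∀ k s → k + (k + s) + 2 ≡ k + (k + (2 + s))
      e₁ = solve-∀
    -- As 2^(s+u) ≥ 2, the surplus gives 6 c ≤ 6 (B + x) + 5, and integrality removes the 5.
    below : c ≤ B + x
    below = ≤-pred (*-cancelˡ-< 6 c (suc (B + x)) (+-cancelʳ-≤ 2 _ _ (begin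
      suc (6 * c) + 2                 ≡⟨ e₁ c ⟩
      6 * c + (2 ^ 1 + 1)             ≤⟨ +-monoʳ-≤ (6 * c) (+-monoˡ-≤ 1 (^-monoʳ-≤ 2 s+u>0)) ⟩
      6 * c + (2 ^ (s + u) + 1)       ≤⟨ surplus ⟩
      6 * (B + x) + 8                 ≡⟨ e₂ (B + x) ⟩
      6 * suc (B + x) + 2             ∎)))
      where
      e₁ : ∀ c → suc (6 * c) + 2 ≡ 6 * c + 3
      e₁ = solve-∀
      e₂ : ∀ t → 6 * t + 8 ≡ 6 * suc t + 2
      e₂ = solve-∀

open QuotientTwo using (double-quotient)

-- The theorem

import Data.Integer.Base as ℤ
open import Data.Integer.Base using (+_)
import Data.Integer.Properties as ℤ
open import Data.Rational.Base as ℚ using (ℚ; _/_; mkℚ; 1ℚ; NonNegative)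
import Data.Rational.Properties as ℚ
open import Data.Rational.Solver using (module +-*-Solver)

-- Passage from natural to rational inequalities

fromℕ-mkℚ : ∀ n → fromℕ n ≡ mkℚ (+ n) 0 (coprime-sym (1-coprimeTo n))
fromℕ-mkℚ n = ℚ.normalize-coprime (coprime-sym (1-coprimeTo n))

fromℕ-+ : ∀ a b → fromℕ (a + b) ≡ fromℕ a ℚ.+ fromℕ b
fromℕ-+ a b = sym (trans (cong₂ ℚ._+_ (fromℕ-mkℚ a) (fromℕ-mkℚ b))
  (cong (_/ 1) (cong₂ ℤ._+_ (ℤ.*-identityʳ (+ a)) (ℤ.*-identityʳ (+ b)))))

fromℕ-* : ∀ a b → fromℕ (a * b) ≡ fromℕ a ℚ.* fromℕ b
fromℕ-* a b = sym (trans (cong₂ ℚ._*_ (fromℕ-mkℚ a) (fromℕ-mkℚ b)) (cong (_/ 1) (sym (ℤ.pos-* a b))))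

fromℕ-mono : ∀ {a b} → a ≤ b → fromℕ a ℚ.≤ fromℕ b
fromℕ-mono {a} {b} a≤b = subst₂ ℚ._≤_ (sym (fromℕ-mkℚ a)) (sym (fromℕ-mkℚ b))
  (ℚ.*≤* (ℤ.*-monoʳ-≤-nonNeg (+ 1) (ℤ.+≤+ a≤b)))

-- The induction step is 3 (2^j + 1) ≤ 2 (2^(j+1) + 1), which amounts to 1 ≤ 2^j. With j = k - 2
-- this turns the surplus into the power of 1.5 in the theorem.
3/2-power : ∀ j → (+ 3 / 2) ^ℚ suc j ℚ.≤ fromℕ (2 ^ j + 1)
3/2-power zero    = ℚ.≤ᵇ⇒≤ _
3/2-power (suc j) = begin
  (+ 3 / 2) ℚ.* (+ 3 / 2) ^ℚ suc j                 ≤⟨ ℚ.*-monoˡ-≤-nonNeg (+ 3 / 2) (3/2-power j) ⟩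
  (+ 3 / 2) ℚ.* fromℕ a                            ≡⟨ ℚ.*-assoc (+ 1 / 2) (fromℕ 3) (fromℕ a) ⟩
  (+ 1 / 2) ℚ.* (fromℕ 3 ℚ.* fromℕ a)              ≡⟨ cong ((+ 1 / 2) ℚ.*_) (fromℕ-* 3 a) ⟨
  (+ 1 / 2) ℚ.* fromℕ (3 * a)
    ≤⟨ ℚ.*-monoˡ-≤-nonNeg (+ 1 / 2) (fromℕ-mono 3a≤2b) ⟩
  (+ 1 / 2) ℚ.* fromℕ (2 * b)                      ≡⟨ cong ((+ 1 / 2) ℚ.*_) (fromℕ-* 2 b) ⟩
  (+ 1 / 2) ℚ.* (fromℕ 2 ℚ.* fromℕ b)              ≡⟨ ℚ.*-assoc (+ 1 / 2) (fromℕ 2) (fromℕ b) ⟨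
  1ℚ ℚ.* fromℕ b                                   ≡⟨ ℚ.*-identityˡ (fromℕ b) ⟩
  fromℕ b                                          ∎
  where
  open ℚ.≤-Reasoning
  a = 2 ^ j + 1
  b = 2 ^ suc j + 1
  3a≤2b : 3 * a ≤ 2 * b
  3a≤2b = ≤-trans (≤-reflexive (e₁ (2 ^ j))) (≤-trans (+-monoʳ-≤ (3 * 2 ^ j + 2) (m^n>0 2 j)) (≤-reflexive (e₂ (2 ^ j))))
    where
    e₁ : ∀ p → 3 * (p + 1) ≡ 3 * p + 2 + 1
    e₁ = solve-∀
    e₂ : ∀ p → 3 * p + 2 + p ≡ 2 * (2 * p + 1)
    e₂ = solve-∀

scaled-gap : ∀ ι d {E P} h x c .{{_ : NonNegative ι}} → ι ℚ.* fromℕ d ≡ 1ℚ → E ℚ.≤ fromℕ P → d * x + P ≤ d * h + c →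
             ι ℚ.* (E ℚ.- fromℕ c) ℚ.≤ fromℕ h ℚ.- fromℕ x
scaled-gap ι d {E} {P} h x c inverse E≤P bound = begin
  ι ℚ.* (E ℚ.- F c)
    ≡⟨ cong (ι ℚ.*_) (e₁ E (F c) (F d ℚ.* F x)) ⟩
  ι ℚ.* ((F d ℚ.* F x ℚ.+ E) ℚ.- (F c ℚ.+ F d ℚ.* F x))
    ≤⟨ ℚ.*-monoˡ-≤-nonNeg ι (ℚ.+-monoˡ-≤ (ℚ.- (F c ℚ.+ F d ℚ.* F x)) sum-bound) ⟩
  ι ℚ.* ((F d ℚ.* F h ℚ.+ F c) ℚ.- (F c ℚ.+ F d ℚ.* F x))  ≡⟨ e₂ ι (F d) (F h) (F c) (F x) ⟩
  (ι ℚ.* F d) ℚ.* (F h ℚ.- F x)                            ≡⟨ cong (ℚ._* (F h ℚ.- F x)) inverse ⟩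
  1ℚ ℚ.* (F h ℚ.- F x)                                     ≡⟨ ℚ.*-identityˡ _ ⟩
  F h ℚ.- F x                                              ∎
  where
  open ℚ.≤-Reasoning
  F = fromℕ
  sum-bound : F d ℚ.* F x ℚ.+ E ℚ.≤ F d ℚ.* F h ℚ.+ F c
  sum-bound = begin
    F d ℚ.* F x ℚ.+ E           ≤⟨ ℚ.+-monoʳ-≤ (F d ℚ.* F x) E≤P ⟩
    F d ℚ.* F x ℚ.+ F P         ≡⟨ cong (ℚ._+ F P) (fromℕ-* d x) ⟨
    F (d * x) ℚ.+ F P           ≡⟨ fromℕ-+ (d * x) P ⟨
    F (d * x + P)               ≤⟨ fromℕ-mono bound ⟩
    F (d * h + c)               ≡⟨ fromℕ-+ (d * h) c ⟩
    F (d * h) ℚ.+ F c           ≡⟨ cong (ℚ._+ F c) (fromℕ-* d h) ⟩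
    F d ℚ.* F h ℚ.+ F c         ∎
  open +-*-Solver
  e₁ : ∀ E c y → E ℚ.- c ≡ (y ℚ.+ E) ℚ.- (c ℚ.+ y)
  e₁ = solve 3 (λ E c y → E :- c := (y :+ E) :- (c :+ y)) refl
  e₂ : ∀ ι d h c x → ι ℚ.* ((d ℚ.* h ℚ.+ c) ℚ.- (c ℚ.+ d ℚ.* x)) ≡ (ι ℚ.* d) ℚ.* (h ℚ.- x)
  e₂ = solve 5 (λ ι d h c x → ι :* ((d :* h :+ c) :- (c :+ d :* x)) := (ι :* d) :* (h :- x)) refl

≤hₒ : ∀ {G t} → BagFamily G (Fin t) → t ≤ hₒ G
≤hₒ {G} F = proj₂ (hₒ-isOddHadwigerNumber G) (oddMinor G F)

large-remainder⁺ : ∀ h s u → 0 < s + u → Large (suc s + (2 + h) * (2 + (s + u))) (2 + (s + u))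
large-remainder⁺ zero s u s+u>0 =
  let (t , χ≤t , F , _) = double-quotient s u s+u>0 in
  subst (λ n → Large n (2 + (s + u))) (rearrange (2 + (s + u)) s) (t , χ≤t , F)
  where
  rearrange : ∀ k s → suc (k + (k + s)) ≡ suc s + 2 * k
  rearrange = solve-∀
large-remainder⁺ (suc p) s u s+u>0 =
  subst (λ n → Large n (2 + (s + u))) (+-comm ((3 + p) * (2 + (s + u))) (1 + s)) (large-quotient p s u s+u>0)

large-remainder : ∀ q s u → 2 ≤ q → Large (suc s + q * (2 + (s + u))) (2 + (s + u))
large-remainder 1 _ _ (s≤s ())
large-remainder (suc (suc h)) zero zero _ =
  subst (λ n → Large (suc n) 2) (*-comm 2 (2 + h)) (odd-pairs h)
large-remainder (suc (suc h)) (suc s) u _ = large-remainder⁺ h (suc s) u (s≤s z≤n)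
large-remainder (suc (suc h)) zero (suc u) _ = large-remainder⁺ h zero (suc u) (s≤s z≤n)

large : ∀ n k → 4 ≤ 2 * k → 2 * k ≤ n → Large n k
large n 0 () _
large n 1 (s≤s (s≤s ())) _
large n k@(suc (suc κ)) _ 2k≤n = by-remainder (n mod k) (n div k) quotient≥2 (m%n<n n k) (m≡m%n+[m/n]*n n k)
  where
  quotient≥2 : 2 ≤ n div k
  quotient≥2 = ≤-trans (≤-reflexive (sym (m*n/n≡m 2 k))) (/-monoˡ-≤ k 2k≤n)

  by-remainder : ∀ r q → 2 ≤ q → r < k → n ≡ r + q * k → Large n k
  by-remainder zero    (suc q) q≥2 _   n≡ = subst (λ n → Large n k) (sym n≡)
    (divisible {suc q} {suc κ} {suc κ + q * k} (s≤s z≤n) q≥2 refl)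
  by-remainder (suc s) q       q≥2 r<k n≡ =
    let (u , s+u≡κ) = m≤n⇒∃[o]m+o≡n (≤-pred (≤-pred r<k)) in
    subst₂ Large (trans (cong (λ κ → suc s + q * (2 + κ)) s+u≡κ) (sym n≡)) (cong (λ κ → 2 + κ) s+u≡κ)
      (large-remainder q s u q≥2)

-- Throughout this range n / k has quotient two, with s = n - 2k - 1 and u = 3k - 1 - n. Thus the
-- bound stated for n = 3k - 1 is available in the whole range.
surplus-range : ∀ n k → 3 ≤ k → 2 * k + 1 ≤ n → n ≤ 3 * k ∸ 1 →
                ∃[ P ] (+ 3 / 2) ^ℚ (k ∸ 1) ℚ.≤ fromℕ P × 6 * χ (K̄ n k) + P ≤ 6 * hₒ (K̄ n k) + 11
surplus-range n (suc k) 3≤k lower upper with m≤n⇒∃[o]m+o≡n lower | m≤n⇒∃[o]m+o≡n upper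
... | s , refl | u , range = transport k≡ 3≤k
  where
  k≡ : k ≡ 1 + (s + u)
  k≡ = +-cancelˡ-≡ (2 * k + 2) _ _ (trans (e₁ k) (trans (sym range) (e₂ k s u)))
    where
    e₁ : ∀ k → 2 * k + 2 + k ≡ k + (suc k + (suc k + 0))
    e₁ = solve-∀
    e₂ : ∀ k s u → 2 * suc k + 1 + s + u ≡ 2 * k + 2 + (1 + (s + u))
    e₂ = solve-∀

  transport : ∀ {k} → k ≡ 1 + (s + u) → 3 ≤ suc k →
              ∃[ P ] (+ 3 / 2) ^ℚ k ℚ.≤ fromℕ P ×
                     6 * χ (K̄ (2 * suc k + 1 + s) (suc k)) + P ≤ 6 * hₒ (K̄ (2 * suc k + 1 + s) (suc k)) + 11
  transport refl (s≤s (s≤s s+u>0)) = 2 ^ (s + u) + 1 , 3/2-power (s + u) ,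
    subst (λ n → 6 * χ (K̄ n (2 + (s + u))) + (2 ^ (s + u) + 1) ≤ 6 * hₒ (K̄ n (2 + (s + u))) + 11)
      (rearrange (2 + (s + u)) s)
      (let (t , _ , F , surplus) = double-quotient s u s+u>0 in
       ≤-trans surplus (+-monoˡ-≤ 11 (*-monoʳ-≤ 6 (≤hₒ F))))
    where
    rearrange : ∀ k s → suc (k + (k + s)) ≡ 2 * k + 1 + s
    rearrange = solve-∀

theorem1p1 : (n k : ℕ) → 4 ≤ 2 * k → 2 * k ≤ n →
    (χ (K̄ n k) ≤ hₒ (K̄ n k))
    × (∃[ t ] χ (K̄ n k) ≤ t × Σ (CompleteMinor (K̄ n k) t) StronglyOneShallow)
    × (3 ≤ k →
    (2 * k + 1 ≤ n → n ≤ 3 * k ∸ 2 →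
    fromℕ (hₒ (K̄ n k)) ℚ.- fromℕ (χ (K̄ n k))
    ℚ.≥ (+ 1 / 12) ℚ.* ((+ 3 / 2) ^ℚ (k ∸ 1) ℚ.- fromℕ (8 * k) ℚ.- fromℕ 2))
    × (n ≡ 3 * k ∸ 1 →
    fromℕ (hₒ (K̄ n k)) ℚ.- fromℕ (χ (K̄ n k))
    ℚ.≥ (+ 1 / 6) ℚ.* ((+ 3 / 2) ^ℚ (k ∸ 1) ℚ.- fromℕ 11)))
theorem1p1 n k 4≤2k 2k≤n =
  let (t , χ≤t , F) = large n k 4≤2k 2k≤n in
  ≤-trans χ≤t (≤hₒ F) ,
  (t , χ≤t , completeMinor (K̄ n k) F) ,
  λ 3≤k →
    (λ lower upper →
      let (P , E≤P , surplus) = surplus-range n k 3≤k lower (≤-trans upper (∸-monoʳ-≤ (3 * k) (s≤s z≤n))) in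
      subst (λ z → (+ 1 / 12) ℚ.* z ℚ.≤ fromℕ (hₒ (K̄ n k)) ℚ.- fromℕ (χ (K̄ n k)))
        (minus-sum ((+ 3 / 2) ^ℚ (k ∸ 1)))
        (scaled-gap (+ 1 / 12) 12 (hₒ (K̄ n k)) (χ (K̄ n k)) (8 * k + 2) refl E≤P
          (twelvefold (χ (K̄ n k)) (hₒ (K̄ n k)) P surplus 3≤k))) ,
    (λ n≡ →
      let (P , E≤P , surplus) = surplus-range n k 3≤k (in-range 3≤k n≡) (≤-reflexive n≡) in
      scaled-gap (+ 1 / 6) 6 (hₒ (K̄ n k)) (χ (K̄ n k)) 11 refl E≤P surplus)
  where
  minus-sum : ∀ E → E ℚ.- fromℕ (8 * k + 2) ≡ E ℚ.- fromℕ (8 * k) ℚ.- fromℕ 2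
  minus-sum E = trans (cong (λ z → E ℚ.- z) (fromℕ-+ (8 * k) 2))
    (solve 3 (λ E a b → E :- (a :+ b) := E :- a :- b) refl E (fromℕ (8 * k)) (fromℕ 2))
    where open +-*-Solver

  -- Doubling the sixfold bound gives the constant 22, and 22 ≤ 26 = 8 * 3 + 2 ≤ 8 k + 2; one of the
  -- two copies of P is dropped.
  twelvefold : ∀ x h P → 6 * x + P ≤ 6 * h + 11 → 3 ≤ k → 12 * x + P ≤ 12 * h + (8 * k + 2)
  twelvefold x h P surplus 3≤k = begin
    12 * x + P              ≤⟨ +-monoʳ-≤ (12 * x) (m≤m+n P (P + 0)) ⟩
    12 * x + 2 * P          ≡⟨ e₁ x P ⟩
    2 * (6 * x + P)         ≤⟨ *-monoʳ-≤ 2 surplus ⟩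
    2 * (6 * h + 11)        ≡⟨ e₂ h ⟩
    12 * h + 22
      ≤⟨ +-monoʳ-≤ (12 * h) (≤-trans (≤ᵇ⇒≤ 22 26 _) (+-monoˡ-≤ 2 (*-monoʳ-≤ 8 3≤k))) ⟩
    12 * h + (8 * k + 2)    ∎
    where
    open ≤-Reasoning
    e₁ : ∀ x P → 12 * x + 2 * P ≡ 2 * (6 * x + P)
    e₁ = solve-∀
    e₂ : ∀ h → 2 * (6 * h + 11) ≡ 12 * h + 22
    e₂ = solve-∀

  in-range : 3 ≤ k → n ≡ 3 * k ∸ 1 → 2 * k + 1 ≤ n
  in-range 3≤k n≡ = ≤-trans (m+n≤o⇒m≤o∸n (2 * k + 1) (≤-trans (≤-reflexive (+-assoc (2 * k) 1 1))
    (≤-trans (+-monoʳ-≤ (2 * k) (≤-trans (n≤1+n 2) 3≤k)) (≤-reflexive (+-comm (2 * k) k))))) (≤-reflexive (sym n≡))
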